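{- For every sufficiently large integer $n$, \[ \frac{0.25}{n} \leq \mathbf{d}(Q_n, C_4, C_6) \leq \frac{0.36578}{n}. \]
   Context: $Q_n$ denotes the $n$-dimensional hypercube: its vertices are the binary vectors of length $n$, two vectors being adjacent iff they differ in exactly one coordinate. $C_m$ is the cycle on $m$ vertices. For graphs $G$ and $T$, a copy of $T$ in $G$ is a subgraph of $G$ isomorphic to $T$, and $N(G,T)$ is the number of copies of $T$ in $G$. A graph is $H$-free if it has no subgraph isomorphic to $H$. For subgraphs $T,H$ of $G$, $\mathrm{ex}(G,T,H)=\max\{N(G',T): G'\subseteq G,\ G' \text{ is } H\text{ -free}\}$ and $\mathbf{d}(G,T,H)=\mathrm{ex}(G,T,H)/N(G,T)$. -}

module Defs where

open import Data.Bool using (Bool; true; false; _∧_; not; if_then_else_)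
open import Data.Nat using (ℕ; zero; suc; _+_; _*_; _/_; _≡ᵇ_)
open import Data.Vec using (Vec; []; _∷_)
open import Data.List using (List; []; _∷_; _++_; map; concatMap; length; filterᵇ)
open import Data.Bool.ListAction using (any)
open import Data.Product using (Σ; _×_; _,_; ∃-syntax)
open import Relation.Binary.PropositionalEquality using (_≡_)
open import Relation.Nullary using (¬_)

Vertex : ℕ → Set
Vertex n = Vec Bool n

allVertices : (n : ℕ) → List (Vertex n)
allVertices zero = [] ∷ []
allVertices (suc n) = map (true ∷_) (allVertices n) ++ map (false ∷_) (allVertices n)

eqBit : Bool → Bool → Bool
eqBit true true = true
eqBit false false = true
eqBit _ _ = false

eqV : ∀ {n} → Vertex n → Vertex n → Bool
eqV [] [] = true
eqV (a ∷ u) (b ∷ v) = eqBit a b ∧ eqV u v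

hamming : ∀ {n} → Vertex n → Vertex n → ℕ
hamming [] [] = 0
hamming (a ∷ u) (b ∷ v) = (if eqBit a b then 0 else 1) + hamming u v

adjQ : ∀ {n} → Vertex n → Vertex n → Bool
adjQ u v = hamming u v ≡ᵇ 1

-- A subgraph of Q_n (on the full vertex set; isolated vertices do not
-- affect any of the counts below): a symmetric edge relation contained
-- in the edge relation of Q_n.
record Subgraph (n : ℕ) : Set where
  field
    edge : Vertex n → Vertex n → Bool
    symm : ∀ u v → edge u v ≡ edge v u
    sub  : ∀ u v → edge u v ≡ true → adjQ u v ≡ true
open Subgraph public

Q : (n : ℕ) → Subgraph n
Q n = record { edge = adjQ ; symm = adjSym ; sub = λ u v e → e }
  where
  eqBitSym : ∀ a b → eqBit a b ≡ eqBit b a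
  eqBitSym true true = _≡_.refl
  eqBitSym true false = _≡_.refl
  eqBitSym false true = _≡_.refl
  eqBitSym false false = _≡_.refl
  hamSym : ∀ {m} (u v : Vertex m) → hamming u v ≡ hamming v u
  hamSym [] [] = _≡_.refl
  hamSym (a ∷ u) (b ∷ v) rewrite eqBitSym a b | hamSym u v = _≡_.refl
  adjSym : ∀ u v → adjQ u v ≡ adjQ v u
  adjSym u v rewrite hamSym u v = _≡_.refl

distinct : ∀ {n} → List (Vertex n) → Bool
distinct [] = true
distinct (x ∷ xs) = not (any (eqV x) xs) ∧ distinct xs

isC4 : ∀ {n} → Subgraph n → Vertex n × Vertex n × Vertex n × Vertex n → Bool
isC4 G (a , b , c , d) =
  distinct (a ∷ b ∷ c ∷ d ∷ [])
  ∧ edge G a b ∧ edge G b c ∧ edge G c d ∧ edge G d a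

allQuads : (n : ℕ) → List (Vertex n × Vertex n × Vertex n × Vertex n)
allQuads n =
  concatMap (λ a → concatMap (λ b → concatMap (λ c → map (λ d → (a , b , c , d))
    (allVertices n)) (allVertices n)) (allVertices n)) (allVertices n)

labelledC4 : ∀ {n} → Subgraph n → ℕ
labelledC4 {n} G = length (filterᵇ (isC4 G) (allQuads n))

-- N(G, C4): number of copies of C4 in G.  Each copy (a 4-cycle subgraph)
-- corresponds to exactly 8 labelled 4-cycles (4 starting points × 2 directions).
numC4 : ∀ {n} → Subgraph n → ℕ
numC4 G = labelledC4 G / 8

HasC6 : ∀ {n} → Subgraph n → Set
HasC6 {n} G =
  ∃[ v0 ] ∃[ v1 ] ∃[ v2 ] ∃[ v3 ] ∃[ v4 ] ∃[ v5 ]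
    (distinct {n} (v0 ∷ v1 ∷ v2 ∷ v3 ∷ v4 ∷ v5 ∷ []) ≡ true
     × edge G v0 v1 ≡ true × edge G v1 v2 ≡ true × edge G v2 v3 ≡ true
     × edge G v3 v4 ≡ true × edge G v4 v5 ≡ true × edge G v5 v0 ≡ true)

C6Free : ∀ {n} → Subgraph n → Set
C6Free G = ¬ HasC6 G

{-# OPTIONS --safe #-}
module Submission where

-- Write E v i for the presence of the edge at v in direction i.
--
-- Lower bound: pair up the directions and keep an edge in direction i when the coordinates before the pair of i,
-- and those after it, have even sum. This keeps at least a quarter of the squares inside each pair, and every
-- 6-cycle of the cube contains an edge that violates one of the two parities.
--
-- Upper bound: two squares sharing an edge are surrounded by a 6-cycle, so every edge lies in at most one
-- 4-cycle, and it is enough to bound the number of edges by 0.36572 n 2ⁿ⁻¹ + O(2ⁿ). Only O(n 2ⁿ) squares have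
-- three or more edges, so these may be ignored, and the other 6-cycles to be avoided are the hexagons of the
-- 3-cubes. A flag algebra argument now applies. A potential u assigns a number to a square (v; i, j) together with
-- what v, v+i and v+j see of two further directions k and l. Its sum over the four vertices of the square is never
-- positive, so by translation invariance its average is not positive. A quadratic form y, applied to what is seen
-- of k and of l, is nonnegative on average. For any four directions, κ times the number of edges at v is at most A
-- plus the sum of 1000 u - y over the six squares that they span at v, which on average gives a density of at
-- most A / 4κ. The two inequalities are finite checks.

open import Defs
open import Data.Bool using (Bool; true; false; _∧_; _∨_; not; _xor_; if_then_else_)
import Data.Bool.Properties as Bool
open import Data.Bool.Properties using (not-involutive; ∧-conicalˡ; ∧-conicalʳ; ∨-conicalˡ; ∨-conicalʳ; T-≡)
open import Data.Bool.ListAction using (any)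
open import Data.Empty using (⊥; ⊥-elim)
open import Data.Fin using (Fin; zero; suc; _≟_; toℕ)
open import Data.Fin.Properties using (toℕ-injective; suc-injective; any?)
open import Data.Integer using (ℤ; +_; -[1+_]; 0ℤ; 1ℤ; _+_; _*_; _-_; -_; _⊖_; _≤_; _≤ᵇ_; +≤+; -≤+; +<+; nonNegative; positive)
import Data.Integer.Properties as ℤ
open import Data.Integer.Solver using (module +-*-Solver)
open import Data.List using (List; []; _∷_; _++_; map; concatMap; length; filterᵇ; allFin)
open import Data.List.Membership.Propositional using (_∈_)
open import Data.List.Membership.Propositional.Properties using (∈-allFin)
open import Data.List.Properties using (map-tabulate; length-tabulate)
open import Data.List.Relation.Unary.Any using (here; there)
open import Data.Nat as ℕ using (ℕ; zero; suc; _≡ᵇ_; _<ᵇ_; ⌊_/2⌋; z≤n; s≤s)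
import Data.Nat.DivMod as ℕ
import Data.Nat.Properties as ℕ
open import Data.Nat.Solver using () renaming (module +-*-Solver to ℕ-Solver)
open import Data.Product using (_×_; _,_; ∃-syntax; proj₁; proj₂)
open import Data.Sum using (_⊎_; inj₁; inj₂)
open import Data.Unit using (tt)
open import Data.Vec using (Vec; []; _∷_; lookup)
open import Data.Vec.Relation.Unary.All using (All; []; _∷_)
open import Data.Vec.Relation.Unary.AllPairs using (AllPairs; []; _∷_)
open import Function using (_∘_; id; Equivalence)
open import Relation.Binary.PropositionalEquality
open import Relation.Nullary using (contradiction; yes; no)

-- Finite sums

-- The order 1/n comes from comparing edges with squares: with at most one 4-cycle per edge there
-- are at most a quarter as many 4-cycles as edges, while the cube has n (n - 1) 2^(n-3) of them, so
-- an edge density d bounds the ratio by d / (n - 1). The gap between 0.36572 and 0.36578 absorbs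
-- the error terms and the n - 1 in place of n, once n is about 4 * 10^10.
--
-- The obstacle to the local inequality is size: a 4-cube has 32 edges, too many to enumerate all
-- its subgraphs. Hence only the 16 edges at a vertex v or at one of its neighbours are inspected.
-- Such a view does not know that the neighbours of v are vertices like v itself. The potential
-- restores this: it acts as a dual variable for the constraint that the statistics are the same
-- seen from each vertex of a square. Testing it takes only the 20 edges of two 3-cubes with a
-- common face.

private variable
  𝒳 𝒴 : Set

⟦_⟧ : Bool → ℤ
⟦ true ⟧ = 1ℤ
⟦ false ⟧ = 0ℤ

∑ : List 𝒳 → (𝒳 → ℤ) → ℤ
∑ [] f = 0ℤ
∑ (x ∷ xs) f = f x + ∑ xs f

∑-cong : ∀ (xs : List 𝒳) {f g} → (∀ x → f x ≡ g x) → ∑ xs f ≡ ∑ xs g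
∑-cong [] h = refl
∑-cong (x ∷ xs) h = cong₂ _+_ (h x) (∑-cong xs h)

∑-mono : ∀ (xs : List 𝒳) {f g} → (∀ x → f x ≤ g x) → ∑ xs f ≤ ∑ xs g
∑-mono [] h = ℤ.≤-refl
∑-mono (x ∷ xs) h = ℤ.+-mono-≤ (h x) (∑-mono xs h)

interchange : ∀ a b c d → (a + b) + (c + d) ≡ (a + c) + (b + d)
interchange = solve 4 (λ a b c d → (a :+ b) :+ (c :+ d) := (a :+ c) :+ (b :+ d)) refl
  where open +-*-Solver

∑-+ : ∀ (xs : List 𝒳) f g → ∑ xs (λ x → f x + g x) ≡ ∑ xs f + ∑ xs g
∑-+ [] f g = refl
∑-+ (x ∷ xs) f g = trans (cong (_+_ (f x + g x)) (∑-+ xs f g)) (interchange (f x) (g x) (∑ xs f) (∑ xs g))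

∑-*ˡ : ∀ (xs : List 𝒳) c f → ∑ xs (λ x → c * f x) ≡ c * ∑ xs f
∑-*ˡ [] c f = sym (ℤ.*-zeroʳ c)
∑-*ˡ (x ∷ xs) c f = trans (cong (_+_ (c * f x)) (∑-*ˡ xs c f)) (sym (ℤ.*-distribˡ-+ c (f x) (∑ xs f)))

∑-const : ∀ (xs : List 𝒳) c → ∑ xs (λ _ → c) ≡ + length xs * c
∑-const [] c = sym (ℤ.*-zeroˡ c)
∑-const (x ∷ xs) c = trans (cong (_+_ c) (∑-const xs c)) (sym (ℤ.suc-* (+ length xs) c))

∑-zero : ∀ (xs : List 𝒳) → ∑ xs (λ _ → 0ℤ) ≡ 0ℤ
∑-zero [] = refl
∑-zero (x ∷ xs) = trans (ℤ.+-identityˡ _) (∑-zero xs)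

∑-swap : ∀ (xs : List 𝒳) (ys : List 𝒴) (f : 𝒳 → 𝒴 → ℤ) →
  ∑ xs (λ x → ∑ ys (f x)) ≡ ∑ ys (λ y → ∑ xs (λ x → f x y))
∑-swap [] ys f = sym (∑-zero ys)
∑-swap (x ∷ xs) ys f = trans (cong (_+_ (∑ ys (f x))) (∑-swap xs ys f))
  (sym (∑-+ ys (f x) (λ y → ∑ xs (λ z → f z y))))

∑-++ : ∀ (xs ys : List 𝒳) f → ∑ (xs ++ ys) f ≡ ∑ xs f + ∑ ys f
∑-++ [] ys f = sym (ℤ.+-identityˡ _)
∑-++ (x ∷ xs) ys f = trans (cong (_+_ (f x)) (∑-++ xs ys f)) (sym (ℤ.+-assoc (f x) (∑ xs f) (∑ ys f)))

∑-map : ∀ (g : 𝒳 → 𝒴) xs f → ∑ (map g xs) f ≡ ∑ xs (f ∘ g)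
∑-map g [] f = refl
∑-map g (x ∷ xs) f = cong (_+_ (f (g x))) (∑-map g xs f)

∑-concatMap : ∀ (g : 𝒳 → List 𝒴) xs f → ∑ (concatMap g xs) f ≡ ∑ xs (λ x → ∑ (g x) f)
∑-concatMap g [] f = refl
∑-concatMap g (x ∷ xs) f = trans (∑-++ (g x) (concatMap g xs) f) (cong (_+_ (∑ (g x) f)) (∑-concatMap g xs f))

∑-filter : ∀ (p : 𝒳 → Bool) xs → + length (filterᵇ p xs) ≡ ∑ xs (λ x → ⟦ p x ⟧)
∑-filter p [] = refl
∑-filter p (x ∷ xs) with p x
... | true = cong (_+_ 1ℤ) (∑-filter p xs)
... | false = trans (∑-filter p xs) (sym (ℤ.+-identityˡ _))

⟦⟧-nonneg : ∀ b → 0ℤ ≤ ⟦ b ⟧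
⟦⟧-nonneg true = +≤+ z≤n
⟦⟧-nonneg false = +≤+ z≤n

∑-nonneg : ∀ (xs : List 𝒳) {f} → (∀ x → 0ℤ ≤ f x) → 0ℤ ≤ ∑ xs f
∑-nonneg xs {f} h = subst (_≤ ∑ xs f) (∑-zero xs) (∑-mono xs h)

∑ᵈ : ∀ n → (Fin n → ℤ) → ℤ
∑ᵈ n = ∑ (allFin n)

∑ᵛ : ∀ n → (Vertex n → ℤ) → ℤ
∑ᵛ n = ∑ (allVertices n)

∑ᵈ-suc : ∀ n f → ∑ᵈ (suc n) f ≡ f zero + ∑ᵈ n (f ∘ suc)
∑ᵈ-suc n f = cong (_+_ (f zero)) (trans (cong (λ xs → ∑ xs f) (sym (map-tabulate id suc))) (∑-map suc (allFin n) f))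

∑ᵛ-suc : ∀ n f → ∑ᵛ (suc n) f ≡ ∑ᵛ n (f ∘ (true ∷_)) + ∑ᵛ n (f ∘ (false ∷_))
∑ᵛ-suc n f = trans (∑-++ (map (true ∷_) (allVertices n)) _ f)
  (cong₂ _+_ (∑-map (true ∷_) (allVertices n) f) (∑-map (false ∷_) (allVertices n) f))

∑ᵈ-const : ∀ n c → ∑ᵈ n (λ _ → c) ≡ + n * c
∑ᵈ-const n c = trans (∑-const (allFin n) c) (cong (λ m → + m * c) (length-tabulate {n = n} id))

∑ᵛ-const : ∀ n c → ∑ᵛ n (λ _ → c) ≡ + (2 ℕ.^ n) * c
∑ᵛ-const zero c = trans (ℤ.+-identityʳ c) (sym (ℤ.*-identityˡ c))
∑ᵛ-const (suc n) c = trans (∑ᵛ-suc n (λ _ → c)) (trans (cong₂ _+_ (∑ᵛ-const n c) (∑ᵛ-const n c))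
  (trans (sym (ℤ.*-distribʳ-+ c (+ (2 ℕ.^ n)) (+ (2 ℕ.^ n))))
    (cong (λ m → + m * c) (cong (2 ℕ.^ n ℕ.+_) (sym (ℕ.+-identityʳ (2 ℕ.^ n)))))))

∑ᵈ-single : ∀ {n} (f : Fin n → ℤ) j → (∀ i → i ≢ j → f i ≡ 0ℤ) → ∑ᵈ n f ≡ f j
∑ᵈ-single {suc n} f zero h = trans (∑ᵈ-suc n f) (trans
  (cong (_+_ (f zero)) (trans (∑-cong (allFin n) (λ i → h (suc i) λ ())) (∑-zero (allFin n))))
  (ℤ.+-identityʳ (f zero)))
∑ᵈ-single {suc n} f (suc j) h = trans (∑ᵈ-suc n f) (trans
  (cong₂ _+_ (h zero λ ()) (∑ᵈ-single (f ∘ suc) j (λ i i≢j → h (suc i) λ { refl → i≢j refl })))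
  (ℤ.+-identityˡ _))

∑ᵈ-atMostOne : ∀ n (p : Fin n → Bool) → (∀ i j → p i ≡ true → p j ≡ true → i ≡ j) →
  ∑ᵈ n (λ i → ⟦ p i ⟧) ≤ 1ℤ
∑ᵈ-atMostOne zero p h = +≤+ z≤n
∑ᵈ-atMostOne (suc n) p h = split (p zero) refl
  where
  split : ∀ b → p zero ≡ b → ∑ᵈ (suc n) (λ i → ⟦ p i ⟧) ≤ 1ℤ
  split true eq = ℤ.≤-reflexive (trans (∑ᵈ-single (λ i → ⟦ p i ⟧) zero none) (cong ⟦_⟧ eq))
    where
    none : ∀ i → i ≢ zero → ⟦ p i ⟧ ≡ 0ℤ
    none i i≢0 with p i in pi
    ... | true = contradiction (h i zero pi eq) i≢0
    ... | false = refl
  split false eq = subst (_≤ 1ℤ)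
    (sym (trans (∑ᵈ-suc n (λ i → ⟦ p i ⟧)) (trans (cong (λ b → ⟦ b ⟧ + ∑ᵈ n (λ i → ⟦ p (suc i) ⟧)) eq) (ℤ.+-identityˡ _))))
    (∑ᵈ-atMostOne n (p ∘ suc) (λ i j pi pj → suc-injective (h (suc i) (suc j) pi pj)))

-- Translations of the cube along its directions.

flip : ∀ {n} → Fin n → Vertex n → Vertex n
flip zero (b ∷ v) = not b ∷ v
flip (suc i) (b ∷ v) = b ∷ flip i v

flip-flip : ∀ {n} (i : Fin n) v → flip i (flip i v) ≡ v
flip-flip zero (b ∷ v) = cong (_∷ v) (not-involutive b)
flip-flip (suc i) (b ∷ v) = cong (b ∷_) (flip-flip i v)

flip-comm : ∀ {n} (i j : Fin n) v → flip i (flip j v) ≡ flip j (flip i v)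
flip-comm zero zero v = refl
flip-comm zero (suc j) (b ∷ v) = refl
flip-comm (suc i) zero (b ∷ v) = refl
flip-comm (suc i) (suc j) (b ∷ v) = cong (b ∷_) (flip-comm i j v)

∑ᵛ-flip : ∀ {n} (i : Fin n) f → ∑ᵛ n (f ∘ flip i) ≡ ∑ᵛ n f
∑ᵛ-flip {suc n} zero f = trans (∑ᵛ-suc n (f ∘ flip zero))
  (trans (ℤ.+-comm (∑ᵛ n (f ∘ (false ∷_))) _) (sym (∑ᵛ-suc n f)))
∑ᵛ-flip {suc n} (suc i) f = trans (∑ᵛ-suc n (f ∘ flip (suc i)))
  (trans (cong₂ _+_ (∑ᵛ-flip i (f ∘ (true ∷_))) (∑ᵛ-flip i (f ∘ (false ∷_)))) (sym (∑ᵛ-suc n f)))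

private
  ∑ᵛ-*0 : ∀ {n} (f : Vertex n → ℤ) → ∑ᵛ n (λ b → 0ℤ * f b) ≡ 0ℤ
  ∑ᵛ-*0 {n} f = trans (∑-cong (allVertices n) λ b → ℤ.*-zeroˡ (f b)) (∑-zero (allVertices n))

∑ᵛ-same : ∀ {n} (a : Vertex n) (f : Vertex n → ℤ) → ∑ᵛ n (λ b → ⟦ hamming a b ≡ᵇ 0 ⟧ * f b) ≡ f a
∑ᵛ-same [] f = trans (ℤ.+-identityʳ (1ℤ * f [])) (ℤ.*-identityˡ (f []))
∑ᵛ-same {suc n} (true ∷ a) f = trans (∑ᵛ-suc n (λ b → ⟦ hamming (true ∷ a) b ≡ᵇ 0 ⟧ * f b)) (trans
  (cong₂ _+_ (∑ᵛ-same a (λ b → f (true ∷ b))) (∑ᵛ-*0 (λ b → f (false ∷ b))))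
  (ℤ.+-identityʳ (f (true ∷ a))))
∑ᵛ-same {suc n} (false ∷ a) f = trans (∑ᵛ-suc n (λ b → ⟦ hamming (false ∷ a) b ≡ᵇ 0 ⟧ * f b)) (trans
  (cong₂ _+_ (∑ᵛ-*0 (λ b → f (true ∷ b))) (∑ᵛ-same a (λ b → f (false ∷ b))))
  (ℤ.+-identityˡ (f (false ∷ a))))

-- In the induction a neighbour either keeps the first bit and moves in the tail, or changes the
-- first bit and keeps the tail; the latter case is `∑ᵛ-same`.
∑ᵛ-adj : ∀ {n} (a : Vertex n) (f : Vertex n → ℤ) →
  ∑ᵛ n (λ b → ⟦ adjQ a b ⟧ * f b) ≡ ∑ᵈ n (λ i → f (flip i a))
∑ᵛ-adj [] f = trans (ℤ.+-identityʳ (0ℤ * f [])) (ℤ.*-zeroˡ (f []))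
∑ᵛ-adj {suc n} (true ∷ a) f = trans (∑ᵛ-suc n (λ b → ⟦ adjQ (true ∷ a) b ⟧ * f b)) (trans
  (cong₂ _+_ (∑ᵛ-adj a (λ b → f (true ∷ b))) (∑ᵛ-same a (λ b → f (false ∷ b))))
  (trans (ℤ.+-comm (∑ᵈ n (λ i → f (true ∷ flip i a))) (f (false ∷ a)))
    (sym (∑ᵈ-suc n (λ i → f (flip i (true ∷ a)))))))
∑ᵛ-adj {suc n} (false ∷ a) f = trans (∑ᵛ-suc n (λ b → ⟦ adjQ (false ∷ a) b ⟧ * f b)) (trans
  (cong₂ _+_ (∑ᵛ-same a (λ b → f (true ∷ b))) (∑ᵛ-adj a (λ b → f (false ∷ b))))
  (sym (∑ᵈ-suc n (λ i → f (flip i (false ∷ a))))))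

-- Squares and 6-cycles of the cube

lookup-flip : ∀ {n} (i : Fin n) v → lookup (flip i v) i ≡ not (lookup v i)
lookup-flip zero (b ∷ v) = refl
lookup-flip (suc i) (b ∷ v) = lookup-flip i v

lookup-flip-≢ : ∀ {n} {i j : Fin n} v → i ≢ j → lookup (flip i v) j ≡ lookup v j
lookup-flip-≢ {i = zero} {zero} (b ∷ v) i≢j = contradiction refl i≢j
lookup-flip-≢ {i = zero} {suc j} (b ∷ v) i≢j = refl
lookup-flip-≢ {i = suc i} {zero} (b ∷ v) i≢j = refl
lookup-flip-≢ {i = suc i} {suc j} (b ∷ v) i≢j = lookup-flip-≢ v (i≢j ∘ cong suc)

b≢not : ∀ {b} → b ≢ not b
b≢not {true} ()
b≢not {false} ()

-- Both sides reach the same vertex in two steps from `a`, so they use the same two directions, and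
-- `i ≢ l` leaves only `j` for `l`. The proof reads a coordinate that only one side would change.
flip-parallelogram : ∀ {n} {i j l m : Fin n} a → i ≢ j → i ≢ l →
  flip j (flip i a) ≡ flip m (flip l a) → j ≡ l
flip-parallelogram {i = i} {j} {l} {m} a i≢j i≢l eq with j ≟ l
... | yes j≡l = j≡l
... | no j≢l with m ≟ l
...   | yes refl = contradiction (begin
        lookup a i ≡⟨ cong (λ v → lookup v i) (trans (sym (flip-flip l a)) (sym eq)) ⟩
        lookup (flip j (flip i a)) i ≡⟨ lookup-flip-≢ (flip i a) (i≢j ∘ sym) ⟩
        lookup (flip i a) i ≡⟨ lookup-flip i a ⟩
        not (lookup a i) ∎) b≢not
  where open ≡-Reasoning
...   | no m≢l = contradiction (begin
        lookup a l ≡⟨ lookup-flip-≢ a i≢l ⟨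
        lookup (flip i a) l ≡⟨ lookup-flip-≢ (flip i a) j≢l ⟨
        lookup (flip j (flip i a)) l ≡⟨ cong (λ v → lookup v l) eq ⟩
        lookup (flip m (flip l a)) l ≡⟨ lookup-flip-≢ (flip l a) m≢l ⟩
        lookup (flip l a) l ≡⟨ lookup-flip l a ⟩
        not (lookup a l) ∎) b≢not
  where open ≡-Reasoning

eqBit-refl : ∀ b → eqBit b b ≡ true
eqBit-refl true = refl
eqBit-refl false = refl

eqV-refl : ∀ {n} (v : Vertex n) → eqV v v ≡ true
eqV-refl [] = refl
eqV-refl (b ∷ v) = cong₂ _∧_ (eqBit-refl b) (eqV-refl v)

eqV-sound : ∀ {n} (u v : Vertex n) → eqV u v ≡ true → u ≡ v
eqV-sound [] [] h = refl
eqV-sound (true ∷ u) (true ∷ v) h = cong (true ∷_) (eqV-sound u v h)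
eqV-sound (false ∷ u) (false ∷ v) h = cong (false ∷_) (eqV-sound u v h)

hamming-refl : ∀ {n} (v : Vertex n) → hamming v v ≡ 0
hamming-refl [] = refl
hamming-refl (b ∷ v) rewrite eqBit-refl b = hamming-refl v

hamming≡0 : ∀ {n} (u v : Vertex n) → (hamming u v ≡ᵇ 0) ≡ true → u ≡ v
hamming≡0 [] [] h = refl
hamming≡0 (true ∷ u) (true ∷ v) h = cong (true ∷_) (hamming≡0 u v h)
hamming≡0 (false ∷ u) (false ∷ v) h = cong (false ∷_) (hamming≡0 u v h)

adjQ-flip : ∀ {n} (i : Fin n) v → adjQ v (flip i v) ≡ true
adjQ-flip zero (true ∷ v) rewrite hamming-refl v = refl
adjQ-flip zero (false ∷ v) rewrite hamming-refl v = refl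
adjQ-flip (suc i) (true ∷ v) = adjQ-flip i v
adjQ-flip (suc i) (false ∷ v) = adjQ-flip i v

adjQ⇒flip : ∀ {n} (u v : Vertex n) → adjQ u v ≡ true → ∃[ i ] v ≡ flip i u
adjQ⇒flip [] [] ()
adjQ⇒flip (true ∷ u) (true ∷ v) h with adjQ⇒flip u v h
... | i , eq = suc i , cong (true ∷_) eq
adjQ⇒flip (false ∷ u) (false ∷ v) h with adjQ⇒flip u v h
... | i , eq = suc i , cong (false ∷_) eq
adjQ⇒flip (true ∷ u) (false ∷ v) h = zero , cong (false ∷_) (sym (hamming≡0 u v h))
adjQ⇒flip (false ∷ u) (true ∷ v) h = zero , cong (true ∷_) (sym (hamming≡0 u v h))

any-∈ : ∀ {A : Set} (p : A → Bool) {y xs} → y ∈ xs → p y ≡ true → any p xs ≡ true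
any-∈ p {xs = x ∷ xs} (here refl) h rewrite h = refl
any-∈ p {xs = x ∷ xs} (there y∈) h with p x
... | true = refl
... | false = any-∈ p y∈ h

distinct-≢ : ∀ {n} {x y : Vertex n} {xs} → distinct (x ∷ xs) ≡ true → y ∈ xs → x ≢ y
distinct-≢ {x = x} {xs = xs} h y∈ refl
  with any (eqV x) xs | any-∈ (eqV x) y∈ (eqV-refl x)
distinct-≢ () y∈ refl | true | refl

-- 4-cycles indexed by a vertex and two directions.

module _ {n} (G : Subgraph n) where

  E : Vertex n → Fin n → Bool
  E v i = edge G v (flip i v)

  E-flip : ∀ i v → E (flip i v) i ≡ E v i
  E-flip i v = trans (cong (edge G (flip i v)) (flip-flip i v)) (symm G (flip i v) v)

  square : Vertex n → Fin n → Fin n → Bool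
  square a i l = isC4 G (a , flip i a , flip l (flip i a) , flip l a)

  record IsC4 (a b c d : Vertex n) : Set where
    constructor mkC4
    field
      a≢c : a ≢ c
      b≢d : b ≢ d
      ab : edge G a b ≡ true
      bc : edge G b c ≡ true
      cd : edge G c d ≡ true
      da : edge G d a ≡ true

  isC4-sound : ∀ a b c d → isC4 G (a , b , c , d) ≡ true → IsC4 a b c d
  isC4-sound a b c d h = mkC4
    (distinct-≢ {xs = b ∷ c ∷ d ∷ []} dist (there (here refl)))
    (distinct-≢ {xs = c ∷ d ∷ []} (∧-conicalʳ (not (any (eqV a) (b ∷ c ∷ d ∷ []))) _ dist) (there (here refl)))
    (∧-conicalˡ (edge G a b) _ e₁) (∧-conicalˡ (edge G b c) _ e₂)
    (∧-conicalˡ (edge G c d) _ e₃) (∧-conicalʳ (edge G c d) _ e₃)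
    where
    dist = ∧-conicalˡ (distinct (a ∷ b ∷ c ∷ d ∷ [])) _ h
    e₁ = ∧-conicalʳ (distinct (a ∷ b ∷ c ∷ d ∷ [])) _ h
    e₂ = ∧-conicalʳ (edge G a b) _ e₁
    e₃ = ∧-conicalʳ (edge G b c) _ e₂

  private
    vanish : ∀ {x y} → (x ≡ true → y ≡ true) → y ≡ false → ⟦ x ⟧ ≡ 0ℤ
    vanish {false} h y≡f = refl
    vanish {true} h y≡f with trans (sym (h refl)) y≡f
    ... | ()

    ∑-vanish : ∀ {A : Set} (xs : List A) {f} → (∀ x → f x ≡ 0ℤ) → ∑ xs f ≡ 0ℤ
    ∑-vanish xs h = trans (∑-cong xs h) (∑-zero xs)

    ∑ᵛ-neighbours : ∀ a (f : Vertex n → ℤ) → (∀ b → adjQ a b ≡ false → f b ≡ 0ℤ) →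
      ∑ᵛ n f ≡ ∑ᵈ n (λ i → f (flip i a))
    ∑ᵛ-neighbours a f h = trans (∑-cong (allVertices n) guarded) (∑ᵛ-adj a f)
      where
      guarded : ∀ b → f b ≡ ⟦ adjQ a b ⟧ * f b
      guarded b with adjQ a b in eq
      ... | true = sym (ℤ.*-identityˡ (f b))
      ... | false = trans (h b eq) (sym (ℤ.*-zeroˡ (f b)))

    quads : ∀ (p : Vertex n × Vertex n × Vertex n × Vertex n → ℤ) → ∑ (allQuads n) p ≡
      ∑ᵛ n (λ a → ∑ᵛ n (λ b → ∑ᵛ n (λ c → ∑ᵛ n (λ d → p (a , b , c , d)))))
    quads p = trans (∑-concatMap _ (allVertices n) p) (∑-cong (allVertices n) λ a →
      trans (∑-concatMap _ (allVertices n) p) (∑-cong (allVertices n) λ b →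
      trans (∑-concatMap _ (allVertices n) p) (∑-cong (allVertices n) λ c →
      ∑-map _ (allVertices n) p)))

    -- The edge from the third vertex to the fourth closes a parallelogram at `a`, which forces the
    -- direction of the second step.
    fourth : ∀ a i j l → j ≢ l → ⟦ isC4 G (a , flip i a , flip j (flip i a) , flip l a) ⟧ ≡ 0ℤ
    fourth a i j l j≢l with isC4 G (a , flip i a , flip j (flip i a) , flip l a) in eq
    ... | false = refl
    ... | true with isC4-sound a (flip i a) (flip j (flip i a)) (flip l a) eq
    ...   | c with adjQ⇒flip (flip j (flip i a)) (flip l a) (sub G (flip j (flip i a)) (flip l a) (IsC4.cd c))
    ...     | m , e = contradiction
      (flip-parallelogram {i = i} {j} {l} {m} a
        (λ { refl → IsC4.a≢c c (sym (flip-flip i a)) })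
        (λ { refl → IsC4.b≢d c refl })
        (trans (sym (flip-flip m (flip j (flip i a)))) (cong (flip m) (sym e))))
      j≢l

  -- The second and the fourth vertex are neighbours of the first, and the third is then forced by
  -- `fourth`. The sums over `c` and `d` are exchanged so that both neighbours of `a` are resolved
  -- before `c`.
  labelledC4≡∑square : + labelledC4 G ≡ ∑ᵛ n (λ a → ∑ᵈ n (λ i → ∑ᵈ n (λ l → ⟦ square a i l ⟧)))
  labelledC4≡∑square = trans (∑-filter (isC4 G) (allQuads n)) (trans (quads (λ q → ⟦ isC4 G q ⟧))
    (∑-cong V λ a → trans
      (∑ᵛ-neighbours a (λ b → ∑ V (λ c → ∑ V (λ d → ⟦ isC4 G (a , b , c , d) ⟧)))
        (λ b ¬adj → ∑-vanish V λ c → ∑-vanish V λ d →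
          vanish (λ h → sub G a b (IsC4.ab (isC4-sound a b c d h))) ¬adj))
      (∑-cong (allFin n) λ i → overC a i)))
    where
    V = allVertices n
    overD : ∀ a i l → let b = flip i a ; d = flip l a in
      ∑ V (λ c → ⟦ isC4 G (a , b , c , d) ⟧) ≡ ⟦ square a i l ⟧
    overD a i l = let b = flip i a ; d = flip l a in trans
      (∑ᵛ-neighbours b (λ c → ⟦ isC4 G (a , b , c , d) ⟧) (λ c ¬adj →
        vanish (λ h → sub G b c (IsC4.bc (isC4-sound a b c d h))) ¬adj))
      (∑ᵈ-single (λ j → ⟦ isC4 G (a , b , flip j b , d) ⟧) l (λ j → fourth a i j l))
    overC : ∀ a i → let b = flip i a in
      ∑ V (λ c → ∑ V (λ d → ⟦ isC4 G (a , b , c , d) ⟧)) ≡ ∑ᵈ n (λ l → ⟦ square a i l ⟧)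
    overC a i = let b = flip i a in trans (∑-swap V V (λ c d → ⟦ isC4 G (a , b , c , d) ⟧)) (trans
      (∑ᵛ-neighbours a (λ d → ∑ V (λ c → ⟦ isC4 G (a , b , c , d) ⟧)) (λ d ¬adj → ∑-vanish V λ c →
        vanish (λ h → sub G a d (trans (symm G a d) (IsC4.da (isC4-sound a b c d h)))) ¬adj))
      (∑-cong (allFin n) (overD a i)))

-- Subcubes spanned by distinct directions.

flipIf : ∀ {n} → Bool → Fin n → Vertex n → Vertex n
flipIf true i v = flip i v
flipIf false i v = v

flipIf-involutive : ∀ {n} x (i : Fin n) v → flipIf x i (flipIf x i v) ≡ v
flipIf-involutive true = flip-flip
flipIf-involutive false i v = refl

lookup-flipIf : ∀ {n} x (i : Fin n) v → lookup (flipIf x i v) i ≡ x xor lookup v i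
lookup-flipIf true = lookup-flip
lookup-flipIf false i v = refl

-- The subcube at `v` with directions `is`. Distinctness of vertices of the large cube is pulled
-- back along this injection to explicit vertices of a small cube, where it holds by evaluation.
embed : ∀ {n m} → Vec (Fin n) m → Vertex n → Vertex m → Vertex n
embed [] v [] = v
embed (i ∷ is) v (x ∷ xs) = flipIf x i (embed is v xs)

lookup-embed : ∀ {n m} {i : Fin n} {is : Vec (Fin n) m} v → All (i ≢_) is → ∀ xs →
  lookup (embed is v xs) i ≡ lookup v i
lookup-embed v [] [] = refl
lookup-embed {is = j ∷ is} v (i≢j ∷ i∉) (true ∷ xs) =
  trans (lookup-flip-≢ (embed is v xs) (i≢j ∘ sym)) (lookup-embed v i∉ xs)
lookup-embed v (i≢j ∷ i∉) (false ∷ xs) = lookup-embed v i∉ xs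

xor-cancelʳ : ∀ {x y} b → x xor b ≡ y xor b → x ≡ y
xor-cancelʳ {true} {true} b h = refl
xor-cancelʳ {false} {false} b h = refl
xor-cancelʳ {true} {false} b h = contradiction (sym h) b≢not
xor-cancelʳ {false} {true} b h = contradiction h b≢not

embed-injective : ∀ {n m} {is : Vec (Fin n) m} v → AllPairs _≢_ is →
  ∀ xs ys → embed is v xs ≡ embed is v ys → xs ≡ ys
embed-injective v [] [] [] h = refl
embed-injective {is = i ∷ is} v (i∉ ∷ u) (x ∷ xs) (y ∷ ys) h with x≡y
  where
  x≡y : x ≡ y
  x≡y = xor-cancelʳ (lookup v i) (begin
    x xor lookup v i                       ≡⟨ cong (x xor_) (lookup-embed v i∉ xs) ⟨
    x xor lookup (embed is v xs) i         ≡⟨ lookup-flipIf x i (embed is v xs) ⟨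
    lookup (embed (i ∷ is) v (x ∷ xs)) i   ≡⟨ cong (λ w → lookup w i) h ⟩
    lookup (embed (i ∷ is) v (y ∷ ys)) i   ≡⟨ lookup-flipIf y i (embed is v ys) ⟩
    y xor lookup (embed is v ys) i         ≡⟨ cong (y xor_) (lookup-embed v i∉ ys) ⟩
    y xor lookup v i                       ∎)
    where open ≡-Reasoning
... | refl = cong (x ∷_) (embed-injective v u xs ys
  (trans (sym (flipIf-involutive x i (embed is v xs)))
    (trans (cong (flipIf x i) h) (flipIf-involutive x i (embed is v ys)))))

module _ {n m} (f : Vertex m → Vertex n) (inj : ∀ xs ys → f xs ≡ f ys → xs ≡ ys) where

  eqV-map : ∀ x y → eqV (f x) (f y) ≡ eqV x y
  eqV-map x y with eqV x y in eq
  ... | true rewrite eqV-sound x y eq = eqV-refl (f y)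
  ... | false with eqV (f x) (f y) in eq′
  ...   | false = refl
  ...   | true with refl ← inj x y (eqV-sound (f x) (f y) eq′) = trans (sym (eqV-refl x)) eq

  any-map : ∀ x ys → any (eqV (f x)) (map f ys) ≡ any (eqV x) ys
  any-map x [] = refl
  any-map x (y ∷ ys) = cong₂ _∨_ (eqV-map x y) (any-map x ys)

  distinct-map : ∀ xs → distinct (map f xs) ≡ distinct xs
  distinct-map [] = refl
  distinct-map (x ∷ xs) = cong₂ _∧_ (cong not (any-map x xs)) (distinct-map xs)

Distinct₃ : ∀ {n} → Fin n → Fin n → Fin n → Set
Distinct₃ i j k = i ≢ j × i ≢ k × j ≢ k

allPairs₃ : ∀ {n} {i j k : Fin n} → Distinct₃ i j k → AllPairs _≢_ (i ∷ j ∷ k ∷ [])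
allPairs₃ (i≢j , i≢k , j≢k) = (i≢j ∷ i≢k ∷ []) ∷ (j≢k ∷ []) ∷ [] ∷ []

module _ {n} (G : Subgraph n) where

  edge-flip : ∀ i v → edge G (flip i v) v ≡ E G v i
  edge-flip i v = symm G (flip i v) v

  edge-flip₂ : ∀ i j v → edge G (flip i v) (flip i (flip j v)) ≡ E G (flip i v) j
  edge-flip₂ i j v = cong (edge G (flip i v)) (flip-comm i j v)

  edge-flip₂′ : ∀ i j v → edge G (flip i (flip j v)) (flip i v) ≡ E G (flip i v) j
  edge-flip₂′ i j v = trans (symm G (flip i (flip j v)) (flip i v)) (edge-flip₂ i j v)

-- What C6-freeness forbids, and the resulting counts.

module _ {n} (G : Subgraph n) (free : C6Free G) where

  -- The 6-cycle around two squares that share the edge in direction i.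
  no-domino : ∀ {i l m} a → Distinct₃ i l m →
    E G a l ≡ true → E G (flip l a) i ≡ true → E G (flip i a) l ≡ true →
    E G a m ≡ true → E G (flip m a) i ≡ true → E G (flip i a) m ≡ true → ⊥
  no-domino {i} {l} {m} a d al li il am mi im = free
    ( a , flip l a , flip i (flip l a) , flip i a , flip i (flip m a) , flip m a
    , distinct-map (embed (i ∷ l ∷ m ∷ []) a) (embed-injective a (allPairs₃ d))
        ( (false ∷ false ∷ false ∷ []) ∷ (false ∷ true ∷ false ∷ []) ∷ (true ∷ true ∷ false ∷ [])
        ∷ (true ∷ false ∷ false ∷ []) ∷ (true ∷ false ∷ true ∷ []) ∷ (false ∷ false ∷ true ∷ []) ∷ [])
    , al , li , trans (edge-flip₂′ G i l a) il , trans (edge-flip₂ G i m a) im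
    , trans (edge-flip G i (flip m a)) mi , trans (edge-flip G m a) am)

  -- The 6-cycle of a 3-cube that avoids `v` and its antipode: its vertices are alternately at
  -- distance one and two from `v`.
  no-hexagon : ∀ {i j k} v → Distinct₃ i j k →
    E G (flip i v) j ≡ true → E G (flip j v) i ≡ true → E G (flip j v) k ≡ true →
    E G (flip k v) j ≡ true → E G (flip k v) i ≡ true → E G (flip i v) k ≡ true → ⊥
  no-hexagon {i} {j} {k} v d ij ji jk kj ki ik = free
    ( flip i v , flip i (flip j v) , flip j v , flip j (flip k v) , flip k v , flip i (flip k v)
    , distinct-map (embed (i ∷ j ∷ k ∷ []) v) (embed-injective v (allPairs₃ d))
        ( (true ∷ false ∷ false ∷ []) ∷ (true ∷ true ∷ false ∷ []) ∷ (false ∷ true ∷ false ∷ [])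
        ∷ (false ∷ true ∷ true ∷ []) ∷ (false ∷ false ∷ true ∷ []) ∷ (true ∷ false ∷ true ∷ []) ∷ [])
    , trans (edge-flip₂ G i j v) ij , trans (edge-flip G i (flip j v)) ji
    , trans (edge-flip₂ G j k v) jk , trans (edge-flip G j (flip k v)) kj
    , ki , trans (edge-flip₂′ G i k v) ik)

  -- A labelled 4-cycle is given by `a`, `i` and `l`. Once the first edge is fixed, two choices of
  -- `l` would give two squares sharing that edge, against `no-domino`.
  labelledC4≤∑E : + labelledC4 G ≤ ∑ᵛ n (λ v → ∑ᵈ n (λ i → ⟦ E G v i ⟧))
  labelledC4≤∑E = subst (_≤ ∑ᵛ n (λ v → ∑ᵈ n (λ i → ⟦ E G v i ⟧))) (sym (labelledC4≡∑square G))
    (∑-mono (allVertices n) λ a → ∑-mono (allFin n) λ i → oneSquare a i)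
    where
    oneSquare : ∀ a i → ∑ᵈ n (λ l → ⟦ square G a i l ⟧) ≤ ⟦ E G a i ⟧
    oneSquare a i = split (E G a i) refl
     where
     split : ∀ b → E G a i ≡ b → ∑ᵈ n (λ l → ⟦ square G a i l ⟧) ≤ ⟦ E G a i ⟧
     split true ai = subst (λ b → ∑ᵈ n (λ l → ⟦ square G a i l ⟧) ≤ ⟦ b ⟧) (sym ai) (∑ᵈ-atMostOne n (square G a i) unique)
      where
      sides : ∀ l → square G a i l ≡ true → i ≢ l × E G a l ≡ true × E G (flip l a) i ≡ true × E G (flip i a) l ≡ true
      sides l h with mkC4 a≢c b≢d ab bc cd da ← isC4-sound G a (flip i a) (flip l (flip i a)) (flip l a) h =
        (λ { refl → b≢d refl }) , trans (sym (edge-flip G l a)) da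
        , trans (sym (edge-flip₂′ G l i a)) (trans (cong (λ w → edge G w (flip l a)) refl) cd) , bc
      unique : ∀ l m → square G a i l ≡ true → square G a i m ≡ true → l ≡ m
      unique l m hl hm with l ≟ m
      ... | yes l≡m = l≡m
      ... | no l≢m with i≢l , al , li , il ← sides l hl | i≢m , am , mi , im ← sides m hm =
        ⊥-elim (no-domino a (i≢l , i≢m , l≢m) al li il am mi im)
     split false ai = ℤ.≤-reflexive (trans (∑-cong (allFin n) none) (trans (∑-zero (allFin n)) (cong ⟦_⟧ (sym ai))))
      where
      none : ∀ l → ⟦ square G a i l ⟧ ≡ 0ℤ
      none l with square G a i l in h
      ... | false = refl
      ... | true with trans (sym (IsC4.ab (isC4-sound G a (flip i a) (flip l (flip i a)) (flip l a) h))) ai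
      ...   | ()

  -- All sides of the square but the one at `v` in direction `k`, about which nothing is said. The
  -- diagonal must be excluded: for `i` equal to `k` the condition would hold at every edge.
  threeSides : Vertex n → Fin n → Fin n → Bool
  threeSides v k i with i ≟ k
  ... | yes _ = false
  ... | no _ = E G v i ∧ E G (flip i v) k ∧ E G (flip k v) i

  -- The 6-cycle of `no-domino` runs around the shared edge without using it, so uniqueness holds
  -- whether or not that edge is present.
  ∑threeSides≤1 : ∀ v k → ∑ᵈ n (λ i → ⟦ threeSides v k i ⟧) ≤ 1ℤ
  ∑threeSides≤1 v k = ∑ᵈ-atMostOne n (threeSides v k) unique
    where
    sides : ∀ i → threeSides v k i ≡ true → k ≢ i × E G v i ≡ true × E G (flip i v) k ≡ true × E G (flip k v) i ≡ true
    sides i h with i ≟ k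
    ... | no i≢k = i≢k ∘ sym , ∧-conicalˡ (E G v i) _ h , ∧-conicalˡ (E G (flip i v) k) _ h′ , ∧-conicalʳ (E G (flip i v) k) _ h′
      where h′ = ∧-conicalʳ (E G v i) _ h
    unique : ∀ i j → threeSides v k i ≡ true → threeSides v k j ≡ true → i ≡ j
    unique i j hi hj with i ≟ j
    ... | yes i≡j = i≡j
    ... | no i≢j with k≢i , vi , ik , ki ← sides i hi | k≢j , vj , jk , kj ← sides j hj =
      ⊥-elim (no-domino v (k≢i , k≢j , i≢j) vi ik ki vj jk kj)

-- The number of 4-cycles of the cube.

∑-Q : ∀ n → + labelledC4 (Q n) ≡ + (2 ℕ.^ n) * (+ n * (+ n - 1ℤ))
∑-Q n = trans (labelledC4≡∑square (Q n)) (trans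
  (∑-cong (allVertices n) λ a → trans (∑-cong (allFin n) (perSide a)) (∑ᵈ-const n (+ n - 1ℤ)))
  (∑ᵛ-const n (+ n * (+ n - 1ℤ))))
  where
  isSquare : ∀ a {i l} → i ≢ l → square (Q n) a i l ≡ true
  isSquare a {i} {l} i≢l = cong₂ _∧_
    (trans (cong (λ w → distinct (a ∷ flip i a ∷ w ∷ flip l a ∷ [])) (flip-comm l i a))
      (distinct-map (embed (i ∷ l ∷ []) a) (embed-injective a ((i≢l ∷ []) ∷ [] ∷ []))
        ((false ∷ false ∷ []) ∷ (true ∷ false ∷ []) ∷ (true ∷ true ∷ []) ∷ (false ∷ true ∷ []) ∷ [])))
    (cong₂ _∧_ (adjQ-flip i a) (cong₂ _∧_ (adjQ-flip l (flip i a))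
      (cong₂ _∧_ (trans (edge-flip₂′ (Q n) l i a) (adjQ-flip i (flip l a))) (trans (edge-flip (Q n) l a) (adjQ-flip l a)))))
  notSquare : ∀ a i → square (Q n) a i i ≡ false
  notSquare a i with square (Q n) a i i in h
  ... | false = refl
  ... | true with mkC4 a≢c b≢d _ _ _ _ ← isC4-sound (Q n) a (flip i a) (flip i (flip i a)) (flip i a) h = contradiction refl b≢d
  same : Fin n → Fin n → Bool
  same i l with l ≟ i
  ... | yes _ = true
  ... | no _ = false
  total : ∀ a i l → ⟦ square (Q n) a i l ⟧ ≡ 1ℤ + - 1ℤ * ⟦ same i l ⟧
  total a i l with l ≟ i
  ... | yes refl = cong ⟦_⟧ (notSquare a i)
  ... | no l≢i = cong ⟦_⟧ (isSquare a (l≢i ∘ sym))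
  same-refl : ∀ i → same i i ≡ true
  same-refl i with i ≟ i
  ... | yes _ = refl
  ... | no i≢i = contradiction refl i≢i
  same-≢ : ∀ i l → l ≢ i → ⟦ same i l ⟧ ≡ 0ℤ
  same-≢ i l l≢i with l ≟ i
  ... | yes l≡i = contradiction l≡i l≢i
  ... | no _ = refl
  perSide : ∀ a i → ∑ᵈ n (λ l → ⟦ square (Q n) a i l ⟧) ≡ + n - 1ℤ
  perSide a i = begin
    ∑ᵈ n (λ l → ⟦ square (Q n) a i l ⟧)
      ≡⟨ ∑-cong (allFin n) (total a i) ⟩
    ∑ᵈ n (λ l → 1ℤ + - 1ℤ * ⟦ same i l ⟧)
      ≡⟨ ∑-+ (allFin n) (λ _ → 1ℤ) (λ l → - 1ℤ * ⟦ same i l ⟧) ⟩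
    ∑ᵈ n (λ _ → 1ℤ) + ∑ᵈ n (λ l → - 1ℤ * ⟦ same i l ⟧)
      ≡⟨ cong₂ _+_ (trans (∑ᵈ-const n 1ℤ) (ℤ.*-identityʳ (+ n))) (∑-*ˡ (allFin n) (- 1ℤ) (λ l → ⟦ same i l ⟧)) ⟩
    + n + - 1ℤ * ∑ᵈ n (λ l → ⟦ same i l ⟧)
      ≡⟨ cong (λ s → + n + - 1ℤ * s) (trans (∑ᵈ-single (λ l → ⟦ same i l ⟧) i (same-≢ i)) (cong ⟦_⟧ (same-refl i))) ⟩
    + n - 1ℤ ∎
    where open ≡-Reasoning

-- The lower bound: pairs of directions

any-witness : ∀ {A : Set} (p : A → Bool) xs → any p xs ≡ true → ∃[ x ] p x ≡ true
any-witness p (x ∷ xs) h with p x in eq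
... | true = x , eq
... | false = any-witness p xs h

flip-injectiveˡ : ∀ {n} {i j : Fin n} v → flip i v ≡ flip j v → i ≡ j
flip-injectiveˡ {i = i} {j} v h with i ≟ j
... | yes i≡j = i≡j
... | no i≢j = contradiction
  (trans (sym (lookup-flip-≢ v (i≢j ∘ sym))) (trans (cong (λ w → lookup w i) (sym h)) (lookup-flip i v))) b≢not

module _ {n} (e : Vertex n → Fin n → Bool) (e-flip : ∀ i v → e (flip i v) i ≡ e v i) where

  private
    along : Vertex n → Vertex n → Fin n → Bool
    along u w i = eqV (flip i u) w ∧ e u i

    joined : Vertex n → Vertex n → Bool
    joined u w = any (along u w) (allFin n)

    joined-flip : ∀ u i → e u i ≡ true → joined u (flip i u) ≡ true
    joined-flip u i ei = any-∈ (along u (flip i u)) (∈-allFin i) (cong₂ _∧_ (eqV-refl (flip i u)) ei)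

    joined⇒ : ∀ u w → joined u w ≡ true → ∃[ i ] w ≡ flip i u × e u i ≡ true
    joined⇒ u w h with i , hi ← any-witness (along u w) (allFin n) h =
      i , sym (eqV-sound (flip i u) w (∧-conicalˡ (eqV (flip i u) w) _ hi)) , ∧-conicalʳ (eqV (flip i u) w) _ hi

    joined-sym : ∀ u w → joined u w ≡ true → joined w u ≡ true
    joined-sym u w h with i , refl , ei ← joined⇒ u w h =
      trans (cong (joined (flip i u)) (sym (flip-flip i u))) (joined-flip (flip i u) i (trans (e-flip i u) ei))

    iff⇒≡ : ∀ {x y} → (x ≡ true → y ≡ true) → (y ≡ true → x ≡ true) → x ≡ y
    iff⇒≡ {true} f g = sym (f refl)
    iff⇒≡ {false} {true} f g = g refl
    iff⇒≡ {false} {false} f g = refl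

  -- A subgraph is given on pairs of vertices, so its edge relation searches for a direction that
  -- leads from one to the other.
  fromDirections : Subgraph n
  fromDirections = record
    { edge = joined
    ; symm = λ u w → iff⇒≡ (joined-sym u w) (joined-sym w u)
    ; sub = λ u w h → subAdj u w (joined⇒ u w h)
    }
    where
    subAdj : ∀ u w → ∃[ i ] w ≡ flip i u × e u i ≡ true → adjQ u w ≡ true
    subAdj u w (i , refl , _) = adjQ-flip i u

  direction : ∀ u w → edge fromDirections u w ≡ true → ∃[ i ] w ≡ flip i u × e u i ≡ true
  direction = joined⇒

  E-fromDirections : ∀ u i → E fromDirections u i ≡ e u i
  E-fromDirections u i = iff⇒≡ back (joined-flip u i)
    where
    back : joined u (flip i u) ≡ true → e u i ≡ true
    back h with j , eq , ej ← joined⇒ u (flip i u) h = trans (cong (e u) (flip-injectiveˡ u eq)) ej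

-- The graph defined by two parities.

parity : ∀ {n} → (Fin n → Bool) → Vertex n → Bool
parity s [] = false
parity s (b ∷ v) = (s zero ∧ b) xor parity (s ∘ suc) v

parity-flip : ∀ {n} s (i : Fin n) v → parity s (flip i v) ≡ s i xor parity s v
parity-flip s zero (b ∷ v) = lemma (s zero) b (parity (s ∘ suc) v)
  where
  lemma : ∀ x y z → (x ∧ not y) xor z ≡ x xor ((x ∧ y) xor z)
  lemma false y z = refl
  lemma true true z = sym (Bool.not-involutive z)
  lemma true false z = refl
parity-flip s (suc i) (b ∷ v) = trans (cong ((s zero ∧ b) xor_) (parity-flip (s ∘ suc) i v))
  (lemma (s zero ∧ b) (s (suc i)) (parity (s ∘ suc) v))
  where
  lemma : ∀ x y z → x xor (y xor z) ≡ y xor (x xor z)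
  lemma false y z = refl
  lemma true false z = refl
  lemma true true z = refl

pair : ∀ {n} → Fin n → ℕ
pair i = ⌊ toℕ i /2⌋

below above : ∀ {n} → Fin n → Fin n → Bool
below i j = pair j <ᵇ pair i
above i j = pair i <ᵇ pair j

-- Neither condition involves the coordinates in the pair of `i`, so the square spanned by a full
-- pair at `v` is kept or lost as a whole.
low : ∀ {n} → Vertex n → Fin n → Bool
low v i = not (parity (below i) v) ∧ not (parity (above i) v)

<ᵇ-irrefl : ∀ m → (m <ᵇ m) ≡ false
<ᵇ-irrefl zero = refl
<ᵇ-irrefl (suc m) = <ᵇ-irrefl m

low-flip-pair : ∀ {n} (i j : Fin n) v → pair i ≡ pair j → low (flip j v) i ≡ low v i
low-flip-pair i j v p = cong₂ (λ x y → not x ∧ not y)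
  (trans (parity-flip (below i) j v) (cong (_xor parity (below i) v) (trans (cong (_<ᵇ pair i) (sym p)) (<ᵇ-irrefl (pair i)))))
  (trans (parity-flip (above i) j v) (cong (_xor parity (above i) v) (trans (cong (pair i <ᵇ_) (sym p)) (<ᵇ-irrefl (pair i)))))

lowGraph : ∀ n → Subgraph n
lowGraph n = fromDirections {n} low (λ i v → low-flip-pair i i v refl)

not-xor : ∀ {x y} → not x ≡ true → not (y xor x) ≡ true → y ≡ false
not-xor {false} {false} _ _ = refl

<ᵇ-antisym : ∀ m n → (m <ᵇ n) ≡ false → (n <ᵇ m) ≡ false → m ≡ n
<ᵇ-antisym zero zero _ _ = refl
<ᵇ-antisym (suc m) (suc n) h k = cong suc (<ᵇ-antisym m n h k)

<ᵇ-asym : ∀ m n → (m <ᵇ n) ≡ (n <ᵇ m) → m ≡ n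
<ᵇ-asym zero zero _ = refl
<ᵇ-asym (suc m) (suc n) h = cong suc (<ᵇ-asym m n h)

low-below : ∀ {n} {v : Vertex n} {i} → low v i ≡ true → not (parity (below i) v) ≡ true
low-below h = ∧-conicalˡ _ _ h

low-above : ∀ {n} {v : Vertex n} {i} → low v i ≡ true → not (parity (above i) v) ≡ true
low-above {v = v} {i} h = ∧-conicalʳ (not (parity (below i) v)) _ h

-- When two opposite sides of a square are both kept, moving along `y` changes neither parity, so
-- `y` is neither below nor above the pair of `x`.
low-side : ∀ {n} {x y : Fin n} v → low v x ≡ true → low (flip y v) x ≡ true → pair y ≡ pair x
low-side {x = x} {y} v h k = <ᵇ-antisym (pair y) (pair x)
  (not-xor (low-below {v = v} {x} h) (trans (cong not (sym (parity-flip (below x) y v))) (low-below {v = flip y v} {x} k)))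
  (not-xor (low-above {v = v} {x} h) (trans (cong not (sym (parity-flip (above x) y v))) (low-above {v = flip y v} {x} k)))

halves : ∀ a b c → ⌊ a /2⌋ ≡ ⌊ b /2⌋ → ⌊ b /2⌋ ≡ ⌊ c /2⌋ → a ≡ b ⊎ a ≡ c ⊎ b ≡ c
halves 0 0 c p q = inj₁ refl
halves 1 1 c p q = inj₁ refl
halves 0 1 0 p q = inj₂ (inj₁ refl)
halves 0 1 1 p q = inj₂ (inj₂ refl)
halves 1 0 0 p q = inj₂ (inj₂ refl)
halves 1 0 1 p q = inj₂ (inj₁ refl)
halves (suc (suc a)) (suc (suc b)) (suc (suc c)) p q with halves a b c (ℕ.suc-injective p) (ℕ.suc-injective q)
... | inj₁ e = inj₁ (cong (λ m → suc (suc m)) e)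
... | inj₂ (inj₁ e) = inj₂ (inj₁ (cong (λ m → suc (suc m)) e))
... | inj₂ (inj₂ e) = inj₂ (inj₂ (cong (λ m → suc (suc m)) e))

pair-three : ∀ {n} {x y z : Fin n} → Distinct₃ x y z → pair x ≡ pair y → pair y ≡ pair z → ⊥
pair-three {x = x} {y} {z} (x≢y , x≢z , y≢z) p q with halves (toℕ x) (toℕ y) (toℕ z) p q
... | inj₁ e = x≢y (toℕ-injective e)
... | inj₂ (inj₁ e) = x≢z (toℕ-injective e)
... | inj₂ (inj₂ e) = y≢z (toℕ-injective e)

-- Absence of 6-cycles in the parity graph.

record Walk {n} (v₀ v₁ v₂ v₃ v₄ v₅ : Vertex n) (d₀ d₁ d₂ d₃ d₄ d₅ : Fin n) : Set where
  field
    s₀ : v₁ ≡ flip d₀ v₀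
    s₁ : v₂ ≡ flip d₁ v₁
    s₂ : v₃ ≡ flip d₂ v₂
    s₃ : v₄ ≡ flip d₃ v₃
    s₄ : v₅ ≡ flip d₄ v₄
    s₅ : v₀ ≡ flip d₅ v₅
    n₀ : v₀ ≢ v₂
    n₁ : v₁ ≢ v₃
    n₂ : v₂ ≢ v₄
    n₃ : v₃ ≢ v₅
    n₄ : v₄ ≢ v₀
    n₅ : v₅ ≢ v₁
    l₀ : low v₀ d₀ ≡ true
    l₁ : low v₁ d₁ ≡ true
    l₂ : low v₂ d₂ ≡ true
    l₃ : low v₃ d₃ ≡ true
    l₄ : low v₄ d₄ ≡ true
    l₅ : low v₅ d₅ ≡ true

-- Facts are proved for the first direction only and carried to the others by rotation.
rotate : ∀ {n} {v₀ v₁ v₂ v₃ v₄ v₅ : Vertex n} {d₀ d₁ d₂ d₃ d₄ d₅} →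
  Walk v₀ v₁ v₂ v₃ v₄ v₅ d₀ d₁ d₂ d₃ d₄ d₅ → Walk v₁ v₂ v₃ v₄ v₅ v₀ d₁ d₂ d₃ d₄ d₅ d₀
rotate w = record
  { s₀ = s₁ ; s₁ = s₂ ; s₂ = s₃ ; s₃ = s₄ ; s₄ = s₅ ; s₅ = s₀
  ; n₀ = n₁ ; n₁ = n₂ ; n₂ = n₃ ; n₃ = n₄ ; n₄ = n₅ ; n₅ = n₀
  ; l₀ = l₁ ; l₁ = l₂ ; l₂ = l₃ ; l₃ = l₄ ; l₄ = l₅ ; l₅ = l₀ }
  where open Walk w

module _ {n} {v₀ v₁ v₂ v₃ v₄ v₅ : Vertex n} {d₀ d₁ d₂ d₃ d₄ d₅}
  (w : Walk v₀ v₁ v₂ v₃ v₄ v₅ d₀ d₁ d₂ d₃ d₄ d₅) where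

  open Walk w

  private
    unflip : ∀ {i} {a b : Vertex n} → a ≡ flip i b → b ≡ flip i a
    unflip {i} {b = b} refl = sym (flip-flip i b)

    d₀≢d₁ : d₀ ≢ d₁
    d₀≢d₁ refl = n₀ (trans (unflip s₀) (sym s₁))
    d₁≢d₂ : d₁ ≢ d₂
    d₁≢d₂ refl = n₁ (trans (unflip s₁) (sym s₂))
    d₂≢d₃ : d₂ ≢ d₃
    d₂≢d₃ refl = n₂ (trans (unflip s₂) (sym s₃))
    d₅≢d₀ : d₅ ≢ d₀
    d₅≢d₀ refl = n₅ (trans (unflip s₅) (sym s₀))

  -- Otherwise the cycle is the boundary of two squares with a common edge, with directions x, y, x,
  -- z, y, z. Its two x-edges lie opposite each other across y, and so do its two z-edges; by
  -- `low-side` all three directions would be in one pair, which has room for two.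
  no-turn : d₀ ≢ d₂
  no-turn refl = pair-three (d₀≢d₁ , d₂≢d₃ , y≢d₃) (sym x~y) (sym z~y)
    where
    v₃≡ : v₃ ≡ flip d₁ v₀
    v₃≡ = trans s₂ (trans (cong (flip d₀) (trans s₁ (trans (cong (flip d₁) s₀) (flip-comm d₁ d₀ v₀)))) (flip-flip d₀ (flip d₁ v₀)))
    y≢d₃ : d₁ ≢ d₃
    y≢d₃ refl = n₄ (trans s₃ (sym (unflip v₃≡)))
    y≢d₅ : d₁ ≢ d₅
    y≢d₅ refl = n₃ (trans v₃≡ (sym (unflip s₅)))
    d₃≡d₅ : d₃ ≡ d₅
    -- `v₄` is two steps from `v₀` along either arc, now that `v₃` is known to be a neighbour of
    -- `v₀`.
    d₃≡d₅ = flip-parallelogram {m = d₄} v₀ y≢d₃ y≢d₅ (begin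
      flip d₃ (flip d₁ v₀) ≡⟨ cong (flip d₃) v₃≡ ⟨
      flip d₃ v₃           ≡⟨ s₃ ⟨
      v₄                   ≡⟨ unflip s₄ ⟩
      flip d₄ v₅           ≡⟨ cong (flip d₄) (unflip s₅) ⟩
      flip d₄ (flip d₅ v₀) ∎)
      where open ≡-Reasoning
    d₄≡d₁ : d₄ ≡ d₁
    d₄≡d₁ = flip-injectiveˡ v₀ (begin
      flip d₄ v₀ ≡⟨ cong (flip d₄) s₅ ⟩
      flip d₄ (flip d₅ v₅) ≡⟨ flip-comm d₄ d₅ v₅ ⟩
      flip d₅ (flip d₄ v₅) ≡⟨ cong (flip d₅) (unflip s₄) ⟨
      flip d₅ v₄ ≡⟨ cong (λ d → flip d v₄) d₃≡d₅ ⟨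
      flip d₃ v₄ ≡⟨ unflip s₃ ⟨
      v₃ ≡⟨ v₃≡ ⟩
      flip d₁ v₀ ∎)
      where open ≡-Reasoning
    x~y : pair d₁ ≡ pair d₀
    x~y = low-side v₀ l₀ (trans (sym (low-flip-pair d₀ d₀ (flip d₁ v₀) refl))
      (trans (cong (λ v → low v d₀) (sym (trans s₁ (trans (cong (flip d₁) s₀) (flip-comm d₁ d₀ v₀))))) l₂))
    z~y : pair d₃ ≡ pair d₁
    z~y = sym (low-side v₃ l₃ (trans (sym (low-flip-pair d₃ d₃ (flip d₁ v₃) refl)) (trans
      (cong (λ v → low v d₃) (begin
        flip d₃ (flip d₁ v₃) ≡⟨ flip-comm d₃ d₁ v₃ ⟩
        flip d₁ (flip d₃ v₃) ≡⟨ cong (flip d₁) s₃ ⟨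
        flip d₁ v₄ ≡⟨ cong (λ d → flip d v₄) d₄≡d₁ ⟨
        flip d₄ v₄ ≡⟨ s₄ ⟨
        v₅ ∎))
      (trans (cong (low v₅) d₃≡d₅) l₅))))
      where open ≡-Reasoning

  -- The two edges in direction `d₀` differ by a translation along `d₁` and `d₂`. Both parities are
  -- even at either edge, so the changes made by `d₁` and `d₂` cancel.
  sides : d₀ ≡ d₃ →
    (pair d₁ <ᵇ pair d₀) ≡ (pair d₂ <ᵇ pair d₀) × (pair d₀ <ᵇ pair d₁) ≡ (pair d₀ <ᵇ pair d₂)
  sides refl = agree (below d₀) (low-below {v = v₀} {d₀} l₀) (low-below {v = u} {d₀} low-u)
             , agree (above d₀) (low-above {v = v₀} {d₀} l₀) (low-above {v = u} {d₀} low-u)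
    where
    u = flip d₂ (flip d₁ v₀)
    low-u : low u d₀ ≡ true
    low-u = trans (sym (low-flip-pair d₀ d₀ u refl)) (trans (cong (λ v → low v d₀) (begin
      flip d₀ (flip d₂ (flip d₁ v₀)) ≡⟨ flip-comm d₀ d₂ (flip d₁ v₀) ⟩
      flip d₂ (flip d₀ (flip d₁ v₀)) ≡⟨ cong (flip d₂) (flip-comm d₀ d₁ v₀) ⟩
      flip d₂ (flip d₁ (flip d₀ v₀)) ≡⟨ cong (flip d₂) (trans s₁ (cong (flip d₁) s₀)) ⟨
      flip d₂ v₂ ≡⟨ s₂ ⟨
      v₃ ∎)) l₃)
      where open ≡-Reasoning
    cancel : ∀ {x y p} → not p ≡ true → not (y xor (x xor p)) ≡ true → x ≡ y
    cancel {false} {false} {false} _ _ = refl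
    cancel {true} {true} {false} _ _ = refl
    agree : ∀ s → not (parity s v₀) ≡ true → not (parity s u) ≡ true → s d₁ ≡ s d₂
    agree s h k = cancel h (trans (cong not (sym (trans (parity-flip s d₂ (flip d₁ v₀))
      (cong (s d₂ xor_) (parity-flip s d₁ v₀))))) k)

  -- Round a closed walk the coordinate `d₀` is flipped an even number of times. Consecutive steps
  -- have different directions, so only the step opposite to the first can flip it back.
  opposite : d₀ ≢ d₂ → d₄ ≢ d₀ → d₀ ≡ d₃
  opposite d₀≢d₂ d₄≢d₀ with d₀ ≟ d₃
  ... | yes e = e
  ... | no d₀≢d₃ = contradiction (begin
    lookup v₀ d₀ ≡⟨ trans (cong (λ v → lookup v d₀) s₅) (lookup-flip-≢ v₅ d₅≢d₀) ⟩
    lookup v₅ d₀ ≡⟨ trans (cong (λ v → lookup v d₀) s₄) (lookup-flip-≢ v₄ d₄≢d₀) ⟩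
    lookup v₄ d₀ ≡⟨ trans (cong (λ v → lookup v d₀) s₃) (lookup-flip-≢ v₃ (d₀≢d₃ ∘ sym)) ⟩
    lookup v₃ d₀ ≡⟨ trans (cong (λ v → lookup v d₀) s₂) (lookup-flip-≢ v₂ (d₀≢d₂ ∘ sym)) ⟩
    lookup v₂ d₀ ≡⟨ trans (cong (λ v → lookup v d₀) s₁) (lookup-flip-≢ v₁ (d₀≢d₁ ∘ sym)) ⟩
    lookup v₁ d₀ ≡⟨ trans (cong (λ v → lookup v d₀) s₀) (lookup-flip d₀ v₀) ⟩
    not (lookup v₀ d₀) ∎) b≢not
    where open ≡-Reasoning

  first-distinct : d₀ ≢ d₂ → Distinct₃ d₀ d₁ d₂
  first-distinct d₀≢d₂ = d₀≢d₁ , d₀≢d₂ , d₁≢d₂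

-- What remains is the hexagon of a 3-cube, with directions `d₀`, `d₁`, `d₂` and then the same
-- again. By `sides`, each direction has the other two on the same side of its pair. The middle one
-- of three has this property only if all three pairs are equal.
no-walk : ∀ {n} {v₀ v₁ v₂ v₃ v₄ v₅ : Vertex n} {d₀ d₁ d₂ d₃ d₄ d₅} →
  Walk v₀ v₁ v₂ v₃ v₄ v₅ d₀ d₁ d₂ d₃ d₄ d₅ → ⊥
no-walk {d₀ = d₀} {d₁} {d₂} w
  with w₁ ← rotate w
  with w₂ ← rotate w₁
  with w₃ ← rotate w₂
  with w₄ ← rotate w₃
  with refl ← opposite w (no-turn w) (no-turn w₄)
     | refl ← opposite w₁ (no-turn w₁) (no-turn (rotate w₄))
     | refl ← opposite w₂ (no-turn w₂) (no-turn w)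
  with e₁ , e₂ ← sides w refl | e₃ , e₄ ← sides w₁ refl | e₅ , e₆ ← sides w₂ refl
  = pair-three (first-distinct w (no-turn w))
      (<ᵇ-asym (pair d₀) (pair d₁) (trans e₂ (trans e₅ e₄)))
      (<ᵇ-asym (pair d₁) (pair d₂) (trans (sym e₅) (trans (sym e₂) (sym e₃))))

lowStep : ∀ {n} (u w : Vertex n) → edge (lowGraph n) u w ≡ true → ∃[ i ] w ≡ flip i u × low u i ≡ true
lowStep {n} = direction {n} low (λ i v → low-flip-pair i i v refl)

lowGraph-C6Free : ∀ n → C6Free (lowGraph n)
lowGraph-C6Free n (v₀ , v₁ , v₂ , v₃ , v₄ , v₅ , dist , e₀ , e₁ , e₂ , e₃ , e₄ , e₅)
  with _ , s₀ , l₀ ← lowStep v₀ v₁ e₀ | _ , s₁ , l₁ ← lowStep v₁ v₂ e₁ | _ , s₂ , l₂ ← lowStep v₂ v₃ e₂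
     | _ , s₃ , l₃ ← lowStep v₃ v₄ e₃ | _ , s₄ , l₄ ← lowStep v₄ v₅ e₄ | _ , s₅ , l₅ ← lowStep v₅ v₀ e₅
  = no-walk (record
    { s₀ = s₀ ; s₁ = s₁ ; s₂ = s₂ ; s₃ = s₃ ; s₄ = s₄ ; s₅ = s₅
    ; n₀ = distinct-≢ {xs = v₁ ∷ v₂ ∷ v₃ ∷ v₄ ∷ v₅ ∷ []} dist (there (here refl))
    ; n₁ = distinct-≢ {xs = v₂ ∷ v₃ ∷ v₄ ∷ v₅ ∷ []} dist₁ (there (here refl))
    ; n₂ = distinct-≢ {xs = v₃ ∷ v₄ ∷ v₅ ∷ []} dist₂ (there (here refl))
    ; n₃ = distinct-≢ {xs = v₄ ∷ v₅ ∷ []} dist₃ (there (here refl))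
    ; n₄ = distinct-≢ {xs = v₁ ∷ v₂ ∷ v₃ ∷ v₄ ∷ v₅ ∷ []} dist (there (there (there (here refl)))) ∘ sym
    ; n₅ = distinct-≢ {xs = v₂ ∷ v₃ ∷ v₄ ∷ v₅ ∷ []} dist₁ (there (there (there (here refl)))) ∘ sym
    ; l₀ = l₀ ; l₁ = l₁ ; l₂ = l₂ ; l₃ = l₃ ; l₄ = l₄ ; l₅ = l₅ })
  where
  dist₁ = ∧-conicalʳ (not (any (eqV v₀) (v₁ ∷ v₂ ∷ v₃ ∷ v₄ ∷ v₅ ∷ []))) _ dist
  dist₂ = ∧-conicalʳ (not (any (eqV v₁) (v₂ ∷ v₃ ∷ v₄ ∷ v₅ ∷ []))) _ dist₁
  dist₃ = ∧-conicalʳ (not (any (eqV v₂) (v₃ ∷ v₄ ∷ v₅ ∷ []))) _ dist₂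

-- Counting the squares of the parity graph.

∑-parity : ∀ {n} (s : Fin n → Bool) (f : Vertex n → Bool) → (∀ i v → s i ≡ true → f (flip i v) ≡ f v) →
  ∑ᵛ n (λ v → ⟦ f v ⟧) ≤ + 2 * ∑ᵛ n (λ v → ⟦ not (parity s v) ∧ f v ⟧)
∑-parity {n} s f inv with any? (λ i → s i Bool.≟ true)
-- Flipping `i` exchanges the two parity classes and preserves `f`, so each class carries exactly
-- half.
... | yes (i , si) = ℤ.≤-reflexive (begin
    ∑ᵛ n (λ v → ⟦ f v ⟧)
      ≡⟨ ∑-cong V (λ v → split v (parity s v) (f v)) ⟩
    ∑ᵛ n (λ v → ⟦ not (parity s v) ∧ f v ⟧ + ⟦ parity s v ∧ f v ⟧)
      ≡⟨ ∑-+ V (λ v → ⟦ not (parity s v) ∧ f v ⟧) (λ v → ⟦ parity s v ∧ f v ⟧) ⟩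
    S + ∑ᵛ n (λ v → ⟦ parity s v ∧ f v ⟧)
      ≡⟨ cong (_+_ S) (∑ᵛ-flip i (λ v → ⟦ parity s v ∧ f v ⟧)) ⟨
    S + ∑ᵛ n (λ v → ⟦ parity s (flip i v) ∧ f (flip i v) ⟧)
      ≡⟨ cong (_+_ S) (∑-cong V (λ v → cong₂ (λ p q → ⟦ p ∧ q ⟧)
           (trans (parity-flip s i v) (cong (_xor parity s v) si)) (inv i v si))) ⟩
    S + S
      ≡⟨ cong₂ _+_ (ℤ.*-identityˡ S) (ℤ.*-identityˡ S) ⟨
    1ℤ * S + 1ℤ * S
      ≡⟨ ℤ.*-distribʳ-+ S 1ℤ 1ℤ ⟨
    + 2 * S ∎)
  where
  open ≡-Reasoning
  V = allVertices n
  S = ∑ᵛ n (λ v → ⟦ not (parity s v) ∧ f v ⟧)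
  split : ∀ v p q → ⟦ q ⟧ ≡ ⟦ not p ∧ q ⟧ + ⟦ p ∧ q ⟧
  split v true true = refl
  split v true false = refl
  split v false true = refl
  split v false false = refl
-- Over an empty set of coordinates the parity is always even, so the condition removes nothing and
-- the factor two is merely generous.
... | no none = subst (_≤ + 2 * ∑ᵛ n (λ v → ⟦ not (parity s v) ∧ f v ⟧))
    (∑-cong (allVertices n) (λ v → cong (λ p → ⟦ not p ∧ f v ⟧) (parity-none s v (λ i → Bool.¬-not (λ si → none (i , si))))))
    (subst (S ≤_) (trans (cong₂ _+_ (sym (ℤ.*-identityˡ S)) (sym (ℤ.*-identityˡ S))) (sym (ℤ.*-distribʳ-+ S 1ℤ 1ℤ)))
      (ℤ.i≤i+j S S {{nonNegative (∑-nonneg (allVertices n) (λ v → ⟦⟧-nonneg (not (parity s v) ∧ f v)))}}))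
  where
  S = ∑ᵛ n (λ v → ⟦ not (parity s v) ∧ f v ⟧)
  parity-none : ∀ {n} (s : Fin n → Bool) v → (∀ i → s i ≡ false) → parity s v ≡ false
  parity-none s [] h = refl
  parity-none s (b ∷ v) h = cong₂ _xor_ (cong (_∧ b) (h zero)) (parity-none (s ∘ suc) v (h ∘ suc))

partner : ∀ {n} → Fin n → Fin n → Bool
partner zero (suc zero) = true
partner (suc zero) zero = true
partner (suc (suc i)) (suc (suc l)) = partner i l
partner _ _ = false

partner-sound : ∀ {n} (i l : Fin n) → partner i l ≡ true → i ≢ l × pair i ≡ pair l
partner-sound zero (suc zero) h = (λ ()) , refl
partner-sound (suc zero) zero h = (λ ()) , refl
partner-sound (suc (suc i)) (suc (suc l)) h with i≢l , p ← partner-sound i l h =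
  (λ { refl → i≢l refl }) , cong suc p
partner-sound zero zero ()
partner-sound zero (suc (suc l)) ()
partner-sound (suc zero) (suc zero) ()
partner-sound (suc zero) (suc (suc l)) ()
partner-sound (suc (suc i)) zero ()
partner-sound (suc (suc i)) (suc zero) ()

-- For odd `n` the last direction has no partner; this is the only loss.
∑-partner : ∀ n → + n - 1ℤ ≤ ∑ᵈ n (λ i → ∑ᵈ n (λ l → ⟦ partner i l ⟧))
∑-partner 0 = -≤+
∑-partner 1 = +≤+ z≤n
∑-partner (suc (suc n)) = ℤ.≤-trans (ℤ.≤-reflexive shift) (ℤ.≤-trans (ℤ.+-monoʳ-≤ (+ 2) (∑-partner n)) (ℤ.≤-reflexive (sym total)))
  where
  open ≡-Reasoning
  shift : + suc (suc n) - 1ℤ ≡ + 2 + (+ n - 1ℤ)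
  shift = ℤ.+-assoc (+ 2) (+ n) (- 1ℤ)
  two : ∀ m (f : Fin (suc (suc m)) → ℤ) → ∑ᵈ (suc (suc m)) f ≡ f zero + (f (suc zero) + ∑ᵈ m (λ i → f (suc (suc i))))
  two m f = trans (∑ᵈ-suc (suc m) f) (cong (_+_ (f zero)) (∑ᵈ-suc m (f ∘ suc)))
  zeros : ∑ᵈ n (λ _ → 0ℤ) ≡ 0ℤ
  zeros = ∑-zero (allFin n)
  total : ∑ᵈ (suc (suc n)) (λ i → ∑ᵈ (suc (suc n)) (λ l → ⟦ partner i l ⟧))
    ≡ + 2 + ∑ᵈ n (λ i → ∑ᵈ n (λ l → ⟦ partner i l ⟧))
  total = begin
    ∑ᵈ (suc (suc n)) (λ i → ∑ᵈ (suc (suc n)) (λ l → ⟦ partner i l ⟧))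
      ≡⟨ two n (λ i → ∑ᵈ (suc (suc n)) (λ l → ⟦ partner i l ⟧)) ⟩
    row zero + (row (suc zero) + ∑ᵈ n (λ i → row (suc (suc i))))
      ≡⟨ cong₂ _+_ (trans (two n (λ l → ⟦ partner zero l ⟧)) (cong (λ z → 0ℤ + (1ℤ + z)) zeros))
          (cong₂ _+_ (trans (two n (λ l → ⟦ partner (suc zero) l ⟧)) (cong (λ z → 1ℤ + (0ℤ + z)) zeros))
            (∑-cong (allFin n) (λ i → trans (two n (λ l → ⟦ partner (suc (suc i)) l ⟧))
              (trans (ℤ.+-identityˡ _) (ℤ.+-identityˡ _))))) ⟩
    1ℤ + (1ℤ + inner) ≡⟨ ℤ.+-assoc 1ℤ 1ℤ inner ⟨
    + 2 + inner ∎
    where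
    row : Fin (suc (suc n)) → ℤ
    row i = ∑ᵈ (suc (suc n)) (λ l → ⟦ partner i l ⟧)
    inner = ∑ᵈ n (λ i → ∑ᵈ n (λ l → ⟦ partner i l ⟧))

-- Each of the two parities costs at most a factor two. They may be imposed in turn, since no
-- direction is both below and above `i`, so that flips along the first set preserve the second
-- parity.
∑-low : ∀ {n} (i : Fin n) → + (2 ℕ.^ n) ≤ + 4 * ∑ᵛ n (λ v → ⟦ low v i ⟧)
∑-low {n} i = begin
  + (2 ℕ.^ n) ≡⟨ trans (∑ᵛ-const n 1ℤ) (ℤ.*-identityʳ (+ (2 ℕ.^ n))) ⟨
  ∑ᵛ n (λ v → 1ℤ) ≤⟨ ∑-parity (above i) (λ _ → true) (λ _ _ _ → refl) ⟩
  + 2 * ∑ᵛ n (λ v → ⟦ not (parity (above i) v) ∧ true ⟧)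
    ≡⟨ cong (_*_ (+ 2)) (∑-cong (allVertices n) (λ v → cong ⟦_⟧ (Bool.∧-identityʳ (not (parity (above i) v))))) ⟩
  + 2 * ∑ᵛ n (λ v → ⟦ not (parity (above i) v) ⟧)
    ≤⟨ ℤ.*-monoˡ-≤-nonNeg (+ 2) (∑-parity (below i) (λ v → not (parity (above i) v)) inv) ⟩
  + 2 * (+ 2 * ∑ᵛ n (λ v → ⟦ low v i ⟧))
    ≡⟨ ℤ.*-assoc (+ 2) (+ 2) (∑ᵛ n (λ v → ⟦ low v i ⟧)) ⟨
  + 4 * ∑ᵛ n (λ v → ⟦ low v i ⟧) ∎
  where
  open ℤ.≤-Reasoning
  exclusive : ∀ m n → (m <ᵇ n) ≡ true → (n <ᵇ m) ≡ false
  exclusive zero (suc n) h = refl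
  exclusive (suc m) (suc n) h = exclusive m n h
  inv : ∀ j v → below i j ≡ true → not (parity (above i) (flip j v)) ≡ not (parity (above i) v)
  inv j v h = cong not (trans (parity-flip (above i) j v) (cong (_xor parity (above i) v) (exclusive (pair j) (pair i) h)))

lowGraph-square : ∀ {n} a (i l : Fin n) → ⟦ partner i l ⟧ * ⟦ low a i ⟧ ≤ ⟦ square (lowGraph n) a i l ⟧
lowGraph-square {n} a i l = go (partner i l) refl (low a i) refl
  where
  G = lowGraph n
  E≡low : ∀ v j → E G v j ≡ low v j
  E≡low = E-fromDirections {n} low (λ i v → low-flip-pair i i v refl)
  go : ∀ p → partner i l ≡ p → ∀ q → low a i ≡ q → ⟦ p ⟧ * ⟦ q ⟧ ≤ ⟦ square G a i l ⟧
  go false _ q _ = subst (_≤ ⟦ square G a i l ⟧) (sym (ℤ.*-zeroˡ ⟦ q ⟧)) (⟦⟧-nonneg (square G a i l))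
  go true _ false _ = ⟦⟧-nonneg (square G a i l)
  go true hp true hq with i≢l , same ← partner-sound i l hp = ℤ.≤-reflexive (cong ⟦_⟧ (sym (cong₂ _∧_
      (trans (cong (λ w → distinct (a ∷ flip i a ∷ w ∷ flip l a ∷ [])) (flip-comm l i a))
        (distinct-map (embed (i ∷ l ∷ []) a) (embed-injective a ((i≢l ∷ []) ∷ [] ∷ []))
          ((false ∷ false ∷ []) ∷ (true ∷ false ∷ []) ∷ (true ∷ true ∷ []) ∷ (false ∷ true ∷ []) ∷ [])))
      (cong₂ _∧_ (trans (E≡low a i) hq)
      (cong₂ _∧_ (trans (E≡low (flip i a) l) (trans (low-flip-pair l i a (sym same)) low-l))
      (cong₂ _∧_ (trans (edge-flip₂′ G l i a) (trans (E≡low (flip l a) i) (trans (low-flip-pair i l a same) hq)))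
        (trans (edge-flip G l a) (trans (E≡low a l) low-l))))))))
    where
    low-l : low a l ≡ true
    low-l = trans (cong (λ p → not (parity (λ j → pair j <ᵇ p) a) ∧ not (parity (λ j → p <ᵇ pair j) a)) (sym same)) hq

lowGraph-count : ∀ n → + (2 ℕ.^ n) * (+ n - 1ℤ) ≤ + 4 * + labelledC4 (lowGraph n)
lowGraph-count n = begin
  N * (+ n - 1ℤ)
    ≤⟨ ℤ.*-monoˡ-≤-nonNeg N (∑-partner n) ⟩
  N * ∑ᵈ n (λ i → ∑ᵈ n (λ l → ⟦ partner i l ⟧))
    ≡⟨ trans (sym (∑-*ˡ D N (λ i → ∑ᵈ n (λ l → ⟦ partner i l ⟧)))) (∑-cong D (λ i → sym (∑-*ˡ D N (λ l → ⟦ partner i l ⟧)))) ⟩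
  ∑ᵈ n (λ i → ∑ᵈ n (λ l → N * ⟦ partner i l ⟧))
    ≤⟨ ∑-mono D (λ i → ∑-mono D (λ l → each i l)) ⟩
  ∑ᵈ n (λ i → ∑ᵈ n (λ l → + 4 * ∑ᵛ n (λ a → ⟦ square G a i l ⟧)))
    ≡⟨ trans (∑-cong D (λ i → ∑-*ˡ D (+ 4) (λ l → ∑ᵛ n (λ a → ⟦ square G a i l ⟧)))) (∑-*ˡ D (+ 4) (λ i → ∑ᵈ n (λ l → ∑ᵛ n (λ a → ⟦ square G a i l ⟧)))) ⟩
  + 4 * ∑ᵈ n (λ i → ∑ᵈ n (λ l → ∑ᵛ n (λ a → ⟦ square G a i l ⟧)))
    ≡⟨ cong (_*_ (+ 4)) (trans (∑-cong D (λ i → sym (∑-swap V D (λ a l → ⟦ square G a i l ⟧)))) (sym (∑-swap V D (λ a i → ∑ᵈ n (λ l → ⟦ square G a i l ⟧))))) ⟩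
  + 4 * ∑ᵛ n (λ a → ∑ᵈ n (λ i → ∑ᵈ n (λ l → ⟦ square G a i l ⟧)))
    ≡⟨ cong (_*_ (+ 4)) (labelledC4≡∑square G) ⟨
  + 4 * + labelledC4 G ∎
  where
  open ℤ.≤-Reasoning
  N = + (2 ℕ.^ n)
  G = lowGraph n
  D = allFin n
  V = allVertices n
  each : ∀ i l → N * ⟦ partner i l ⟧ ≤ + 4 * ∑ᵛ n (λ a → ⟦ square G a i l ⟧)
  each i l = begin
    N * p ≤⟨ ℤ.*-monoʳ-≤-nonNeg p {{nonNegative (⟦⟧-nonneg (partner i l))}} (∑-low i) ⟩
    + 4 * L * p ≡⟨ trans (ℤ.*-assoc (+ 4) L p) (cong (_*_ (+ 4)) (ℤ.*-comm L p)) ⟩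
    + 4 * (p * L) ≡⟨ cong (_*_ (+ 4)) (∑-*ˡ V p (λ a → ⟦ low a i ⟧)) ⟨
    + 4 * ∑ᵛ n (λ a → p * ⟦ low a i ⟧) ≤⟨ ℤ.*-monoˡ-≤-nonNeg (+ 4) (∑-mono V (λ a → lowGraph-square a i l)) ⟩
    + 4 * ∑ᵛ n (λ a → ⟦ square G a i l ⟧) ∎
    where
    p = ⟦ partner i l ⟧
    L = ∑ᵛ n (λ a → ⟦ low a i ⟧)

-- Sums over four directions and a vertex.

-- The sum over vertices is innermost, so that a shift of the vertex may depend on the directions.

Tuples : ℕ → Set
Tuples n = Fin n → Fin n → Fin n → Fin n → Vertex n → ℤ

∑ᵗ : ∀ n → Tuples n → ℤ
∑ᵗ n f = ∑ᵈ n (λ i → ∑ᵈ n (λ j → ∑ᵈ n (λ k → ∑ᵈ n (λ l → ∑ᵛ n (f i j k l)))))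

module _ {n : ℕ} where

  private
    D = allFin n
    V = allVertices n

  ∑ᵗ-cong : ∀ {f g : Tuples n} → (∀ i j k l v → f i j k l v ≡ g i j k l v) → ∑ᵗ n f ≡ ∑ᵗ n g
  ∑ᵗ-cong h = ∑-cong D λ i → ∑-cong D λ j → ∑-cong D λ k → ∑-cong D λ l → ∑-cong V (h i j k l)

  ∑ᵗ-mono : ∀ {f g : Tuples n} → (∀ i j k l v → f i j k l v ≤ g i j k l v) → ∑ᵗ n f ≤ ∑ᵗ n g
  ∑ᵗ-mono h = ∑-mono D λ i → ∑-mono D λ j → ∑-mono D λ k → ∑-mono D λ l → ∑-mono V (h i j k l)

  ∑ᵗ-+ : ∀ (f g : Tuples n) → ∑ᵗ n (λ i j k l v → f i j k l v + g i j k l v) ≡ ∑ᵗ n f + ∑ᵗ n g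
  ∑ᵗ-+ f g = trans (∑-cong D λ i → trans (∑-cong D λ j → trans (∑-cong D λ k → trans (∑-cong D λ l →
    ∑-+ V (f i j k l) (g i j k l))
    (∑-+ D (λ l → ∑ᵛ n (f i j k l)) (λ l → ∑ᵛ n (g i j k l))))
    (∑-+ D (λ k → ∑ᵈ n λ l → ∑ᵛ n (f i j k l)) (λ k → ∑ᵈ n λ l → ∑ᵛ n (g i j k l))))
    (∑-+ D (λ j → ∑ᵈ n λ k → ∑ᵈ n λ l → ∑ᵛ n (f i j k l)) (λ j → ∑ᵈ n λ k → ∑ᵈ n λ l → ∑ᵛ n (g i j k l))))
    (∑-+ D (λ i → ∑ᵈ n λ j → ∑ᵈ n λ k → ∑ᵈ n λ l → ∑ᵛ n (f i j k l)) (λ i → ∑ᵈ n λ j → ∑ᵈ n λ k → ∑ᵈ n λ l → ∑ᵛ n (g i j k l)))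

  ∑ᵗ-* : ∀ c (f : Tuples n) → ∑ᵗ n (λ i j k l v → c * f i j k l v) ≡ c * ∑ᵗ n f
  ∑ᵗ-* c f = trans (∑-cong D λ i → trans (∑-cong D λ j → trans (∑-cong D λ k → trans (∑-cong D λ l →
    ∑-*ˡ V c (f i j k l))
    (∑-*ˡ D c (λ l → ∑ᵛ n (f i j k l))))
    (∑-*ˡ D c (λ k → ∑ᵈ n λ l → ∑ᵛ n (f i j k l))))
    (∑-*ˡ D c (λ j → ∑ᵈ n λ k → ∑ᵈ n λ l → ∑ᵛ n (f i j k l))))
    (∑-*ˡ D c (λ i → ∑ᵈ n λ j → ∑ᵈ n λ k → ∑ᵈ n λ l → ∑ᵛ n (f i j k l)))

  ∑ᵗ-const : ∀ c → ∑ᵗ n (λ _ _ _ _ _ → c) ≡ + n * (+ n * (+ n * (+ n * (+ (2 ℕ.^ n) * c))))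
  ∑ᵗ-const c = begin
    ∑ᵈ n (λ _ → ∑ᵈ n (λ _ → ∑ᵈ n (λ _ → ∑ᵈ n (λ _ → ∑ᵛ n (λ _ → c)))))
      ≡⟨ ∑ᵈ-const n (∑ᵈ n (λ _ → ∑ᵈ n (λ _ → ∑ᵈ n (λ _ → ∑ᵛ n (λ _ → c))))) ⟩
    + n * ∑ᵈ n (λ _ → ∑ᵈ n (λ _ → ∑ᵈ n (λ _ → ∑ᵛ n (λ _ → c))))
      ≡⟨ cong (_*_ (+ n)) (∑ᵈ-const n (∑ᵈ n (λ _ → ∑ᵈ n (λ _ → ∑ᵛ n (λ _ → c))))) ⟩
    + n * (+ n * ∑ᵈ n (λ _ → ∑ᵈ n (λ _ → ∑ᵛ n (λ _ → c))))
      ≡⟨ cong (λ s → + n * (+ n * s)) (∑ᵈ-const n (∑ᵈ n (λ _ → ∑ᵛ n (λ _ → c)))) ⟩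
    + n * (+ n * (+ n * ∑ᵈ n (λ _ → ∑ᵛ n (λ _ → c))))
      ≡⟨ cong (λ s → + n * (+ n * (+ n * s))) (∑ᵈ-const n (∑ᵛ n (λ _ → c))) ⟩
    + n * (+ n * (+ n * (+ n * ∑ᵛ n (λ _ → c))))
      ≡⟨ cong (λ s → + n * (+ n * (+ n * (+ n * s)))) (∑ᵛ-const n c) ⟩
    + n * (+ n * (+ n * (+ n * (+ (2 ℕ.^ n) * c)))) ∎
    where open ≡-Reasoning

  ∑ᵗ-swap₁₂ : ∀ (f : Tuples n) → ∑ᵗ n (λ i j k l → f j i k l) ≡ ∑ᵗ n f
  ∑ᵗ-swap₁₂ f = ∑-swap D D (λ i j → ∑ᵈ n λ k → ∑ᵈ n λ l → ∑ᵛ n (f j i k l))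

  ∑ᵗ-swap₂₃ : ∀ (f : Tuples n) → ∑ᵗ n (λ i j k l → f i k j l) ≡ ∑ᵗ n f
  ∑ᵗ-swap₂₃ f = ∑-cong D λ i → ∑-swap D D (λ j k → ∑ᵈ n λ l → ∑ᵛ n (f i k j l))

  ∑ᵗ-swap₃₄ : ∀ (f : Tuples n) → ∑ᵗ n (λ i j k l → f i j l k) ≡ ∑ᵗ n f
  ∑ᵗ-swap₃₄ f = ∑-cong D λ i → ∑-cong D λ j → ∑-swap D D (λ k l → ∑ᵛ n (f i j l k))

  ∑ᵗ-shift : ∀ (f : Tuples n) (d : Fin n → Fin n → Fin n → Fin n → Fin n) →
    ∑ᵗ n (λ i j k l v → f i j k l (flip (d i j k l) v)) ≡ ∑ᵗ n f
  ∑ᵗ-shift f d = ∑-cong D λ i → ∑-cong D λ j → ∑-cong D λ k → ∑-cong D λ l → ∑ᵛ-flip (d i j k l) (f i j k l)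

  -- Since `k` and `l` run independently over all directions, coincidences included, the double sum
  -- over them is the square of a single sum. This is the positivity used in flag algebras, here
  -- without an error term.
  ∑ᵗ-square : ∀ {A : Set} (G : Fin n → Fin n → Vertex n → List A) (w : Fin n → Fin n → Vertex n → A → Fin n → ℤ) →
    0ℤ ≤ ∑ᵗ n (λ i j k l v → ∑ (G i j v) (λ g → w i j v g k * w i j v g l))
  ∑ᵗ-square {A} G w = ∑-nonneg D λ i → ∑-nonneg D λ j → subst (0ℤ ≤_) (sym (rearrange i j))
    (∑-nonneg V λ v → ∑-nonneg (G i j v) λ g → square-nonneg (∑ᵈ n (w i j v g)))
    where
    square-nonneg : ∀ x → 0ℤ ≤ x * x
    square-nonneg (+ m) = subst (0ℤ ≤_) (ℤ.pos-* m m) (+≤+ z≤n)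
    square-nonneg -[1+ m ] = +≤+ z≤n
    product : ∀ (a : Fin n → ℤ) → ∑ᵈ n (λ k → ∑ᵈ n (λ l → a k * a l)) ≡ ∑ᵈ n a * ∑ᵈ n a
    product a = trans (∑-cong D λ k → trans (∑-*ˡ D (a k) a) (ℤ.*-comm (a k) (∑ᵈ n a))) (∑-*ˡ D (∑ᵈ n a) a)
    inner : ∀ (gs : List A) (a : A → Fin n → ℤ) →
      ∑ᵈ n (λ k → ∑ᵈ n (λ l → ∑ gs (λ g → a g k * a g l))) ≡ ∑ gs (λ g → ∑ᵈ n (a g) * ∑ᵈ n (a g))
    inner gs a = begin
      ∑ᵈ n (λ k → ∑ᵈ n (λ l → ∑ gs (λ g → a g k * a g l)))
        ≡⟨ ∑-cong D (λ k → ∑-swap D gs (λ l g → a g k * a g l)) ⟩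
      ∑ᵈ n (λ k → ∑ gs (λ g → ∑ᵈ n (λ l → a g k * a g l)))
        ≡⟨ ∑-swap D gs (λ k g → ∑ᵈ n (λ l → a g k * a g l)) ⟩
      ∑ gs (λ g → ∑ᵈ n (λ k → ∑ᵈ n (λ l → a g k * a g l)))
        ≡⟨ ∑-cong gs (λ g → product (a g)) ⟩
      ∑ gs (λ g → ∑ᵈ n (a g) * ∑ᵈ n (a g)) ∎
      where open ≡-Reasoning
    rearrange : ∀ i j → ∑ᵈ n (λ k → ∑ᵈ n (λ l → ∑ᵛ n (λ v → ∑ (G i j v) (λ g → w i j v g k * w i j v g l))))
      ≡ ∑ᵛ n (λ v → ∑ (G i j v) (λ g → ∑ᵈ n (w i j v g) * ∑ᵈ n (w i j v g)))
    rearrange i j = begin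
      ∑ᵈ n (λ k → ∑ᵈ n (λ l → ∑ᵛ n (λ v → term v k l)))
        ≡⟨ ∑-cong D (λ k → ∑-swap D V (λ l v → term v k l)) ⟩
      ∑ᵈ n (λ k → ∑ᵛ n (λ v → ∑ᵈ n (λ l → term v k l)))
        ≡⟨ ∑-swap D V (λ k v → ∑ᵈ n (λ l → term v k l)) ⟩
      ∑ᵛ n (λ v → ∑ᵈ n (λ k → ∑ᵈ n (λ l → term v k l)))
        ≡⟨ ∑-cong V (λ v → inner (G i j v) (w i j v)) ⟩
      ∑ᵛ n (λ v → ∑ (G i j v) (λ g → ∑ᵈ n (w i j v g) * ∑ᵈ n (w i j v g))) ∎
      where
      open ≡-Reasoning
      term : Vertex n → Fin n → Fin n → ℤ
      term v k l = ∑ (G i j v) (λ g → w i j v g k * w i j v g l)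

-- Squares with at least three edges.

three : Bool → Bool → Bool → Bool → Bool
three true true true _ = true
three true true false d = d
three true false true d = d
three false true true d = d
three _ _ _ _ = false

_==_ : ∀ {n} → Fin n → Fin n → Bool
i == j with i ≟ j
... | yes _ = true
... | no _ = false

==-false : ∀ {n} (i j : Fin n) → (i == j) ≡ false → i ≢ j
==-false i j h with i ≟ j
... | no i≢j = i≢j

∑-== : ∀ {n} (j : Fin n) → ∑ᵈ n (λ i → ⟦ i == j ⟧) ≡ 1ℤ
∑-== {n} j = trans (∑ᵈ-single (λ i → ⟦ i == j ⟧) j off) diagonal
  where
  off : ∀ i → i ≢ j → ⟦ i == j ⟧ ≡ 0ℤ
  off i i≢j with i ≟ j
  ... | yes i≡j = contradiction i≡j i≢j
  ... | no _ = refl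
  diagonal : ⟦ j == j ⟧ ≡ 1ℤ
  diagonal with j ≟ j
  ... | yes _ = refl
  ... | no j≢j = contradiction refl j≢j

module _ {n} (G : Subgraph n) (free : C6Free G) where

  private
    e : Vertex n → Fin n → Bool
    e = E G
    D = allFin n
    V = allVertices n

  -- The diagonal is counted as bad so that a tuple without bad squares also supplies the distinct
  -- directions that `no-hexagon` asks for.
  bad : Vertex n → Fin n → Fin n → Bool
  bad v i j = (i == j) ∨ three (e v i) (e v j) (e (flip i v) j) (e (flip j v) i)

  -- A square with three edges is charged to a side that may be missing. There are four such sides;
  -- each choice is a translate of `threeSides`, so it costs at most one per vertex and direction.
  -- The diagonal is the fifth unit.
  ∑-bad : ∑ᵈ n (λ i → ∑ᵈ n (λ j → ∑ᵛ n (λ v → ⟦ bad v i j ⟧))) ≤ + 5 * (+ n * + (2 ℕ.^ n))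
  ∑-bad = begin
    ∑ᵈ n (λ i → ∑ᵈ n (λ j → ∑ᵛ n (λ v → ⟦ bad v i j ⟧)))
      ≤⟨ ∑-mono D (λ i → ∑-mono D (λ j → ∑-mono V (λ v → pointwise v i j))) ⟩
    S (λ i j v → ⟦ i == j ⟧ + (P v j i + (P v i j + (P (flip i v) j i + P (flip j v) i j))))
      ≡⟨ S-+ (λ i j v → ⟦ i == j ⟧) (λ i j v → P v j i + (P v i j + (P (flip i v) j i + P (flip j v) i j))) ⟩
    S (λ i j v → ⟦ i == j ⟧) + S (λ i j v → P v j i + (P v i j + (P (flip i v) j i + P (flip j v) i j)))
      ≡⟨ cong (_+_ (S (λ i j v → ⟦ i == j ⟧))) (trans (S-+ (λ i j v → P v j i) (λ i j v → P v i j + (P (flip i v) j i + P (flip j v) i j)))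
           (cong (_+_ (S (λ i j v → P v j i))) (trans (S-+ (λ i j v → P v i j) (λ i j v → P (flip i v) j i + P (flip j v) i j))
           (cong (_+_ (S (λ i j v → P v i j))) (S-+ (λ i j v → P (flip i v) j i) (λ i j v → P (flip j v) i j)))))) ⟩
    S (λ i j v → ⟦ i == j ⟧) + (S (λ i j v → P v j i) + (S (λ i j v → P v i j)
      + (S (λ i j v → P (flip i v) j i) + S (λ i j v → P (flip j v) i j))))
      ≡⟨ cong₂ (λ x y → S (λ i j v → ⟦ i == j ⟧) + (S (λ i j v → P v j i) + (S (λ i j v → P v i j) + (x + y))))
           (∑-cong D (λ i → ∑-cong D (λ j → ∑ᵛ-flip i (λ v → P v j i))))
           (∑-cong D (λ i → ∑-cong D (λ j → ∑ᵛ-flip j (λ v → P v i j)))) ⟩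
    S (λ i j v → ⟦ i == j ⟧) + (S (λ i j v → P v j i) + (S (λ i j v → P v i j)
      + (S (λ i j v → P v j i) + S (λ i j v → P v i j))))
      ≤⟨ ℤ.+-mono-≤ diagonal (ℤ.+-mono-≤ S₁ (ℤ.+-mono-≤ S₂ (ℤ.+-mono-≤ S₁ S₂))) ⟩
    K + (K + (K + (K + K)))
      ≡⟨ solve 1 (λ k → k :+ (k :+ (k :+ (k :+ k))) := con (+ 5) :* k) refl K ⟩
    + 5 * K ∎
    where
    open ℤ.≤-Reasoning
    open +-*-Solver using (solve; _:+_; _:*_; _:=_; con)
    K = + n * + (2 ℕ.^ n)
    P : Vertex n → Fin n → Fin n → ℤ
    P v k i = ⟦ threeSides G free v k i ⟧
    S : (Fin n → Fin n → Vertex n → ℤ) → ℤ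
    S f = ∑ᵈ n (λ i → ∑ᵈ n (λ j → ∑ᵛ n (f i j)))
    S-+ : ∀ f g → S (λ i j v → f i j v + g i j v) ≡ S f + S g
    S-+ f g = trans (∑-cong D λ i → trans (∑-cong D λ j → ∑-+ V (f i j) (g i j))
      (∑-+ D (λ j → ∑ᵛ n (f i j)) (λ j → ∑ᵛ n (g i j))))
      (∑-+ D (λ i → ∑ᵈ n (λ j → ∑ᵛ n (f i j))) (λ i → ∑ᵈ n (λ j → ∑ᵛ n (g i j))))
    total : ∀ (f : Fin n → Fin n → Vertex n → ℤ) → (∀ v j → ∑ᵈ n (λ i → f i j v) ≤ 1ℤ) → S f ≤ K
    total f h = begin
      S f ≡⟨ ∑-swap D D (λ i j → ∑ᵛ n (f i j)) ⟩
      ∑ᵈ n (λ j → ∑ᵈ n (λ i → ∑ᵛ n (f i j))) ≡⟨ ∑-cong D (λ j → ∑-swap D V (λ i v → f i j v)) ⟩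
      ∑ᵈ n (λ j → ∑ᵛ n (λ v → ∑ᵈ n (λ i → f i j v))) ≤⟨ ∑-mono D (λ j → ∑-mono V (λ v → h v j)) ⟩
      ∑ᵈ n (λ j → ∑ᵛ n (λ v → 1ℤ)) ≡⟨ trans (∑-cong D (λ j → trans (∑ᵛ-const n 1ℤ) (ℤ.*-identityʳ (+ (2 ℕ.^ n))))) (∑ᵈ-const n (+ (2 ℕ.^ n))) ⟩
      K ∎
    diagonal : S (λ i j v → ⟦ i == j ⟧) ≤ K
    diagonal = total (λ i j v → ⟦ i == j ⟧) (λ v j → ℤ.≤-reflexive (∑-== j))
    S₁ : S (λ i j v → P v j i) ≤ K
    S₁ = total (λ i j v → P v j i) (λ v j → ∑threeSides≤1 G free v j)
    S₂ : S (λ i j v → P v i j) ≤ K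
    S₂ = ℤ.≤-trans (ℤ.≤-reflexive (∑-swap D D (λ i j → ∑ᵛ n (λ v → P v i j)))) S₁
    threeSides-≢ : ∀ v k i → i ≢ k → threeSides G free v k i ≡ e v i ∧ e (flip i v) k ∧ e (flip k v) i
    threeSides-≢ v k i i≢k with i ≟ k
    ... | yes i≡k = contradiction i≡k i≢k
    ... | no _ = refl
    pointwise : ∀ v i j → ⟦ bad v i j ⟧ ≤ ⟦ i == j ⟧ + (P v j i + (P v i j + (P (flip i v) j i + P (flip j v) i j)))
    pointwise v i j = go (i == j) refl
      where
      nn : ∀ v i j → 0ℤ ≤ P v i j
      nn v i j = ⟦⟧-nonneg (threeSides G free v i j)
      cases : ∀ a b c d → ⟦ three a b c d ⟧ ≤
        0ℤ + (⟦ a ∧ c ∧ d ⟧ + (⟦ b ∧ d ∧ c ⟧ + (⟦ a ∧ b ∧ d ⟧ + ⟦ b ∧ a ∧ c ⟧)))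
      cases false false false false = +≤+ z≤n
      cases false false false true = +≤+ z≤n
      cases false false true false = +≤+ z≤n
      cases false false true true = +≤+ z≤n
      cases false true false false = +≤+ z≤n
      cases false true false true = +≤+ z≤n
      cases false true true false = +≤+ z≤n
      cases false true true true = +≤+ (s≤s z≤n)
      cases true false false false = +≤+ z≤n
      cases true false false true = +≤+ z≤n
      cases true false true false = +≤+ z≤n
      cases true false true true = +≤+ (s≤s z≤n)
      cases true true false false = +≤+ z≤n
      cases true true false true = +≤+ (s≤s z≤n)
      cases true true true false = +≤+ (s≤s z≤n)
      cases true true true true = +≤+ (s≤s z≤n)
      go : ∀ b → (i == j) ≡ b → ⟦ b ∨ three (e v i) (e v j) (e (flip i v) j) (e (flip j v) i) ⟧ ≤
        ⟦ b ⟧ + (P v j i + (P v i j + (P (flip i v) j i + P (flip j v) i j)))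
      go true _ = ℤ.i≤i+j 1ℤ (P v j i + (P v i j + (P (flip i v) j i + P (flip j v) i j)))
        {{nonNegative (ℤ.+-mono-≤ (nn v j i) (ℤ.+-mono-≤ (nn v i j) (ℤ.+-mono-≤ (nn (flip i v) j i) (nn (flip j v) i j))))}}
      -- Expresses all four terms by the same four sides of the square.
      go false h rewrite threeSides-≢ v j i (==-false i j h) | threeSides-≢ v i j (==-false i j h ∘ sym)
        | threeSides-≢ (flip i v) j i (==-false i j h) | threeSides-≢ (flip j v) i j (==-false i j h ∘ sym)
        | E-flip G i v | E-flip G j v | flip-flip i v | flip-flip j v
        | flip-comm j i v | E-flip G i (flip j v) | sym (flip-comm j i v) | E-flip G j (flip i v)
        = cases (e v i) (e v j) (e (flip i v) j) (edge G (flip j v) (flip j (flip i v)))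

-- Local configurations

-- The edges of the square (v; i, j), seen from v: v – v+i, v – v+j, then the j-edge at v+i and the i-edge at v+j.
data Base : Set where
  base : (i j ij ji : Bool) → Base

-- What v, v+i, v+j see of a further direction k: the k-edge at v, the k-edge at v+i, the i-edge at v+k,
-- the k-edge at v+j, the j-edge at v+k.
data Flag : Set where
  flag : (k ik ki jk kj : Bool) → Flag

noHexagon : (a b c d e f : Bool) → Bool
noHexagon a b c d e f = not (a ∧ b ∧ c ∧ d ∧ e ∧ f)

-- A square m₀ m₁ m₂ m₃ in cyclic order, its translate t₀ t₁ t₂ t₃, and the edges s₀ s₁ s₂ s₃ between them.
sparse : (m₀ m₁ m₂ m₃ s₀ s₁ s₂ s₃ t₀ t₁ t₂ t₃ : Bool) → Bool
sparse m₀ m₁ m₂ m₃ s₀ s₁ s₂ s₃ t₀ t₁ t₂ t₃ =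
  not (three m₀ s₀ s₁ t₀) ∧ not (three m₁ s₁ s₂ t₁) ∧ not (three m₂ s₃ s₂ t₂) ∧ not (three m₃ s₀ s₃ t₃)
  ∧ not (three t₀ t₃ t₁ t₂)
  ∧ noHexagon m₁ m₂ s₁ s₃ t₀ t₃ ∧ noHexagon m₂ m₃ s₂ s₀ t₁ t₀
  ∧ noHexagon m₃ m₀ s₃ s₁ t₂ t₁ ∧ noHexagon m₀ m₁ s₀ s₂ t₃ t₂

not-false : ∀ {b} → b ≡ false → not b ≡ true
not-false refl = refl

noHexagon-intro : ∀ a b c d e f →
  (a ≡ true → b ≡ true → c ≡ true → d ≡ true → e ≡ true → f ≡ true → ⊥) → noHexagon a b c d e f ≡ true
noHexagon-intro true true true true true true h = ⊥-elim (h refl refl refl refl refl refl)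
noHexagon-intro true true true true true false h = refl
noHexagon-intro true true true true false f h = refl
noHexagon-intro true true true false e f h = refl
noHexagon-intro true true false d e f h = refl
noHexagon-intro true false c d e f h = refl
noHexagon-intro false b c d e f h = refl

⟦∨⟧ : ∀ a b → ⟦ a ∨ b ⟧ ≤ ⟦ a ⟧ + ⟦ b ⟧
⟦∨⟧ true true = +≤+ (s≤s z≤n)
⟦∨⟧ true false = ℤ.≤-refl
⟦∨⟧ false true = ℤ.≤-refl
⟦∨⟧ false false = ℤ.≤-refl

-- The constraints whose edges are all visible from `v`. In each 3-cube at `v` only one hexagon
-- qualifies, the one avoiding `v`, because the others pass through the antipode of `v`.
sparse₄ : (i j k l ij ji ik ki il li jk kj jl lj kl lk : Bool) → Bool
sparse₄ i j k l ij ji ik ki il li jk kj jl lj kl lk =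
  not (three i j ij ji) ∧ not (three i k ik ki) ∧ not (three i l il li)
  ∧ not (three j k jk kj) ∧ not (three j l jl lj) ∧ not (three k l kl lk)
  ∧ noHexagon ij ji jk kj ki ik ∧ noHexagon ij ji jl lj li il
  ∧ noHexagon ik ki kl lk li il ∧ noHexagon jk kj kl lk lj jl

-- Certificates and the inequalities that they satisfy.

record Proposal : Set₁ where
  field
    u : Base → Flag → Flag → ℤ
    Index : Set
    indices : Base → List Index
    w : Base → Index → Flag → ℤ
    κ A C : ℤ

  y : Base → Flag → Flag → ℤ
  y b f g = ∑ (indices b) (λ r → w b r f * w b r g)

  -- The factor 1000 puts potentials recorded as integers of at most five digits on the scale of
  -- products of two weights.
  z : Base → Flag → Flag → ℤ
  z b f g = + 1000 * u b f g - y b f g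

  -- The square is viewed from its vertices in cyclic order. Unprimed and primed edges belong to two
  -- 3-cubes on this square, one for each flag.
  roundTrip : (m₀ m₁ m₂ m₃ s₀ s₁ s₂ s₃ t₀ t₁ t₂ t₃ s₀′ s₁′ s₂′ s₃′ t₀′ t₁′ t₂′ t₃′ : Bool) → ℤ
  roundTrip m₀ m₁ m₂ m₃ s₀ s₁ s₂ s₃ t₀ t₁ t₂ t₃ s₀′ s₁′ s₂′ s₃′ t₀′ t₁′ t₂′ t₃′ =
    u (base m₀ m₃ m₁ m₂) (flag s₀ s₁ t₀ s₃ t₃) (flag s₀′ s₁′ t₀′ s₃′ t₃′)
    + (u (base m₀ m₁ m₃ m₂) (flag s₁ s₀ t₀ s₂ t₁) (flag s₁′ s₀′ t₀′ s₂′ t₁′)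
    + (u (base m₂ m₁ m₃ m₀) (flag s₂ s₃ t₂ s₁ t₁) (flag s₂′ s₃′ t₂′ s₁′ t₁′)
    + u (base m₂ m₃ m₁ m₀) (flag s₃ s₂ t₂ s₀ t₃) (flag s₃′ s₂′ t₂′ s₀′ t₃′)))

  local : (i j k l ij ji ik ki il li jk kj jl lj kl lk : Bool) → ℤ
  local i j k l ij ji ik ki il li jk kj jl lj kl lk =
    z (base i j ij ji) (flag k ik ki jk kj) (flag l il li jl lj)
    + (z (base i k ik ki) (flag j ij ji kj jk) (flag l il li kl lk)
    + (z (base i l il li) (flag j ij ji lj jl) (flag k ik ki lk kl)
    + (z (base j k jk kj) (flag i ji ij ki ik) (flag l jl lj kl lk)
    + (z (base j l jl lj) (flag i ji ij li il) (flag k jk kj lk kl)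
    + z (base k l kl lk) (flag i ki ik li il) (flag j kj jk lj jl)))))

record Certificate : Set₁ where
  field
    proposal : Proposal

  open Proposal proposal public

  field
    C-nonneg : 0ℤ ≤ C
    κ-nonneg : 0ℤ ≤ κ
    A-nonneg : 0ℤ ≤ A
    -- This bound and the next are required of all arguments, impossible configurations included:
    -- they are what is used on tuples with a bad square.
    u-bound : ∀ b f g → u b f g ≤ C
    z-bound : ∀ b f g → - C ≤ z b f g
    roundTrip≤0 : ∀ m₀ m₁ m₂ m₃ s₀ s₁ s₂ s₃ t₀ t₁ t₂ t₃ s₀′ s₁′ s₂′ s₃′ t₀′ t₁′ t₂′ t₃′ →
      not (three m₀ m₃ m₁ m₂) ≡ true →
      sparse m₀ m₁ m₂ m₃ s₀ s₁ s₂ s₃ t₀ t₁ t₂ t₃ ≡ true →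
      sparse m₀ m₁ m₂ m₃ s₀′ s₁′ s₂′ s₃′ t₀′ t₁′ t₂′ t₃′ ≡ true →
      roundTrip m₀ m₁ m₂ m₃ s₀ s₁ s₂ s₃ t₀ t₁ t₂ t₃ s₀′ s₁′ s₂′ s₃′ t₀′ t₁′ t₂′ t₃′ ≤ 0ℤ
    local≥ : ∀ i j k l ij ji ik ki il li jk kj jl lj kl lk →
      sparse₄ i j k l ij ji ik ki il li jk kj jl lj kl lk ≡ true →
      κ * (⟦ i ⟧ + (⟦ j ⟧ + (⟦ k ⟧ + ⟦ l ⟧))) ≤ A + local i j k l ij ji ik ki il li jk kj jl lj kl lk

-- A certificate evaluated in a C6-free subgraph.

module _ {n} (G : Subgraph n) (free : C6Free G) (c : Certificate) where
  open Certificate c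

  private
    e : Vertex n → Fin n → Bool
    e = E G
    bd : Vertex n → Fin n → Fin n → Bool
    bd = bad G free

  baseAt : Fin n → Fin n → Vertex n → Base
  baseAt i j v = base (e v i) (e v j) (e (flip i v) j) (e (flip j v) i)

  flagAt : Fin n → Fin n → Fin n → Vertex n → Flag
  flagAt i j k v = flag (e v k) (e (flip i v) k) (e (flip k v) i) (e (flip j v) k) (e (flip k v) j)

  uAt zAt : Tuples n
  uAt i j k l v = u (baseAt i j v) (flagAt i j k v) (flagAt i j l v)
  zAt i j k l v = z (baseAt i j v) (flagAt i j k v) (flagAt i j l v)

  private
    base-cong : ∀ {a a′ b b′ c c′ d d′} → a ≡ a′ → b ≡ b′ → c ≡ c′ → d ≡ d′ → base a b c d ≡ base a′ b′ c′ d′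
    base-cong refl refl refl refl = refl
    flag-cong : ∀ {a a′ b b′ c c′ d d′ f f′} → a ≡ a′ → b ≡ b′ → c ≡ c′ → d ≡ d′ → f ≡ f′ →
      flag a b c d f ≡ flag a′ b′ c′ d′ f′
    flag-cong refl refl refl refl refl = refl
    u-cong : ∀ {b b′ f f′ g g′} → b ≡ b′ → f ≡ f′ → g ≡ g′ → u b f g ≡ u b′ f′ g′
    u-cong refl refl refl = refl

    e-comm : ∀ i j k v → e (flip i (flip j v)) k ≡ e (flip j (flip i v)) k
    e-comm i j k v = cong (λ x → e x k) (flip-comm i j v)
    e-back : ∀ i k v → e (flip i (flip i v)) k ≡ e v k
    e-back i k v = cong (λ x → e x k) (flip-flip i v)
    e-across : ∀ i j v → e (flip j (flip i v)) i ≡ e (flip j v) i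
    e-across i j v = trans (e-comm j i i v) (E-flip G i (flip j v))

    base₁ : ∀ i j v → baseAt i j (flip i v) ≡ base (e v i) (e (flip i v) j) (e v j) (e (flip j v) i)
    base₁ i j v = base-cong (E-flip G i v) refl (e-back i j v) (e-across i j v)
    base₃ : ∀ i j v → baseAt i j (flip j v) ≡ base (e (flip j v) i) (e v j) (e (flip i v) j) (e v i)
    base₃ i j v = base-cong refl (E-flip G j v) (e-across j i v) (e-back j i v)
    flag₁ : ∀ i j k v → flagAt i j k (flip i v) ≡
      flag (e (flip i v) k) (e v k) (e (flip k v) i) (e (flip j (flip i v)) k) (e (flip i (flip k v)) j)
    flag₁ i j k v = flag-cong refl (e-back i k v) (e-across i k v) refl (e-comm k i j v)
    flag₃ : ∀ i j k v → flagAt i j k (flip j v) ≡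
      flag (e (flip j v) k) (e (flip j (flip i v)) k) (e (flip j (flip k v)) i) (e v k) (e (flip k v) j)
    flag₃ i j k v = flag-cong refl (e-comm i j k v) (e-comm k j i v) (e-back j k v) (e-across j k v)
    base₂ : ∀ i j v → baseAt i j (flip j (flip i v)) ≡ base (e (flip j v) i) (e (flip i v) j) (e v j) (e v i)
    base₂ i j v = trans (base₃ i j (flip i v)) (base-cong (e-across i j v) refl (e-back i j v) (E-flip G i v))
    flag₂ : ∀ i j k v → flagAt i j k (flip j (flip i v)) ≡
      flag (e (flip j (flip i v)) k) (e (flip j v) k) (e (flip j (flip k v)) i) (e (flip i v) k) (e (flip i (flip k v)) j)
    flag₂ i j k v = trans (flag₃ i j k (flip i v)) (flag-cong refl
      (trans (e-comm j i k (flip i v)) (trans (cong (λ x → e (flip i x) k) (flip-comm j i v)) (e-back i k (flip j v))))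
      (trans (cong (λ x → e (flip j x) i) (flip-comm k i v)) (e-across i j (flip k v)))
      refl (e-comm k i j v))

  -- Five faces of the 3-cube; the sixth, the square `(v; i, j)` itself, is shared by the two cubes
  -- of a round trip and listed once in `tripBad`. Together these are eleven faces.
  cubeBad : Fin n → Fin n → Fin n → Vertex n → Bool
  cubeBad i j k v = bd v i k ∨ (bd v j k ∨ (bd (flip j v) i k ∨ (bd (flip i v) j k ∨ bd (flip k v) i j)))

  tripBad : Fin n → Fin n → Fin n → Fin n → Vertex n → Bool
  tripBad i j k l v = bd v i j ∨ (cubeBad i j k v ∨ cubeBad i j l v)

  private
    square-ok : ∀ v i j → bd v i j ≡ false → not (three (e v i) (e v j) (e (flip i v) j) (e (flip j v) i)) ≡ true
    square-ok v i j h = not-false (∨-conicalʳ (i == j) _ h)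


    ∧-intro : ∀ {a b} → a ≡ true → b ≡ true → a ∧ b ≡ true
    ∧-intro refl refl = refl

    ⟨_⟩_ : ∀ {x y : Bool} → x ≡ y → y ≡ true → x ≡ true
    ⟨ p ⟩ q = trans p q

    three-cong : ∀ {a a′ b b′ c c′ d d′} → a ≡ a′ → b ≡ b′ → c ≡ c′ → d ≡ d′ →
      not (three a b c d) ≡ true → not (three a′ b′ c′ d′) ≡ true
    three-cong refl refl refl refl h = h

    -- The four hexagons of a 3-cube correspond to its four pairs of antipodes, and the vertices of
    -- the square `(v; i, j)` represent these pairs. So `no-hexagon` is applied at each of these
    -- vertices.
    sparseAt : ∀ i j k v → bd v i j ≡ false → cubeBad i j k v ≡ false →
      sparse (e v i) (e (flip i v) j) (e (flip j v) i) (e v j)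
        (e v k) (e (flip i v) k) (e (flip j (flip i v)) k) (e (flip j v) k)
        (e (flip k v) i) (e (flip i (flip k v)) j) (e (flip j (flip k v)) i) (e (flip k v) j) ≡ true
    sparseAt i j k v hij h =
      ∧-intro (square-ok v i k hik)
      (∧-intro (three-cong refl refl refl (e-comm k i j v) (square-ok (flip i v) j k hjk′))
      (∧-intro (three-cong refl refl (e-comm i j k v) (e-comm k j i v) (square-ok (flip j v) i k hik′))
      (∧-intro (square-ok v j k hjk)
      (∧-intro (square-ok (flip k v) i j hij′)
      (∧-intro (noHexagon-intro _ _ _ _ _ _ (λ m₁ m₂ s₁ s₃ t₀ t₃ → no-hexagon G free v d m₁ m₂ s₃ t₃ t₀ s₁))
      (∧-intro (noHexagon-intro _ _ _ _ _ _ (λ m₂ m₃ s₂ s₀ t₁ t₀ → no-hexagon G free (flip i v) d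
        (⟨ e-back i j v ⟩ m₃) (⟨ e-across i j v ⟩ m₂) s₂ (⟨ e-comm k i j v ⟩ t₁) (⟨ e-across i k v ⟩ t₀) (⟨ e-back i k v ⟩ s₀)))
      (∧-intro (noHexagon-intro _ _ _ _ _ _ (λ m₃ m₀ s₃ s₁ t₂ t₁ → no-hexagon G free (flip j (flip i v)) d
        (⟨ trans (e-across j i (flip i v)) (e-back i j v) ⟩ m₃)
        (⟨ trans (e-back j i (flip i v)) (E-flip G i v) ⟩ m₀)
        (⟨ e-back j k (flip i v) ⟩ s₁)
        (⟨ trans (e-across j k (flip i v)) (e-comm k i j v) ⟩ t₁)
        (⟨ trans (e-comm k j i (flip i v)) (trans (cong (λ x → e (flip j x) i) (flip-comm k i v)) (e-across i j (flip k v))) ⟩ t₂)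
        (⟨ trans (e-comm i j k (flip i v)) (cong (λ x → e (flip j x) k) (flip-flip i v)) ⟩ s₃)))
      (noHexagon-intro _ _ _ _ _ _ (λ m₀ m₁ s₀ s₂ t₃ t₂ → no-hexagon G free (flip j v) d
        (⟨ e-across j i v ⟩ m₁) (⟨ e-back j i v ⟩ m₀) (⟨ e-back j k v ⟩ s₀)
        (⟨ e-across j k v ⟩ t₃) (⟨ e-comm k j i v ⟩ t₂) (⟨ e-comm i j k v ⟩ s₂)))))))))) 
      where
      h₁ = ∨-conicalʳ (bd v i k) _ h
      h₂ = ∨-conicalʳ (bd v j k) _ h₁
      h₃ = ∨-conicalʳ (bd (flip j v) i k) _ h₂
      hik = ∨-conicalˡ (bd v i k) _ h
      hjk = ∨-conicalˡ (bd v j k) _ h₁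
      hik′ = ∨-conicalˡ (bd (flip j v) i k) _ h₂
      hjk′ = ∨-conicalˡ (bd (flip i v) j k) _ h₃
      hij′ = ∨-conicalʳ (bd (flip i v) j k) _ h₃
      d : Distinct₃ i j k
      d = ==-false i j (∨-conicalˡ (i == j) _ hij) , ==-false i k (∨-conicalˡ (i == k) _ hik)
        , ==-false j k (∨-conicalˡ (j == k) _ hjk)

  localBad : Fin n → Fin n → Fin n → Fin n → Vertex n → Bool
  localBad i j k l v = bd v i j ∨ (bd v i k ∨ (bd v i l ∨ (bd v j k ∨ (bd v j l ∨ bd v k l))))

  private
    sparse₄At : ∀ i j k l v → localBad i j k l v ≡ false →
      sparse₄ (e v i) (e v j) (e v k) (e v l) (e (flip i v) j) (e (flip j v) i) (e (flip i v) k) (e (flip k v) i)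
        (e (flip i v) l) (e (flip l v) i) (e (flip j v) k) (e (flip k v) j) (e (flip j v) l) (e (flip l v) j)
        (e (flip k v) l) (e (flip l v) k) ≡ true
    sparse₄At i j k l v h =
      ∧-intro (square-ok v i j hij) (∧-intro (square-ok v i k hik) (∧-intro (square-ok v i l hil)
      (∧-intro (square-ok v j k hjk) (∧-intro (square-ok v j l hjl) (∧-intro (square-ok v k l hkl)
      (∧-intro (hexagon hij hik hjk) (∧-intro (hexagon hij hil hjl) (∧-intro (hexagon hik hil hkl) (hexagon hjk hjl hkl)))))))))
      where
      h₁ = ∨-conicalʳ (bd v i j) _ h
      h₂ = ∨-conicalʳ (bd v i k) _ h₁
      h₃ = ∨-conicalʳ (bd v i l) _ h₂
      h₄ = ∨-conicalʳ (bd v j k) _ h₃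
      hij = ∨-conicalˡ (bd v i j) _ h
      hik = ∨-conicalˡ (bd v i k) _ h₁
      hil = ∨-conicalˡ (bd v i l) _ h₂
      hjk = ∨-conicalˡ (bd v j k) _ h₃
      hjl = ∨-conicalˡ (bd v j l) _ h₄
      hkl = ∨-conicalʳ (bd v j l) _ h₄
      hexagon : ∀ {x y z} → bd v x y ≡ false → bd v x z ≡ false → bd v y z ≡ false →
        noHexagon (e (flip x v) y) (e (flip y v) x) (e (flip y v) z) (e (flip z v) y) (e (flip z v) x) (e (flip x v) z) ≡ true
      hexagon {x} {y} {z} hxy hxz hyz = noHexagon-intro _ _ _ _ _ _ (no-hexagon G free v
        ( ==-false x y (∨-conicalˡ (x == y) _ hxy) , ==-false x z (∨-conicalˡ (x == z) _ hxz)
        , ==-false y z (∨-conicalˡ (y == z) _ hyz)))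

  tripU : Tuples n
  tripU i j k l v = uAt i j k l v + (uAt i j k l (flip i v)
    + (uAt i j k l (flip j (flip i v)) + uAt i j k l (flip j v)))

  tripU≤ : ∀ i j k l v → tripU i j k l v ≤ + 4 * C * ⟦ tripBad i j k l v ⟧
  tripU≤ i j k l v = go (tripBad i j k l v) refl
    where
    go : ∀ b → tripBad i j k l v ≡ b → tripU i j k l v ≤ + 4 * C * ⟦ b ⟧
    go true _ = ℤ.≤-trans
      (ℤ.+-mono-≤ (u-bound _ _ _) (ℤ.+-mono-≤ (u-bound _ _ _) (ℤ.+-mono-≤ (u-bound _ _ _) (u-bound _ _ _))))
      (ℤ.≤-reflexive (solve 1 (λ x → x :+ (x :+ (x :+ x)) := con (+ 4) :* x :* con 1ℤ) refl C))
      where open +-*-Solver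
    go false h = subst₂ _≤_
      (sym (cong (_+_ (uAt i j k l v)) (cong₂ _+_ (u-cong (base₁ i j v) (flag₁ i j k v) (flag₁ i j l v))
        (cong₂ _+_ (u-cong (base₂ i j v) (flag₂ i j k v) (flag₂ i j l v)) (u-cong (base₃ i j v) (flag₃ i j k v) (flag₃ i j l v))))))
      (sym (ℤ.*-zeroʳ (+ 4 * C)))
      (roundTrip≤0 (e v i) (e (flip i v) j) (e (flip j v) i) (e v j)
        (e v k) (e (flip i v) k) (e (flip j (flip i v)) k) (e (flip j v) k)
        (e (flip k v) i) (e (flip i (flip k v)) j) (e (flip j (flip k v)) i) (e (flip k v) j)
        (e v l) (e (flip i v) l) (e (flip j (flip i v)) l) (e (flip j v) l)
        (e (flip l v) i) (e (flip i (flip l v)) j) (e (flip j (flip l v)) i) (e (flip l v) j)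
        (square-ok v i j hij)
        (sparseAt i j k v hij (∨-conicalˡ (cubeBad i j k v) _ h′))
        (sparseAt i j l v hij (∨-conicalʳ (cubeBad i j k v) _ h′)))
      where
      hij = ∨-conicalˡ (bd v i j) _ h
      h′ = ∨-conicalʳ (bd v i j) _ h

  degree : Tuples n
  degree i j k l v = ⟦ e v i ⟧ + (⟦ e v j ⟧ + (⟦ e v k ⟧ + ⟦ e v l ⟧))

  localZ : Tuples n
  localZ i j k l v = zAt i j k l v + (zAt i k j l v + (zAt i l j k v
    + (zAt j k i l v + (zAt j l i k v + zAt k l i j v))))

  -- On a bad tuple this makes the inequality trivial: six local terms are at least `- C` each, and
  -- the degree term is at most `4 κ`.
  penalty : ℤ
  penalty = + 6 * C + + 4 * κ

  degree≤ : ∀ i j k l v → κ * degree i j k l v ≤ A + localZ i j k l v + penalty * ⟦ localBad i j k l v ⟧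
  degree≤ i j k l v = go (localBad i j k l v) refl
    where
    open ℤ.≤-Reasoning
    ⟦⟧≤1 : ∀ b → ⟦ b ⟧ ≤ 1ℤ
    ⟦⟧≤1 true = ℤ.≤-refl
    ⟦⟧≤1 false = +≤+ z≤n
    go : ∀ b → localBad i j k l v ≡ b → κ * degree i j k l v ≤ A + localZ i j k l v + penalty * ⟦ b ⟧
    go false h = begin
      κ * degree i j k l v ≤⟨ local≥ _ _ _ _ _ _ _ _ _ _ _ _ _ _ _ _ (sparse₄At i j k l v h) ⟩
      A + localZ i j k l v ≡⟨ ℤ.+-identityʳ (A + localZ i j k l v) ⟨
      A + localZ i j k l v + 0ℤ ≡⟨ cong (_+_ (A + localZ i j k l v)) (ℤ.*-zeroʳ penalty) ⟨
      A + localZ i j k l v + penalty * 0ℤ ∎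
    go true _ = begin
      κ * degree i j k l v
        ≤⟨ ℤ.*-monoˡ-≤-nonNeg κ {{nonNegative κ-nonneg}} (ℤ.+-mono-≤ (⟦⟧≤1 (e v i)) (ℤ.+-mono-≤ (⟦⟧≤1 (e v j)) (ℤ.+-mono-≤ (⟦⟧≤1 (e v k)) (⟦⟧≤1 (e v l))))) ⟩
      κ * + 4
        ≡⟨ solve 2 (λ κ c → κ :* con (+ 4) := con 0ℤ :+ (:- c :+ (:- c :+ (:- c :+ (:- c :+ (:- c :+ :- c)))))
             :+ (con (+ 6) :* c :+ con (+ 4) :* κ) :* con 1ℤ) refl κ C ⟩
      0ℤ + (- C + (- C + (- C + (- C + (- C + - C))))) + penalty * 1ℤ
        ≤⟨ ℤ.+-monoˡ-≤ (penalty * 1ℤ) (ℤ.+-mono-≤ A-nonneg (ℤ.+-mono-≤ (z-bound _ _ _) (ℤ.+-mono-≤ (z-bound _ _ _)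
             (ℤ.+-mono-≤ (z-bound _ _ _) (ℤ.+-mono-≤ (z-bound _ _ _) (ℤ.+-mono-≤ (z-bound _ _ _) (z-bound _ _ _))))))) ⟩
      A + localZ i j k l v + penalty * 1ℤ ∎
      where open +-*-Solver

  ∑-y≥0 : 0ℤ ≤ ∑ᵗ n (λ i j k l v → y (baseAt i j v) (flagAt i j k v) (flagAt i j l v))
  ∑-y≥0 = ∑ᵗ-square (λ i j v → indices (baseAt i j v)) (λ i j v r k → w (baseAt i j v) r (flagAt i j k v))

-- The edge density of C6-free subgraphs

module _ {n : ℕ} (f : Tuples n) where

  ∑ᵗ-ikjl : ∑ᵗ n (λ i j k l → f i k j l) ≡ ∑ᵗ n f
  ∑ᵗ-ikjl = ∑ᵗ-swap₂₃ f

  ∑ᵗ-iljk : ∑ᵗ n (λ i j k l → f i l j k) ≡ ∑ᵗ n f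
  ∑ᵗ-iljk = trans (∑ᵗ-swap₃₄ (λ i j k l → f i k j l)) ∑ᵗ-ikjl

  ∑ᵗ-jkil : ∑ᵗ n (λ i j k l → f j k i l) ≡ ∑ᵗ n f
  ∑ᵗ-jkil = trans (∑ᵗ-swap₁₂ (λ i j k l → f i k j l)) ∑ᵗ-ikjl

  ∑ᵗ-jlik : ∑ᵗ n (λ i j k l → f j l i k) ≡ ∑ᵗ n f
  ∑ᵗ-jlik = trans (∑ᵗ-swap₁₂ (λ i j k l → f i l j k)) ∑ᵗ-iljk

  ∑ᵗ-klij : ∑ᵗ n (λ i j k l → f k l i j) ≡ ∑ᵗ n f
  ∑ᵗ-klij = trans (∑ᵗ-swap₂₃ (λ i j k l → f j l i k)) ∑ᵗ-jlik

module _ {n} (G : Subgraph n) (free : C6Free G) where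

  private
    D = allFin n
    bd : Vertex n → Fin n → Fin n → Bool
    bd = bad G free
    N K : ℤ
    N = + (2 ℕ.^ n)
    K = + n * (+ n * (+ 5 * (+ n * N)))

    face : Tuples n
    face i j k l v = ⟦ bd v i j ⟧

    ∑-face : ∑ᵗ n face ≤ K
    ∑-face = begin
      ∑ᵗ n face
        ≡⟨ ∑-cong D (λ i → ∑-cong D (λ j → trans (∑ᵈ-const n (∑ᵈ n (λ _ → s i j))) (cong (_*_ (+ n)) (∑ᵈ-const n (s i j))))) ⟩
      ∑ᵈ n (λ i → ∑ᵈ n (λ j → + n * (+ n * s i j)))
        ≡⟨ pull (+ n) (λ i j → + n * s i j) ⟩
      + n * ∑ᵈ n (λ i → ∑ᵈ n (λ j → + n * s i j))
        ≡⟨ cong (_*_ (+ n)) (pull (+ n) s) ⟩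
      + n * (+ n * ∑ᵈ n (λ i → ∑ᵈ n (λ j → s i j)))
        ≤⟨ ℤ.*-monoˡ-≤-nonNeg (+ n) (ℤ.*-monoˡ-≤-nonNeg (+ n) (∑-bad G free)) ⟩
      K ∎
      where
      open ℤ.≤-Reasoning
      s : Fin n → Fin n → ℤ
      s i j = ∑ᵛ n (λ v → ⟦ bd v i j ⟧)
      pull : ∀ a (t : Fin n → Fin n → ℤ) → ∑ᵈ n (λ i → ∑ᵈ n (λ j → a * t i j)) ≡ a * ∑ᵈ n (λ i → ∑ᵈ n (t i))
      pull a t = trans (∑-cong D (λ i → ∑-*ˡ D a (t i))) (∑-*ˡ D a (λ i → ∑ᵈ n (t i)))

    infixr 5 _⊕_
    _⊕_ : ∀ {a b : Fin n → Fin n → Fin n → Fin n → Vertex n → Bool} {p q} →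
      ∑ᵗ n (λ i j k l v → ⟦ a i j k l v ⟧) ≤ p → ∑ᵗ n (λ i j k l v → ⟦ b i j k l v ⟧) ≤ q →
      ∑ᵗ n (λ i j k l v → ⟦ a i j k l v ∨ b i j k l v ⟧) ≤ p + q
    _⊕_ {a} {b} ha hb = ℤ.≤-trans (∑ᵗ-mono (λ i j k l v → ⟦∨⟧ (a i j k l v) (b i j k l v)))
      (ℤ.≤-trans (ℤ.≤-reflexive (∑ᵗ-+ (λ i j k l v → ⟦ a i j k l v ⟧) (λ i j k l v → ⟦ b i j k l v ⟧))) (ℤ.+-mono-≤ ha hb))

    ij : ∑ᵗ n (λ i j k l v → ⟦ bd v i j ⟧) ≤ K
    ij = ∑-face
    ik : ∑ᵗ n (λ i j k l v → ⟦ bd v i k ⟧) ≤ K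
    ik = subst (_≤ K) (sym (∑ᵗ-ikjl face)) ∑-face
    il : ∑ᵗ n (λ i j k l v → ⟦ bd v i l ⟧) ≤ K
    il = subst (_≤ K) (sym (∑ᵗ-iljk face)) ∑-face
    jk : ∑ᵗ n (λ i j k l v → ⟦ bd v j k ⟧) ≤ K
    jk = subst (_≤ K) (sym (∑ᵗ-jkil face)) ∑-face
    jl : ∑ᵗ n (λ i j k l v → ⟦ bd v j l ⟧) ≤ K
    jl = subst (_≤ K) (sym (∑ᵗ-jlik face)) ∑-face
    kl : ∑ᵗ n (λ i j k l v → ⟦ bd v k l ⟧) ≤ K
    kl = subst (_≤ K) (sym (∑ᵗ-klij face)) ∑-face

    shifted : ∀ {f : Tuples n} (d : Fin n → Fin n → Fin n → Fin n → Fin n) → ∑ᵗ n f ≤ K →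
      ∑ᵗ n (λ i j k l v → f i j k l (flip (d i j k l) v)) ≤ K
    shifted {f} d h = subst (_≤ K) (sym (∑ᵗ-shift f d)) h

  module _ (c : Certificate) where
    open Certificate c

    private
      ∑-tripBad : ∑ᵗ n (λ i j k l v → ⟦ tripBad G free c i j k l v ⟧) ≤ + 11 * K
      ∑-tripBad = ℤ.≤-trans
        (ij ⊕ (ik ⊕ jk ⊕ shifted (λ i j k l → j) ik ⊕ shifted (λ i j k l → i) jk ⊕ shifted (λ i j k l → k) ij)
            ⊕ (il ⊕ jl ⊕ shifted (λ i j k l → j) il ⊕ shifted (λ i j k l → i) jl ⊕ shifted (λ i j k l → l) ij))
        (ℤ.≤-reflexive (solve 1 (λ k → k :+ ((k :+ (k :+ (k :+ (k :+ k)))) :+ (k :+ (k :+ (k :+ (k :+ k))))) := con (+ 11) :* k) refl K))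
        where open +-*-Solver using (solve; _:+_; _:*_; _:=_; con)

      ∑-localBad : ∑ᵗ n (λ i j k l v → ⟦ localBad G free c i j k l v ⟧) ≤ + 6 * K
      ∑-localBad = ℤ.≤-trans (ij ⊕ ik ⊕ il ⊕ jk ⊕ jl ⊕ kl)
        (ℤ.≤-reflexive (solve 1 (λ k → k :+ (k :+ (k :+ (k :+ (k :+ k)))) := con (+ 6) :* k) refl K))
        where open +-*-Solver using (solve; _:+_; _:*_; _:=_; con)

    edgeSum : ℤ
    edgeSum = ∑ᵛ n (λ v → ∑ᵈ n (λ i → ⟦ E G v i ⟧))

    private
      M = ∑ᵈ n (λ i → ∑ᵛ n (λ v → ⟦ E G v i ⟧))

      edgeSum≡M : edgeSum ≡ M
      edgeSum≡M = ∑-swap (allVertices n) D (λ v i → ⟦ E G v i ⟧)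

      first : Tuples n
      first i j k l v = ⟦ E G v i ⟧

      n³M = + n * (+ n * (+ n * M))

      ∑-first : ∑ᵗ n first ≡ n³M
      ∑-first = begin
        ∑ᵗ n first
          ≡⟨ ∑-cong D (λ i → trans (∑ᵈ-const n (∑ᵈ n (λ _ → ∑ᵈ n (λ _ → s i)))) (cong (_*_ (+ n))
               (trans (∑ᵈ-const n (∑ᵈ n (λ _ → s i))) (cong (_*_ (+ n)) (∑ᵈ-const n (s i)))))) ⟩
        ∑ᵈ n (λ i → + n * (+ n * (+ n * s i))) ≡⟨ ∑-*ˡ D (+ n) (λ i → + n * (+ n * s i)) ⟩
        + n * ∑ᵈ n (λ i → + n * (+ n * s i)) ≡⟨ cong (_*_ (+ n)) (∑-*ˡ D (+ n) (λ i → + n * s i)) ⟩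
        + n * (+ n * ∑ᵈ n (λ i → + n * s i)) ≡⟨ cong (λ x → + n * (+ n * x)) (∑-*ˡ D (+ n) s) ⟩
        n³M ∎
        where
        open ≡-Reasoning
        s : Fin n → ℤ
        s i = ∑ᵛ n (λ v → ⟦ E G v i ⟧)

      ∑-second : ∑ᵗ n (λ i j k l → first j i k l) ≡ n³M
      ∑-second = trans (∑ᵗ-swap₁₂ first) ∑-first
      ∑-third : ∑ᵗ n (λ i j k l → first k i j l) ≡ n³M
      ∑-third = trans (∑ᵗ-swap₂₃ (λ i j k l → first j i k l)) ∑-second
      ∑-fourth : ∑ᵗ n (λ i j k l → first l i j k) ≡ n³M
      ∑-fourth = trans (∑ᵗ-swap₃₄ (λ i j k l → first k i j l)) ∑-third

      ∑-degree : ∑ᵗ n (degree G free c) ≡ + 4 * n³M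
      ∑-degree = trans (∑ᵗ-+ first _) (trans (cong (_+_ (∑ᵗ n first)) (trans (∑ᵗ-+ (λ i j k l → first j i k l) _)
        (cong (_+_ (∑ᵗ n (λ i j k l → first j i k l))) (∑ᵗ-+ (λ i j k l → first k i j l) (λ i j k l → first l i j k)))))
        (trans (cong₂ _+_ ∑-first (cong₂ _+_ ∑-second (cong₂ _+_ ∑-third ∑-fourth)))
          (solve 1 (λ m → m :+ (m :+ (m :+ m)) := con (+ 4) :* m) refl n³M)))
        where open +-*-Solver

      U Z : ℤ
      U = ∑ᵗ n (uAt G free c)
      Z = ∑ᵗ n (zAt G free c)

      ∑-tripU : ∑ᵗ n (tripU G free c) ≡ + 4 * U
      ∑-tripU = trans (∑ᵗ-+ f _) (trans (cong (_+_ U) (trans (∑ᵗ-+ (λ i j k l v → f i j k l (flip i v)) _)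
        (cong (_+_ (∑ᵗ n (λ i j k l v → f i j k l (flip i v)))) (∑ᵗ-+ (λ i j k l v → f i j k l (flip j (flip i v))) (λ i j k l v → f i j k l (flip j v))))))
        (trans (cong (_+_ U) (cong₂ _+_ (∑ᵗ-shift f (λ i j k l → i)) (cong₂ _+_
          (trans (∑ᵗ-shift (λ i j k l v → f i j k l (flip j v)) (λ i j k l → i)) (∑ᵗ-shift f (λ i j k l → j)))
          (∑ᵗ-shift f (λ i j k l → j)))))
          (solve 1 (λ m → m :+ (m :+ (m :+ m)) := con (+ 4) :* m) refl U)))
        where
        open +-*-Solver
        f = uAt G free c

      U≤ : + 4 * U ≤ + 4 * C * (+ 11 * K)
      U≤ = begin
        + 4 * U ≡⟨ ∑-tripU ⟨
        ∑ᵗ n (tripU G free c) ≤⟨ ∑ᵗ-mono (tripU≤ G free c) ⟩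
        ∑ᵗ n (λ i j k l v → + 4 * C * ⟦ tripBad G free c i j k l v ⟧)
          ≡⟨ ∑ᵗ-* (+ 4 * C) (λ i j k l v → ⟦ tripBad G free c i j k l v ⟧) ⟩
        + 4 * C * ∑ᵗ n (λ i j k l v → ⟦ tripBad G free c i j k l v ⟧)
          ≤⟨ ℤ.*-monoˡ-≤-nonNeg (+ 4 * C) {{nonNegative (ℤ.*-monoˡ-≤-nonNeg (+ 4) C-nonneg)}} ∑-tripBad ⟩
        + 4 * C * (+ 11 * K) ∎
        where open ℤ.≤-Reasoning

      Z≤ : Z ≤ + 1000 * U
      Z≤ = begin
        Z ≡⟨ trans (∑ᵗ-+ (λ i j k l v → + 1000 * f i j k l v) (λ i j k l v → - Y i j k l v))
               (cong₂ _+_ (∑ᵗ-* (+ 1000) f) (trans (∑ᵗ-cong (λ i j k l v → sym (ℤ.-1*i≡-i (Y i j k l v)))) (∑ᵗ-* (- 1ℤ) Y))) ⟩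
        + 1000 * U + - 1ℤ * ∑ᵗ n Y ≤⟨ ℤ.+-monoʳ-≤ (+ 1000 * U) (ℤ.≤-trans (ℤ.≤-reflexive (ℤ.-1*i≡-i (∑ᵗ n Y))) (ℤ.neg-mono-≤ (∑-y≥0 G free c))) ⟩
        + 1000 * U + 0ℤ ≡⟨ ℤ.+-identityʳ (+ 1000 * U) ⟩
        + 1000 * U ∎
        where
        open ℤ.≤-Reasoning
        f Y : Tuples n
        f = uAt G free c
        Y i j k l v = y (baseAt G free c i j v) (flagAt G free c i j k v) (flagAt G free c i j l v)

      ∑-localZ : ∑ᵗ n (localZ G free c) ≡ + 6 * Z
      ∑-localZ = trans (∑ᵗ-+ f _) (trans (cong (_+_ Z)
        (trans (∑ᵗ-+ (λ i j k l → f i k j l) _) (cong₂ _+_ (∑ᵗ-ikjl f)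
        (trans (∑ᵗ-+ (λ i j k l → f i l j k) _) (cong₂ _+_ (∑ᵗ-iljk f)
        (trans (∑ᵗ-+ (λ i j k l → f j k i l) _) (cong₂ _+_ (∑ᵗ-jkil f)
        (trans (∑ᵗ-+ (λ i j k l → f j l i k) (λ i j k l → f k l i j)) (cong₂ _+_ (∑ᵗ-jlik f) (∑ᵗ-klij f))))))))))
        (solve 1 (λ m → m :+ (m :+ (m :+ (m :+ (m :+ m)))) := con (+ 6) :* m) refl Z))
        where
        open +-*-Solver
        f = zAt G free c

    -- The total price of bad tuples. The summand `6 * 1000 * U` is rewritten as `1500 * (4 * U)` to
    -- match the bound on `4 * U`; a round trip meets 11 squares, a local view 6, and the last
    -- factor 5 is that of `∑-bad`.
    excess : ℤ
    excess = (+ 1500 * (+ 4 * C) * + 11 + penalty G free c * + 6) * + 5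

    private
      summed : κ * (+ 4 * n³M) ≤ + n * (+ n * (+ n * (A * (+ n * N) + excess * N)))
      summed = begin
        κ * (+ 4 * n³M) ≡⟨ cong (_*_ κ) ∑-degree ⟨
        κ * ∑ᵗ n (degree G free c) ≡⟨ ∑ᵗ-* κ (degree G free c) ⟨
        ∑ᵗ n (λ i j k l v → κ * degree G free c i j k l v) ≤⟨ ∑ᵗ-mono (degree≤ G free c) ⟩
        ∑ᵗ n (λ i j k l v → A + localZ G free c i j k l v + P * B i j k l v)
          ≡⟨ trans (∑ᵗ-+ (λ i j k l v → A + localZ G free c i j k l v) (λ i j k l v → P * B i j k l v))
               (cong₂ _+_ (trans (∑ᵗ-+ (λ _ _ _ _ _ → A) (localZ G free c)) (cong₂ _+_ (∑ᵗ-const {n} A) ∑-localZ)) (∑ᵗ-* P B)) ⟩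
        + n * (+ n * (+ n * (+ n * (N * A)))) + + 6 * Z + P * ∑ᵗ n B
          ≤⟨ ℤ.+-mono-≤ (ℤ.+-monoʳ-≤ (+ n * (+ n * (+ n * (+ n * (N * A))))) 6Z≤)
               (ℤ.*-monoˡ-≤-nonNeg P {{nonNegative P-nonneg}} ∑-localBad) ⟩
        + n * (+ n * (+ n * (+ n * (N * A)))) + + 1500 * (+ 4 * C * (+ 11 * K)) + P * (+ 6 * K)
          ≡⟨ cong₂ (λ x y → + n * (+ n * (+ n * (+ n * (N * A)))) + x + y)
               (trans (cong (_*_ (+ 1500)) (sym (ℤ.*-assoc (+ 4 * C) (+ 11) K)))
                 (trans (sym (ℤ.*-assoc (+ 1500) (+ 4 * C * + 11) K)) (cong (_* K) (sym (ℤ.*-assoc (+ 1500) (+ 4 * C) (+ 11))))))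
               (sym (ℤ.*-assoc P (+ 6) K)) ⟩
        + n * (+ n * (+ n * (+ n * (N * A)))) + X * K + P * + 6 * K
          ≡⟨ collect (+ n) N A X (P * + 6) (+ 5) ⟩
        + n * (+ n * (+ n * (A * (+ n * N) + excess * N))) ∎
        where
        open ℤ.≤-Reasoning
        open +-*-Solver using (solve; _:+_; _:*_; _:=_; con)
        P = penalty G free c
        X = + 1500 * (+ 4 * C) * + 11
        collect : ∀ n N A X Y d → n * (n * (n * (n * (N * A)))) + X * (n * (n * (d * (n * N)))) + Y * (n * (n * (d * (n * N))))
          ≡ n * (n * (n * (A * (n * N) + (X + Y) * d * N)))
        collect = solve 6 (λ n N A X Y d →
          n :* (n :* (n :* (n :* (N :* A)))) :+ X :* (n :* (n :* (d :* (n :* N)))) :+ Y :* (n :* (n :* (d :* (n :* N))))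
          := n :* (n :* (n :* (A :* (n :* N) :+ (X :+ Y) :* d :* N)))) refl
        B : Tuples n
        B i j k l v = ⟦ localBad G free c i j k l v ⟧
        P-nonneg : 0ℤ ≤ P
        P-nonneg = ℤ.+-mono-≤ (ℤ.*-monoˡ-≤-nonNeg (+ 6) C-nonneg) (ℤ.*-monoˡ-≤-nonNeg (+ 4) κ-nonneg)
        6Z≤ : + 6 * Z ≤ + 1500 * (+ 4 * C * (+ 11 * K))
        6Z≤ = begin
          + 6 * Z ≤⟨ ℤ.*-monoˡ-≤-nonNeg (+ 6) Z≤ ⟩
          + 6 * (+ 1000 * U) ≡⟨ trans (sym (ℤ.*-assoc (+ 6) (+ 1000) U)) (ℤ.*-assoc (+ 1500) (+ 4) U) ⟩
          + 1500 * (+ 4 * U) ≤⟨ ℤ.*-monoˡ-≤-nonNeg (+ 1500) U≤ ⟩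
          + 1500 * (+ 4 * C * (+ 11 * K)) ∎

    edgeSum≤ : .{{ℕ.NonZero n}} → + 4 * κ * edgeSum ≤ A * (+ n * N) + excess * N
    edgeSum≤ = cancel (cancel (cancel (subst (_≤ + n * (+ n * (+ n * (A * (+ n * N) + excess * N)))) regroup summed)))
      where
      cancel : ∀ {a b} → + n * a ≤ + n * b → a ≤ b
      cancel {a} {b} = ℤ.*-cancelˡ-≤-pos a b (+ n) {{positive (+<+ (ℕ.>-nonZero⁻¹ n))}}
      regroup : κ * (+ 4 * n³M) ≡ + n * (+ n * (+ n * (+ 4 * κ * edgeSum)))
      regroup = trans (solve 3 (λ κ n m → κ :* (con (+ 4) :* (n :* (n :* (n :* m)))) := n :* (n :* (n :* (con (+ 4) :* κ :* m)))) refl κ (+ n) M)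
        (cong (λ x → + n * (+ n * (+ n * (+ 4 * κ * x)))) (sym edgeSum≡M))
        where open +-*-Solver

    labelledC4≤ : .{{ℕ.NonZero n}} → + 4 * κ * + labelledC4 G ≤ A * (+ n * N) + excess * N
    labelledC4≤ = ℤ.≤-trans (ℤ.*-monoˡ-≤-nonNeg (+ 4 * κ) {{nonNegative (ℤ.*-monoˡ-≤-nonNeg (+ 4) κ-nonneg)}}
      (labelledC4≤∑E G free)) edgeSum≤

-- The numerical certificate

-- Rounded from a numerical solution of the semidefinite program that minimises A / 4κ. There is one table for each
-- square up to exchanging i and j; potentials are symmetric in the two flags and shifted by 43414, weights by 8000.

potential₁ : List (List ℕ)
potential₁ =
  (43413 ∷ []) ∷
  (43412 ∷ 43411 ∷ []) ∷
  (41979 ∷ 40769 ∷ 41838 ∷ []) ∷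
  (42167 ∷ 40915 ∷ 40588 ∷ 35358 ∷ []) ∷
  (43412 ∷ 43413 ∷ 41981 ∷ 42166 ∷ 43411 ∷ []) ∷
  (43412 ∷ 37180 ∷ 40769 ∷ 38805 ∷ 37180 ∷ 43416 ∷ []) ∷
  (41977 ∷ 40737 ∷ 41838 ∷ 40582 ∷ 41977 ∷ 36723 ∷ 41838 ∷ []) ∷
  (42159 ∷ 36928 ∷ 40578 ∷ 35352 ∷ 37201 ∷ 28237 ∷ 38820 ∷ 35415 ∷ []) ∷
  (41979 ∷ 41981 ∷ 40547 ∷ 40735 ∷ 40769 ∷ 40769 ∷ 39331 ∷ 34557 ∷ 41838 ∷ []) ∷
  (41977 ∷ 41977 ∷ 39331 ∷ 39484 ∷ 40737 ∷ 36723 ∷ 38124 ∷ 38249 ∷ 41838 ∷ 41838 ∷ []) ∷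
  (40550 ∷ 35237 ∷ 36024 ∷ 39154 ∷ 35237 ∷ 38112 ∷ 39187 ∷ 37923 ∷ 36024 ∷ 39187 ∷ 40265 ∷ []) ∷
  (40737 ∷ 39484 ∷ 39145 ∷ 33927 ∷ 39512 ∷ 38269 ∷ 37945 ∷ 32714 ∷ 40588 ∷ 39340 ∷ 39008 ∷ 33787 ∷ []) ∷
  (42167 ∷ 42166 ∷ 40735 ∷ 40921 ∷ 40915 ∷ 38805 ∷ 39484 ∷ 39648 ∷ 40588 ∷ 40582 ∷ 39154 ∷ 39344 ∷ 35358 ∷ []) ∷
  (42159 ∷ 37201 ∷ 34557 ∷ 39648 ∷ 36928 ∷ 28237 ∷ 38249 ∷ 38422 ∷ 40578 ∷ 38820 ∷ 37923 ∷ 38096 ∷ 35352 ∷ 35415 ∷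
  []) ∷
  (40737 ∷ 39512 ∷ 40588 ∷ 39344 ∷ 39484 ∷ 38269 ∷ 39340 ∷ 38096 ∷ 39145 ∷ 37945 ∷ 39008 ∷ 37733 ∷ 33927 ∷ 32714 ∷
  33787 ∷ []) ∷
  (40923 ∷ 39480 ∷ 30718 ∷ 34100 ∷ 39480 ∷ 38429 ∷ 38097 ∷ 46752 ∷ 30718 ∷ 38097 ∷ 37770 ∷ 32547 ∷ 34100 ∷ 46752 ∷
  32547 ∷ 46332 ∷ []) ∷
  (46275 ∷ 47490 ∷ 44847 ∷ 45207 ∷ 47490 ∷ 48698 ∷ 46044 ∷ 42340 ∷ 44847 ∷ 46044 ∷ 43408 ∷ 43772 ∷ 45207 ∷ 42340 ∷
  43772 ∷ 44151 ∷ 46560 ∷ []) ∷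
  (44821 ∷ 44829 ∷ 36129 ∷ 33408 ∷ 38047 ∷ 40874 ∷ 42828 ∷ 48351 ∷ 40726 ∷ 43405 ∷ 34899 ∷ 31977 ∷ 43763 ∷ 34894 ∷
  45615 ∷ 50233 ∷ 34173 ∷ 44948 ∷ []) ∷
  (46084 ∷ 47336 ∷ 44475 ∷ 44839 ∷ 47301 ∷ 48549 ∷ 45692 ∷ 46054 ∷ 44658 ∷ 45903 ∷ 43043 ∷ 43405 ∷ 45021 ∷ 46264 ∷
  43407 ∷ 43782 ∷ 47807 ∷ 38517 ∷ 43526 ∷ []) ∷
  (44821 ∷ 38047 ∷ 40726 ∷ 43763 ∷ 44829 ∷ 40874 ∷ 43405 ∷ 34894 ∷ 36129 ∷ 42828 ∷ 34899 ∷ 45615 ∷ 33408 ∷ 48351 ∷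
  31977 ∷ 50233 ∷ 34173 ∷ 35996 ∷ 42500 ∷ 44948 ∷ []) ∷
  (43410 ∷ 43393 ∷ 39844 ∷ 31961 ∷ 43393 ∷ 43419 ∷ 44334 ∷ 49882 ∷ 39844 ∷ 44334 ∷ 42775 ∷ 18548 ∷ 31961 ∷ 49882 ∷
  18548 ∷ 56348 ∷ 39632 ∷ 29186 ∷ 37254 ∷ 29186 ∷ 24424 ∷ []) ∷
  (44657 ∷ 41674 ∷ 43032 ∷ 43410 ∷ 44653 ∷ 45898 ∷ 43040 ∷ 43412 ∷ 40345 ∷ 46285 ∷ 42722 ∷ 45298 ∷ 33223 ∷ 52361 ∷
  31612 ∷ 49890 ∷ 44348 ∷ 32905 ∷ 42264 ∷ 46224 ∷ 36935 ∷ 51419 ∷ []) ∷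
  (46084 ∷ 47301 ∷ 44658 ∷ 45021 ∷ 47336 ∷ 48549 ∷ 45903 ∷ 46264 ∷ 44475 ∷ 45692 ∷ 43043 ∷ 43407 ∷ 44839 ∷ 46054 ∷
  43405 ∷ 43782 ∷ 47807 ∷ 42500 ∷ 49050 ∷ 38517 ∷ 37254 ∷ 39760 ∷ 43526 ∷ []) ∷
  (44657 ∷ 44653 ∷ 40345 ∷ 33223 ∷ 41674 ∷ 45898 ∷ 46285 ∷ 52361 ∷ 43032 ∷ 43040 ∷ 42722 ∷ 31612 ∷ 43410 ∷ 43412 ∷
  45298 ∷ 49890 ∷ 44348 ∷ 46224 ∷ 39760 ∷ 32905 ∷ 36935 ∷ 30475 ∷ 42264 ∷ 51419 ∷ []) ∷
  (45901 ∷ 47153 ∷ 44294 ∷ 44655 ∷ 47153 ∷ 48407 ∷ 45540 ∷ 45910 ∷ 44294 ∷ 45540 ∷ 42686 ∷ 43051 ∷ 44655 ∷ 45910 ∷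
  43051 ∷ 43420 ∷ 49060 ∷ 57666 ∷ 54283 ∷ 57666 ∷ 66275 ∷ 62899 ∷ 54283 ∷ 62899 ∷ 59516 ∷ []) ∷ []

potential₂ : List (List ℕ)
potential₂ =
  (40675 ∷ []) ∷
  (38283 ∷ 37016 ∷ []) ∷
  (45610 ∷ 47263 ∷ 48661 ∷ []) ∷
  (39595 ∷ 37787 ∷ 29322 ∷ 14785 ∷ []) ∷
  (40235 ∷ 36278 ∷ 45163 ∷ 39135 ∷ 40675 ∷ []) ∷
  (38730 ∷ 38385 ∷ 43653 ∷ 29977 ∷ 36718 ∷ 38837 ∷ []) ∷
  (46054 ∷ 47713 ∷ 46799 ∷ 27656 ∷ 45603 ∷ 47262 ∷ 46840 ∷ []) ∷
  (41409 ∷ 38253 ∷ 55854 ∷ 39414 ∷ 40961 ∷ 37813 ∷ 55414 ∷ 40878 ∷ []) ∷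
  (34638 ∷ 34212 ∷ 41137 ∷ 35106 ∷ 32587 ∷ 29731 ∷ 37306 ∷ 31296 ∷ 41078 ∷ []) ∷
  (34212 ∷ 34756 ∷ 34857 ∷ 32092 ∷ 28826 ∷ 29387 ∷ 38962 ∷ 36236 ∷ 38623 ∷ 39416 ∷ []) ∷
  (47817 ∷ 49471 ∷ 49435 ∷ 29285 ∷ 42628 ∷ 44286 ∷ 57679 ∷ 44793 ∷ 39276 ∷ 40931 ∷ 64555 ∷ []) ∷
  (40816 ∷ 40014 ∷ 30088 ∷ 15561 ∷ 36608 ∷ 28538 ∷ 31588 ∷ 30251 ∷ 29469 ∷ 38183 ∷ 34628 ∷ 30681 ∷ []) ∷
  (36448 ∷ 33577 ∷ 41167 ∷ 35140 ∷ 32670 ∷ 29800 ∷ 27311 ∷ 38218 ∷ 36971 ∷ 34768 ∷ 35177 ∷ 29155 ∷ 18229 ∷ []) ∷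
  (28803 ∷ 23409 ∷ 42824 ∷ 27134 ∷ 33278 ∷ 28231 ∷ 45164 ∷ 43145 ∷ 39552 ∷ 30474 ∷ 41613 ∷ 25966 ∷ 16001 ∷ 45279 ∷
  []) ∷
  (45118 ∷ 46773 ∷ 46384 ∷ 27050 ∷ 41336 ∷ 42984 ∷ 32530 ∷ 51705 ∷ 35167 ∷ 36833 ∷ 60442 ∷ 29733 ∷ 16420 ∷ 18071 ∷
  41700 ∷ []) ∷
  (41849 ∷ 38694 ∷ 50565 ∷ 36024 ∷ 44910 ∷ 49853 ∷ 53623 ∷ 39087 ∷ 33945 ∷ 38886 ∷ 47766 ∷ 33229 ∷ 22420 ∷ 44963 ∷
  22364 ∷ 68490 ∷ []) ∷
  (43782 ∷ 44612 ∷ 45621 ∷ 39672 ∷ 47611 ∷ 48443 ∷ 50993 ∷ 50045 ∷ 33431 ∷ 40357 ∷ 48025 ∷ 47028 ∷ 38787 ∷ 21623 ∷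
  44542 ∷ 51767 ∷ 47956 ∷ []) ∷
  (50912 ∷ 49892 ∷ 50777 ∷ 31866 ∷ 51541 ∷ 53244 ∷ 56160 ∷ 52356 ∷ 39158 ∷ 45400 ∷ 43153 ∷ 24226 ∷ 39259 ∷ 46257 ∷
  39652 ∷ 59766 ∷ 31533 ∷ 43971 ∷ []) ∷
  (41134 ∷ 36844 ∷ 44314 ∷ 45880 ∷ 46324 ∷ 28601 ∷ 49497 ∷ 51075 ∷ 36867 ∷ 42992 ∷ 46524 ∷ 48076 ∷ 36134 ∷ 42128 ∷
  44420 ∷ 50320 ∷ 39733 ∷ 41786 ∷ 39804 ∷ []) ∷
  (39521 ∷ 40331 ∷ 41324 ∷ 35534 ∷ 37926 ∷ 40339 ∷ 41335 ∷ 40373 ∷ 36118 ∷ 36937 ∷ 37783 ∷ 36808 ∷ 29599 ∷ 36633 ∷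
  27859 ∷ 48165 ∷ 27109 ∷ 23168 ∷ 34160 ∷ 38531 ∷ []) ∷
  (50014 ∷ 50756 ∷ 49651 ∷ 31002 ∷ 52113 ∷ 50754 ∷ 50485 ∷ 47323 ∷ 40597 ∷ 47770 ∷ 66516 ∷ 40879 ∷ 31974 ∷ 39658 ∷
  33351 ∷ 47406 ∷ 54770 ∷ 30457 ∷ 43366 ∷ 44454 ∷ 59206 ∷ []) ∷
  (38237 ∷ 35671 ∷ 41196 ∷ 41165 ∷ 38235 ∷ 35661 ∷ 41202 ∷ 42778 ∷ 40771 ∷ 45027 ∷ 37666 ∷ 29011 ∷ 31282 ∷ 46553 ∷
  27730 ∷ 50568 ∷ 37561 ∷ 35527 ∷ 37225 ∷ 37141 ∷ 36825 ∷ 40204 ∷ []) ∷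
  (43744 ∷ 44572 ∷ 47141 ∷ 46185 ∷ 40687 ∷ 41516 ∷ 35982 ∷ 45588 ∷ 34822 ∷ 35664 ∷ 45799 ∷ 47301 ∷ 37047 ∷ 37890 ∷
  44177 ∷ 49537 ∷ 47275 ∷ 49648 ∷ 37185 ∷ 34041 ∷ 46016 ∷ 37829 ∷ 21828 ∷ []) ∷
  (52960 ∷ 48818 ∷ 56218 ∷ 36492 ∷ 44630 ∷ 47528 ∷ 57311 ∷ 46409 ∷ 43461 ∷ 44596 ∷ 44022 ∷ 25100 ∷ 42444 ∷ 44744 ∷
  42842 ∷ 57539 ∷ 52859 ∷ 52564 ∷ 37925 ∷ 39637 ∷ 37463 ∷ 38307 ∷ 43560 ∷ 38120 ∷ []) ∷
  (42465 ∷ 39890 ∷ 47016 ∷ 47997 ∷ 39403 ∷ 53748 ∷ 50794 ∷ 52364 ∷ 38974 ∷ 46480 ∷ 48627 ∷ 50195 ∷ 38236 ∷ 43298 ∷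
  46524 ∷ 51943 ∷ 43841 ∷ 54790 ∷ 43905 ∷ 47077 ∷ 62473 ∷ 47162 ∷ 62584 ∷ 73561 ∷ 62655 ∷ []) ∷ []

potential₃ : List (List ℕ)
potential₃ =
  (30379 ∷ []) ∷
  (24226 ∷ 26213 ∷ []) ∷
  (34436 ∷ 37477 ∷ 52756 ∷ []) ∷
  (36008 ∷ 32063 ∷ 38670 ∷ 43898 ∷ []) ∷
  (24226 ∷ 18070 ∷ 37447 ∷ 30102 ∷ 26213 ∷ []) ∷
  (18069 ∷ 18371 ∷ 39430 ∷ 25908 ∷ 18371 ∷ 18688 ∷ []) ∷
  (28958 ∷ 32097 ∷ 61338 ∷ 50462 ∷ 31246 ∷ 33286 ∷ 64256 ∷ []) ∷
  (30102 ∷ 25911 ∷ 50466 ∷ 55698 ∷ 33506 ∷ 29314 ∷ 50696 ∷ 55926 ∷ []) ∷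
  (34436 ∷ 37447 ∷ 43116 ∷ 30348 ∷ 37477 ∷ 39430 ∷ 43673 ∷ 31242 ∷ 52756 ∷ []) ∷
  (28958 ∷ 31246 ∷ 43673 ∷ 26153 ∷ 32097 ∷ 33286 ∷ 44906 ∷ 27053 ∷ 61338 ∷ 64256 ∷ []) ∷
  (35623 ∷ 35282 ∷ 52363 ∷ 38921 ∷ 35282 ∷ 34939 ∷ 47652 ∷ 39817 ∷ 52363 ∷ 47652 ∷ 28178 ∷ []) ∷
  (22857 ∷ 18665 ∷ 38903 ∷ 44148 ∷ 22511 ∷ 18323 ∷ 39816 ∷ 45048 ∷ 40225 ∷ 30314 ∷ 14087 ∷ 19318 ∷ []) ∷
  (36008 ∷ 30102 ∷ 30348 ∷ 17585 ∷ 32063 ∷ 25908 ∷ 26153 ∷ 13405 ∷ 38670 ∷ 50462 ∷ 38921 ∷ 26144 ∷ 43898 ∷ []) ∷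
  (30102 ∷ 33506 ∷ 31242 ∷ 13405 ∷ 25911 ∷ 29314 ∷ 27053 ∷ 9218 ∷ 50466 ∷ 50696 ∷ 39817 ∷ 21973 ∷ 55698 ∷ 55926 ∷ []) ∷
  (22857 ∷ 22511 ∷ 40225 ∷ 26144 ∷ 18665 ∷ 18323 ∷ 30314 ∷ 21973 ∷ 38903 ∷ 39816 ∷ 14087 ∷ 0 ∷ 44148 ∷ 45048 ∷
  19318 ∷ []) ∷
  (0 ∷ 0 ∷ 0 ∷ 0 ∷ 0 ∷ 0 ∷ 0 ∷ 0 ∷ 0 ∷ 0 ∷ 0 ∷ 0 ∷ 0 ∷ 0 ∷ 0 ∷ 0 ∷ []) ∷
  (29728 ∷ 29070 ∷ 49735 ∷ 46741 ∷ 29070 ∷ 28402 ∷ 48221 ∷ 47955 ∷ 49735 ∷ 48221 ∷ 37736 ∷ 34718 ∷ 46741 ∷ 47955 ∷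
  34718 ∷ 0 ∷ 34372 ∷ []) ∷
  (39061 ∷ 37318 ∷ 48120 ∷ 47148 ∷ 38400 ∷ 36660 ∷ 47821 ∷ 48367 ∷ 45273 ∷ 44935 ∷ 44097 ∷ 48306 ∷ 42268 ∷ 42607 ∷
  45390 ∷ 0 ∷ 40666 ∷ 50753 ∷ []) ∷
  (28747 ∷ 29016 ∷ 49707 ∷ 47206 ∷ 28087 ∷ 28353 ∷ 49082 ∷ 48421 ∷ 48759 ∷ 45198 ∷ 38599 ∷ 35184 ∷ 45758 ∷ 46040 ∷
  35580 ∷ 0 ∷ 32178 ∷ 44726 ∷ 33500 ∷ []) ∷
  (39061 ∷ 38400 ∷ 45273 ∷ 42268 ∷ 37318 ∷ 36660 ∷ 44935 ∷ 42607 ∷ 48120 ∷ 47821 ∷ 44097 ∷ 45390 ∷ 47148 ∷ 48367 ∷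
  48306 ∷ 0 ∷ 40666 ∷ 49206 ∷ 40962 ∷ 50753 ∷ []) ∷
  (31100 ∷ 29356 ∷ 39580 ∷ 48826 ∷ 29356 ∷ 27614 ∷ 35381 ∷ 49179 ∷ 39580 ∷ 35381 ∷ 20766 ∷ 24829 ∷ 48826 ∷ 49179 ∷
  24829 ∷ 0 ∷ 34573 ∷ 38419 ∷ 36213 ∷ 38419 ∷ 27864 ∷ []) ∷
  (38073 ∷ 39430 ∷ 46138 ∷ 42732 ∷ 36326 ∷ 37686 ∷ 46484 ∷ 43071 ∷ 53368 ∷ 49818 ∷ 49302 ∷ 52965 ∷ 46173 ∷ 46454 ∷
  49168 ∷ 0 ∷ 40961 ∷ 47242 ∷ 33827 ∷ 52222 ∷ 52722 ∷ 53524 ∷ []) ∷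
  (28747 ∷ 28087 ∷ 48759 ∷ 45758 ∷ 29016 ∷ 28353 ∷ 45198 ∷ 46040 ∷ 49707 ∷ 49082 ∷ 38599 ∷ 35580 ∷ 47206 ∷ 48421 ∷
  35184 ∷ 0 ∷ 32178 ∷ 40962 ∷ 29998 ∷ 44726 ∷ 36213 ∷ 42537 ∷ 33500 ∷ []) ∷
  (38073 ∷ 36326 ∷ 53368 ∷ 46173 ∷ 39430 ∷ 37686 ∷ 49818 ∷ 46454 ∷ 46138 ∷ 46484 ∷ 49302 ∷ 49168 ∷ 42732 ∷ 43071 ∷
  52965 ∷ 0 ∷ 40961 ∷ 52222 ∷ 42537 ∷ 47242 ∷ 52722 ∷ 44847 ∷ 33827 ∷ 53524 ∷ []) ∷
  (27766 ∷ 28036 ∷ 49638 ∷ 46222 ∷ 28036 ∷ 28300 ∷ 49914 ∷ 46509 ∷ 49638 ∷ 49914 ∷ 39462 ∷ 36045 ∷ 46222 ∷ 46509 ∷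
  36045 ∷ 0 ∷ 29997 ∷ 42540 ∷ 31305 ∷ 42540 ∷ 37789 ∷ 43854 ∷ 31305 ∷ 43854 ∷ 32626 ∷ []) ∷ []

potential₄ : List (List ℕ)
potential₄ =
  (46151 ∷ []) ∷
  (32953 ∷ 21992 ∷ []) ∷
  (39749 ∷ 33963 ∷ 41232 ∷ []) ∷
  (48357 ∷ 36716 ∷ 40108 ∷ 47812 ∷ []) ∷
  (35823 ∷ 25947 ∷ 34293 ∷ 36168 ∷ 51740 ∷ []) ∷
  (42198 ∷ 40041 ∷ 39817 ∷ 40471 ∷ 39534 ∷ 42896 ∷ []) ∷
  (47301 ∷ 35691 ∷ 43971 ∷ 46467 ∷ 34859 ∷ 46874 ∷ 38466 ∷ []) ∷
  (28999 ∷ 23771 ∷ 32361 ∷ 28156 ∷ 22940 ∷ 31518 ∷ 33375 ∷ 13228 ∷ []) ∷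
  (46867 ∷ 36924 ∷ 39082 ∷ 46059 ∷ 36130 ∷ 46460 ∷ 44867 ∷ 33018 ∷ 43369 ∷ []) ∷
  (48588 ∷ 36977 ∷ 45605 ∷ 41083 ∷ 39550 ∷ 41515 ∷ 46685 ∷ 29591 ∷ 46273 ∷ 46617 ∷ []) ∷
  (31657 ∷ 26964 ∷ 32681 ∷ 25518 ∷ 51138 ∷ 28899 ∷ 41592 ∷ 33130 ∷ 42857 ∷ 41525 ∷ 33051 ∷ []) ∷
  (49017 ∷ 40340 ∷ 44854 ∷ 48187 ∷ 42924 ∷ 58142 ∷ 53090 ∷ 32955 ∷ 49672 ∷ 50022 ∷ 44897 ∷ 51534 ∷ []) ∷
  (53043 ∷ 41214 ∷ 49674 ∷ 51385 ∷ 39562 ∷ 48035 ∷ 57103 ∷ 38795 ∷ 53729 ∷ 57234 ∷ 40301 ∷ 55980 ∷ 36233 ∷ []) ∷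
  (48359 ∷ 36852 ∷ 45129 ∷ 45709 ∷ 41393 ∷ 43178 ∷ 45412 ∷ 36095 ∷ 41606 ∷ 48237 ∷ 42455 ∷ 56821 ∷ 36361 ∷ 38494 ∷
  []) ∷
  (59054 ∷ 45864 ∷ 55690 ∷ 54113 ∷ 49020 ∷ 52875 ∷ 58064 ∷ 37289 ∷ 54700 ∷ 55663 ∷ 38735 ∷ 56024 ∷ 55571 ∷ 55281 ∷
  70104 ∷ []) ∷ []

potential₅ : List (List ℕ)
potential₅ =
  (40081 ∷ []) ∷
  (30637 ∷ 37582 ∷ []) ∷
  (34381 ∷ 26611 ∷ 39623 ∷ []) ∷
  (28285 ∷ 36792 ∷ 29754 ∷ 28057 ∷ []) ∷
  (36793 ∷ 45411 ∷ 32745 ∷ 33389 ∷ 45098 ∷ []) ∷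
  (23850 ∷ 39649 ∷ 27228 ∷ 29525 ∷ 38154 ∷ 28105 ∷ []) ∷
  (40407 ∷ 30964 ∷ 34690 ∷ 39192 ∷ 31621 ∷ 36220 ∷ 38083 ∷ []) ∷
  (30958 ∷ 39578 ∷ 26927 ∷ 29743 ∷ 40245 ∷ 28465 ∷ 28642 ∷ 37261 ∷ []) ∷
  (41884 ∷ 34309 ∷ 39226 ∷ 40667 ∷ 34966 ∷ 40552 ∷ 39750 ∷ 31986 ∷ 41478 ∷ []) ∷
  (41387 ∷ 31943 ∷ 35666 ∷ 41104 ∷ 31677 ∷ 33899 ∷ 40266 ∷ 30827 ∷ 41936 ∷ 38958 ∷ []) ∷
  (31940 ∷ 40561 ∷ 27911 ∷ 31655 ∷ 40295 ∷ 27636 ∷ 30829 ∷ 39447 ∷ 34174 ∷ 29515 ∷ 38133 ∷ []) ∷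
  (42849 ∷ 35296 ∷ 40929 ∷ 42580 ∷ 33941 ∷ 44501 ∷ 41655 ∷ 34176 ∷ 40008 ∷ 40625 ∷ 32860 ∷ 38700 ∷ []) ∷
  (43026 ∷ 44841 ∷ 42735 ∷ 42132 ∷ 45183 ∷ 41835 ∷ 41969 ∷ 43783 ∷ 42156 ∷ 41107 ∷ 42922 ∷ 41293 ∷ 40514 ∷ []) ∷
  (41915 ∷ 47101 ∷ 41636 ∷ 41577 ∷ 48845 ∷ 41347 ∷ 39975 ∷ 45333 ∷ 39738 ∷ 41941 ∷ 43758 ∷ 42140 ∷ 38580 ∷ 40670 ∷
  []) ∷
  (55793 ∷ 57607 ∷ 55513 ∷ 59975 ∷ 61799 ∷ 60174 ∷ 44988 ∷ 46803 ∷ 45177 ∷ 44523 ∷ 46339 ∷ 44712 ∷ 54603 ∷ 45797 ∷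
  49374 ∷ []) ∷ []

potential₆ : List (List ℕ)
potential₆ =
  (43406 ∷ []) ∷
  (30272 ∷ 27362 ∷ []) ∷
  (34972 ∷ 25048 ∷ 36681 ∷ []) ∷
  (40005 ∷ 26939 ∷ 38384 ∷ 35772 ∷ []) ∷
  (33800 ∷ 23948 ∷ 28477 ∷ 30363 ∷ 35030 ∷ []) ∷
  (39656 ∷ 30320 ∷ 39365 ∷ 41785 ∷ 38494 ∷ 53554 ∷ []) ∷
  (53449 ∷ 46480 ∷ 47886 ∷ 53087 ∷ 46121 ∷ 49242 ∷ 60061 ∷ []) ∷
  (39453 ∷ 40278 ∷ 35089 ∷ 40032 ∷ 39932 ∷ 42003 ∷ 50247 ∷ 44048 ∷ []) ∷
  (47590 ∷ 41004 ∷ 40099 ∷ 52224 ∷ 46625 ∷ 53031 ∷ 54068 ∷ 48356 ∷ 42239 ∷ []) ∷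
  (47466 ∷ 34438 ∷ 41910 ∷ 41521 ∷ 34555 ∷ 37014 ∷ 42905 ∷ 31622 ∷ 37283 ∷ 49412 ∷ []) ∷
  (34445 ∷ 28240 ∷ 29124 ∷ 28477 ∷ 28369 ∷ 31869 ∷ 37833 ∷ 31637 ∷ 37448 ∷ 39570 ∷ 33388 ∷ []) ∷
  (53062 ∷ 34948 ∷ 47493 ∷ 47106 ∷ 35058 ∷ 54418 ∷ 56136 ∷ 38351 ∷ 54419 ∷ 57878 ∷ 40096 ∷ 56170 ∷ []) ∷
  (39754 ∷ 33347 ∷ 39839 ∷ 39831 ∷ 33733 ∷ 40187 ∷ 56448 ∷ 43394 ∷ 47907 ∷ 46857 ∷ 38529 ∷ 56899 ∷ 42761 ∷ []) ∷
  (52643 ∷ 41149 ∷ 52141 ∷ 50382 ∷ 43411 ∷ 49876 ∷ 56184 ∷ 47915 ∷ 48064 ∷ 48002 ∷ 39722 ∷ 60970 ∷ 52061 ∷ 51795 ∷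
  []) ∷
  (52378 ∷ 39332 ∷ 51878 ∷ 52269 ∷ 45303 ∷ 52639 ∷ 61333 ∷ 48292 ∷ 57935 ∷ 56456 ∷ 43413 ∷ 61777 ∷ 55179 ∷ 60257 ∷
  53437 ∷ []) ∷ []

potential₇ : List (List ℕ)
potential₇ =
  (63110 ∷ []) ∷
  (41516 ∷ 40294 ∷ []) ∷
  (61412 ∷ 41322 ∷ 59709 ∷ []) ∷
  (41516 ∷ 44479 ∷ 40033 ∷ 40294 ∷ []) ∷
  (51975 ∷ 37097 ∷ 51781 ∷ 37097 ∷ 64444 ∷ []) ∷
  (47230 ∷ 44290 ∷ 41975 ∷ 38820 ∷ 37392 ∷ 40749 ∷ []) ∷
  (61412 ∷ 40033 ∷ 59710 ∷ 41322 ∷ 51781 ∷ 47021 ∷ 59709 ∷ []) ∷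
  (47230 ∷ 38820 ∷ 47021 ∷ 44290 ∷ 37392 ∷ 44525 ∷ 41975 ∷ 40749 ∷ []) ∷
  (59779 ∷ 39849 ∷ 58034 ∷ 39849 ∷ 51599 ∷ 42506 ∷ 58034 ∷ 42506 ∷ 56321 ∷ []) ∷
  (81995 ∷ 49149 ∷ 78644 ∷ 49149 ∷ 48346 ∷ 53179 ∷ 78644 ∷ 53179 ∷ 75306 ∷ 64758 ∷ []) ∷ []

weights₁ : List (List ℕ)
weights₁ =
  (10836 ∷ 11043 ∷ 10824 ∷ 9524 ∷ 11043 ∷ 12692 ∷ 11383 ∷ 7911 ∷ 10824 ∷ 11383 ∷ 9741 ∷ 7844 ∷ 9524 ∷ 7911 ∷ 7844 ∷
  8231 ∷ 5456 ∷ 5863 ∷ 5907 ∷ 5863 ∷ 4301 ∷ 3763 ∷ 5907 ∷ 3763 ∷ 3541 ∷ []) ∷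
  (8164 ∷ 8879 ∷ 6792 ∷ 10116 ∷ 8879 ∷ 8877 ∷ 7597 ∷ 8564 ∷ 6792 ∷ 7597 ∷ 7195 ∷ 10219 ∷ 10116 ∷ 8564 ∷ 10219 ∷
  7176 ∷ 7987 ∷ 9719 ∷ 4539 ∷ 9719 ∷ 10949 ∷ 7014 ∷ 4539 ∷ 7014 ∷ 8133 ∷ []) ∷
  (8548 ∷ 10695 ∷ 8899 ∷ 5580 ∷ 10695 ∷ 7158 ∷ 10060 ∷ 9341 ∷ 8899 ∷ 10060 ∷ 8267 ∷ 6882 ∷ 5580 ∷ 9341 ∷ 6882 ∷
  6048 ∷ 7808 ∷ 8381 ∷ 7609 ∷ 8381 ∷ 9046 ∷ 7725 ∷ 7609 ∷ 7725 ∷ 10127 ∷ []) ∷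
  (8324 ∷ 8347 ∷ 7703 ∷ 8974 ∷ 8347 ∷ 9737 ∷ 6800 ∷ 8372 ∷ 7703 ∷ 6800 ∷ 7076 ∷ 6342 ∷ 8974 ∷ 8372 ∷ 6342 ∷ 6352 ∷
  8963 ∷ 7888 ∷ 9353 ∷ 7888 ∷ 8320 ∷ 7496 ∷ 9353 ∷ 7496 ∷ 8192 ∷ []) ∷
  (7185 ∷ 9012 ∷ 8582 ∷ 8453 ∷ 9012 ∷ 8266 ∷ 7482 ∷ 9007 ∷ 8582 ∷ 7482 ∷ 8848 ∷ 7828 ∷ 8453 ∷ 9007 ∷ 7828 ∷ 8337 ∷
  8339 ∷ 8076 ∷ 7807 ∷ 8076 ∷ 7994 ∷ 9404 ∷ 7807 ∷ 9404 ∷ 7449 ∷ []) ∷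
  (7991 ∷ 7684 ∷ 7840 ∷ 7835 ∷ 7684 ∷ 8467 ∷ 8271 ∷ 7872 ∷ 7840 ∷ 8271 ∷ 8075 ∷ 8294 ∷ 7835 ∷ 7872 ∷ 8294 ∷ 7516 ∷
  7973 ∷ 7240 ∷ 7800 ∷ 7240 ∷ 8141 ∷ 8609 ∷ 7800 ∷ 8609 ∷ 8092 ∷ []) ∷
  (8000 ∷ 6450 ∷ 11821 ∷ 10321 ∷ 9550 ∷ 8000 ∷ 10253 ∷ 10538 ∷ 4179 ∷ 5747 ∷ 8000 ∷ 7600 ∷ 5679 ∷ 5462 ∷ 8400 ∷
  8000 ∷ 8000 ∷ 10147 ∷ 8439 ∷ 5853 ∷ 8000 ∷ 3908 ∷ 7561 ∷ 12092 ∷ 8000 ∷ []) ∷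
  (8000 ∷ 8226 ∷ 9406 ∷ 5473 ∷ 7774 ∷ 8000 ∷ 8802 ∷ 7807 ∷ 6594 ∷ 7198 ∷ 8000 ∷ 4041 ∷ 10527 ∷ 8193 ∷ 11959 ∷ 8000 ∷
  8000 ∷ 9707 ∷ 11061 ∷ 6293 ∷ 8000 ∷ 9727 ∷ 4939 ∷ 6273 ∷ 8000 ∷ []) ∷
  (8000 ∷ 9930 ∷ 8945 ∷ 5852 ∷ 6070 ∷ 8000 ∷ 7452 ∷ 9421 ∷ 7055 ∷ 8548 ∷ 8000 ∷ 7949 ∷ 10148 ∷ 6579 ∷ 8051 ∷ 8000 ∷
  8000 ∷ 7841 ∷ 6327 ∷ 8159 ∷ 8000 ∷ 7254 ∷ 9673 ∷ 8746 ∷ 8000 ∷ []) ∷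
  (8000 ∷ 7437 ∷ 7302 ∷ 8117 ∷ 8563 ∷ 8000 ∷ 7052 ∷ 8901 ∷ 8698 ∷ 8948 ∷ 8000 ∷ 7487 ∷ 7883 ∷ 7099 ∷ 8513 ∷ 8000 ∷
  8000 ∷ 8449 ∷ 7883 ∷ 7551 ∷ 8000 ∷ 7938 ∷ 8117 ∷ 8062 ∷ 8000 ∷ []) ∷ []

weights₂ : List (List ℕ)
weights₂ =
  (8336 ∷ 8833 ∷ 10615 ∷ 10079 ∷ 10261 ∷ 9679 ∷ 11979 ∷ 11069 ∷ 5110 ∷ 6030 ∷ 9446 ∷ 11105 ∷ 4210 ∷ 8431 ∷ 6844 ∷
  5320 ∷ 6800 ∷ 8018 ∷ 9005 ∷ 6702 ∷ 8832 ∷ 4303 ∷ 7433 ∷ 8262 ∷ 8881 ∷ []) ∷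
  (6254 ∷ 7287 ∷ 9129 ∷ 7485 ∷ 9432 ∷ 9210 ∷ 10262 ∷ 8148 ∷ 9113 ∷ 8271 ∷ 10211 ∷ 4104 ∷ 7146 ∷ 9907 ∷ 8990 ∷ 10310 ∷
  5695 ∷ 11707 ∷ 9335 ∷ 5966 ∷ 7980 ∷ 9230 ∷ 5492 ∷ 8579 ∷ 4234 ∷ []) ∷
  (9142 ∷ 10333 ∷ 7356 ∷ 8354 ∷ 8412 ∷ 9608 ∷ 8256 ∷ 8903 ∷ 6669 ∷ 8958 ∷ 8786 ∷ 9270 ∷ 11321 ∷ 5585 ∷ 11884 ∷ 8617 ∷
  8682 ∷ 7516 ∷ 6510 ∷ 7458 ∷ 9536 ∷ 6438 ∷ 5327 ∷ 4783 ∷ 5534 ∷ []) ∷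
  (7597 ∷ 9473 ∷ 8676 ∷ 8244 ∷ 7522 ∷ 10330 ∷ 8412 ∷ 9780 ∷ 10661 ∷ 9468 ∷ 9505 ∷ 9126 ∷ 9745 ∷ 8503 ∷ 4336 ∷ 6883 ∷
  7733 ∷ 8298 ∷ 6041 ∷ 10130 ∷ 8625 ∷ 9017 ∷ 8528 ∷ 8402 ∷ 6433 ∷ []) ∷
  (8235 ∷ 6690 ∷ 8607 ∷ 8601 ∷ 8681 ∷ 6953 ∷ 7122 ∷ 10580 ∷ 8468 ∷ 5683 ∷ 5220 ∷ 7901 ∷ 8662 ∷ 7097 ∷ 5572 ∷ 11087 ∷
  8389 ∷ 8106 ∷ 8534 ∷ 8310 ∷ 8510 ∷ 6720 ∷ 7520 ∷ 6935 ∷ 6448 ∷ []) ∷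
  (7511 ∷ 8308 ∷ 7111 ∷ 7852 ∷ 8670 ∷ 9513 ∷ 7597 ∷ 8127 ∷ 5833 ∷ 7572 ∷ 7091 ∷ 7473 ∷ 8920 ∷ 7877 ∷ 7200 ∷ 6570 ∷
  9664 ∷ 8709 ∷ 10516 ∷ 8299 ∷ 9384 ∷ 9834 ∷ 7872 ∷ 8440 ∷ 7562 ∷ []) ∷
  (7207 ∷ 7182 ∷ 8229 ∷ 7661 ∷ 7503 ∷ 7402 ∷ 8155 ∷ 8105 ∷ 7781 ∷ 7617 ∷ 8914 ∷ 8923 ∷ 8101 ∷ 7574 ∷ 8144 ∷ 8222 ∷
  7146 ∷ 7679 ∷ 8566 ∷ 8798 ∷ 8644 ∷ 8907 ∷ 7609 ∷ 7419 ∷ 8219 ∷ []) ∷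
  (7979 ∷ 7972 ∷ 7945 ∷ 7907 ∷ 8024 ∷ 8026 ∷ 8022 ∷ 7984 ∷ 8075 ∷ 8017 ∷ 7978 ∷ 8188 ∷ 7912 ∷ 7966 ∷ 7974 ∷ 8038 ∷
  8088 ∷ 7987 ∷ 7983 ∷ 7781 ∷ 8006 ∷ 8107 ∷ 8040 ∷ 7979 ∷ 7927 ∷ []) ∷ []

weights₃ : List (List ℕ)
weights₃ =
  (11748 ∷ 12085 ∷ 9992 ∷ 6822 ∷ 12085 ∷ 9688 ∷ 7859 ∷ 7896 ∷ 9992 ∷ 7859 ∷ 9782 ∷ 3819 ∷ 6822 ∷ 7896 ∷ 3819 ∷ 8000 ∷
  6037 ∷ 4721 ∷ 7999 ∷ 4721 ∷ 1570 ∷ 5392 ∷ 7999 ∷ 5392 ∷ 11305 ∷ []) ∷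
  (7364 ∷ 7850 ∷ 9477 ∷ 7902 ∷ 7850 ∷ 9994 ∷ 8684 ∷ 8601 ∷ 9477 ∷ 8684 ∷ 11839 ∷ 8370 ∷ 7902 ∷ 8601 ∷ 8370 ∷ 8000 ∷
  5057 ∷ 6859 ∷ 9238 ∷ 6859 ∷ 9100 ∷ 9383 ∷ 9238 ∷ 9383 ∷ 5760 ∷ []) ∷
  (8279 ∷ 8453 ∷ 8378 ∷ 8432 ∷ 8453 ∷ 10631 ∷ 8619 ∷ 8566 ∷ 8378 ∷ 8619 ∷ 6129 ∷ 6682 ∷ 8432 ∷ 8566 ∷ 6682 ∷ 8000 ∷
  9416 ∷ 8850 ∷ 10182 ∷ 8850 ∷ 7729 ∷ 7472 ∷ 10182 ∷ 7472 ∷ 5833 ∷ []) ∷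
  (8000 ∷ 5786 ∷ 9280 ∷ 11459 ∷ 10214 ∷ 8000 ∷ 9938 ∷ 14180 ∷ 6720 ∷ 6062 ∷ 8000 ∷ 10620 ∷ 4541 ∷ 1820 ∷ 5380 ∷
  8000 ∷ 8000 ∷ 8873 ∷ 9599 ∷ 7127 ∷ 8000 ∷ 5265 ∷ 6401 ∷ 10735 ∷ 8000 ∷ []) ∷
  (8000 ∷ 7591 ∷ 6919 ∷ 7973 ∷ 8409 ∷ 8000 ∷ 8566 ∷ 8263 ∷ 9081 ∷ 7434 ∷ 8000 ∷ 10378 ∷ 8027 ∷ 7737 ∷ 5622 ∷ 8000 ∷
  8000 ∷ 6027 ∷ 6318 ∷ 9973 ∷ 8000 ∷ 9450 ∷ 9682 ∷ 6550 ∷ 8000 ∷ []) ∷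
  (8000 ∷ 8820 ∷ 7060 ∷ 5980 ∷ 7180 ∷ 8000 ∷ 8304 ∷ 9236 ∷ 8940 ∷ 7696 ∷ 8000 ∷ 8346 ∷ 10020 ∷ 6764 ∷ 7654 ∷ 8000 ∷
  8000 ∷ 9201 ∷ 7734 ∷ 6799 ∷ 8000 ∷ 7909 ∷ 8266 ∷ 8091 ∷ 8000 ∷ []) ∷ []

weights₄ : List (List ℕ)
weights₄ =
  (12219 ∷ 9212 ∷ 11264 ∷ 14258 ∷ 9153 ∷ 12992 ∷ 8008 ∷ 5042 ∷ 9178 ∷ 8349 ∷ 4599 ∷ 8267 ∷ 8297 ∷ 4063 ∷ 7224 ∷ []) ∷
  (8788 ∷ 6869 ∷ 8644 ∷ 8371 ∷ 8192 ∷ 7197 ∷ 10155 ∷ 7299 ∷ 9963 ∷ 12010 ∷ 11487 ∷ 13727 ∷ 8378 ∷ 8380 ∷ 3718 ∷ []) ∷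
  (8362 ∷ 8741 ∷ 9333 ∷ 5061 ∷ 7820 ∷ 9112 ∷ 6567 ∷ 7309 ∷ 6096 ∷ 10305 ∷ 9043 ∷ 7271 ∷ 7503 ∷ 5592 ∷ 7892 ∷ []) ∷
  (8342 ∷ 6867 ∷ 7865 ∷ 7524 ∷ 6195 ∷ 7501 ∷ 7997 ∷ 6628 ∷ 8275 ∷ 8755 ∷ 6787 ∷ 8811 ∷ 8725 ∷ 8024 ∷ 9532 ∷ []) ∷ []

weights₅ : List (List ℕ)
weights₅ =
  (10665 ∷ 10009 ∷ 10240 ∷ 10978 ∷ 9885 ∷ 11384 ∷ 7761 ∷ 5127 ∷ 7698 ∷ 6814 ∷ 2695 ∷ 5229 ∷ 8200 ∷ 4833 ∷ 10086 ∷ []) ∷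
  (5782 ∷ 10801 ∷ 7232 ∷ 6024 ∷ 11189 ∷ 8589 ∷ 7278 ∷ 12118 ∷ 7189 ∷ 5390 ∷ 8624 ∷ 4145 ∷ 5687 ∷ 7601 ∷ 8015 ∷ []) ∷
  (7391 ∷ 9227 ∷ 8060 ∷ 8500 ∷ 7270 ∷ 8607 ∷ 8645 ∷ 5932 ∷ 8074 ∷ 7286 ∷ 10997 ∷ 7710 ∷ 7359 ∷ 5644 ∷ 7046 ∷ []) ∷
  (8477 ∷ 8027 ∷ 8459 ∷ 8389 ∷ 8264 ∷ 7721 ∷ 8568 ∷ 8667 ∷ 8516 ∷ 8211 ∷ 7970 ∷ 8415 ∷ 7342 ∷ 7594 ∷ 7629 ∷ []) ∷ []

weights₆ : List (List ℕ)
weights₆ =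
  (7465 ∷ 9581 ∷ 8725 ∷ 8463 ∷ 10215 ∷ 11801 ∷ 9739 ∷ 11704 ∷ 11097 ∷ 3408 ∷ 6623 ∷ 292 ∷ 7862 ∷ 8496 ∷ 8921 ∷ []) ∷
  (6232 ∷ 7025 ∷ 5500 ∷ 4484 ∷ 6906 ∷ 5682 ∷ 5457 ∷ 11883 ∷ 5624 ∷ 7673 ∷ 7675 ∷ 7007 ∷ 8867 ∷ 9959 ∷ 10399 ∷ []) ∷
  (7723 ∷ 6540 ∷ 6807 ∷ 8570 ∷ 6384 ∷ 9557 ∷ 9047 ∷ 8739 ∷ 9189 ∷ 7307 ∷ 10663 ∷ 9007 ∷ 8178 ∷ 10811 ∷ 6975 ∷ []) ∷
  (8228 ∷ 7337 ∷ 8400 ∷ 7733 ∷ 8252 ∷ 9544 ∷ 6816 ∷ 8017 ∷ 8916 ∷ 9210 ∷ 6347 ∷ 8378 ∷ 10176 ∷ 8772 ∷ 7836 ∷ []) ∷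
  (8101 ∷ 8079 ∷ 7878 ∷ 7793 ∷ 8143 ∷ 8027 ∷ 8246 ∷ 7944 ∷ 7878 ∷ 8061 ∷ 7982 ∷ 7978 ∷ 8080 ∷ 8081 ∷ 7899 ∷ []) ∷ []

weights₇ : List (List ℕ)
weights₇ =
  (13092 ∷ 7597 ∷ 11753 ∷ 7597 ∷ 1948 ∷ 7287 ∷ 11753 ∷ 7287 ∷ 11844 ∷ 10297 ∷ []) ∷
  (6879 ∷ 7592 ∷ 10497 ∷ 7592 ∷ 8391 ∷ 7282 ∷ 10497 ∷ 7282 ∷ 7212 ∷ 8459 ∷ []) ∷
  (8000 ∷ 13595 ∷ 8851 ∷ 2405 ∷ 8000 ∷ 2236 ∷ 7149 ∷ 13764 ∷ 8000 ∷ 8000 ∷ []) ∷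
  (8000 ∷ 7796 ∷ 9475 ∷ 8204 ∷ 8000 ∷ 8020 ∷ 6525 ∷ 7980 ∷ 8000 ∷ 8000 ∷ []) ∷ []

-- Encodes the two far sides of a square that has one side at `v`: both of them would make three
-- edges, so three cases remain. This leaves 25, 15 or 10 flags, according to whether 0, 1 or 2
-- sides of the base are at `v`.
code : Bool → Bool → ℕ
code false false = 0
code true false = 1
code false true = 2
code true true = 99

bit : ℕ → Bool → ℕ
bit m true = m
bit m false = 0

-- Positions in the tables; the code 99 of an impossible flag is beyond the end of every table.
place₀₀ place₀₁ place₁₁ : Flag → ℕ
place₀₀ (flag false ik ki jk kj) = bit 8 ik ℕ.+ (bit 4 ki ℕ.+ (bit 2 jk ℕ.+ bit 1 kj))
place₀₀ (flag true ik ki jk kj) = 16 ℕ.+ (3 ℕ.* code ik ki ℕ.+ code jk kj)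
place₀₁ (flag false ik ki jk kj) = 3 ℕ.* (bit 2 ik ℕ.+ bit 1 ki) ℕ.+ code jk kj
place₀₁ (flag true ik ki jk kj) = 12 ℕ.+ (code ik ki ℕ.+ (bit 99 jk ℕ.+ bit 99 kj))
place₁₁ (flag false ik ki jk kj) = 3 ℕ.* code ik ki ℕ.+ code jk kj
place₁₁ (flag true ik ki jk kj) = 9 ℕ.+ (bit 99 ik ℕ.+ (bit 99 ki ℕ.+ (bit 99 jk ℕ.+ bit 99 kj)))

swap : Flag → Flag
swap (flag k ik ki jk kj) = flag k jk kj ik ki

record Table : Set where
  constructor table
  field
    potential weights : List (List ℕ)
    place : Flag → ℕ

tableOf : Base → Table
tableOf (base false false false false) = table potential₁ weights₁ place₀₀
tableOf (base false false false true) = table potential₂ weights₂ place₀₀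
tableOf (base false false true false) = table potential₂ weights₂ (place₀₀ ∘ swap)
tableOf (base false false true true) = table potential₃ weights₃ place₀₀
tableOf (base false true false false) = table potential₄ weights₄ place₀₁
tableOf (base true false false false) = table potential₄ weights₄ (place₀₁ ∘ swap)
tableOf (base false true false true) = table potential₅ weights₅ place₀₁
tableOf (base true false true false) = table potential₅ weights₅ (place₀₁ ∘ swap)
tableOf (base false true true false) = table potential₆ weights₆ place₀₁
tableOf (base true false false true) = table potential₆ weights₆ (place₀₁ ∘ swap)
tableOf (base true true false false) = table potential₇ weights₇ place₁₁
-- Only squares with three or more edges are left.
tableOf _ = table [] [] place₀₀

at : ∀ {A : Set} → A → List A → ℕ → A
at d [] _ = d
at d (x ∷ xs) zero = x
at d (x ∷ xs) (suc m) = at d xs m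

triangular : List (List ℕ) → ℕ → ℕ → ℕ
triangular t p q = if p <ᵇ q then at 0 (at [] t q) p else at 0 (at [] t p) q

potential : Base → Flag → Flag → ℤ
potential b f g = triangular t (p f) (p g) ⊖ 43414
  where open Table (tableOf b) renaming (potential to t; place to p)

-- The default equals the shift, so a flag outside the table has weight zero.
weight : Base → List ℕ → Flag → ℤ
weight b r f = at 8000 r (Table.place (tableOf b) f) ⊖ 8000

-- Finite checks by evaluation.

data Formula : Set where
  every : (Bool → Formula) → Formula
  _⇒_ : Bool → Formula → Formula
  _≼_ : ℤ → ℤ → Formula
  _∧′_ : Formula → Formula → Formula

infixr 3 _⇒_
infix 4 _≼_

-- A false premise settles an implication without unfolding its conclusion, so guards placed between
-- quantifiers prune the enumeration.
decide : Formula → Bool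
decide (every p) = decide (p true) ∧ decide (p false)
decide (false ⇒ f) = true
decide (true ⇒ f) = decide f
decide (a ≼ b) = a ≤ᵇ b
decide (f ∧′ g) = decide f ∧ decide g

Meaning : Formula → Set
Meaning (every p) = ∀ b → Meaning (p b)
Meaning (b ⇒ f) = b ≡ true → Meaning f
Meaning (a ≼ b) = a ≤ b
Meaning (f ∧′ g) = Meaning f × Meaning g

sound : ∀ f → decide f ≡ true → Meaning f
sound (every p) h true = sound (p true) (∧-conicalˡ (decide (p true)) _ h)
sound (every p) h false = sound (p false) (∧-conicalʳ (decide (p true)) _ h)
sound (true ⇒ f) h refl = sound f h
sound (a ≼ b) h = ℤ.≤ᵇ⇒≤ (Equivalence.from T-≡ h)
sound (f ∧′ g) h = sound f (∧-conicalˡ (decide f) _ h) , sound g (∧-conicalʳ (decide f) _ h)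

every₂ : (Bool → Bool → Formula) → Formula
every₂ p = every λ a → every (p a)

every₄ : (Bool → Bool → Bool → Bool → Formula) → Formula
every₄ p = every₂ λ a b → every₂ (p a b)

-- A / 4κ = 0.365719…
proposal : Proposal
proposal = record
  { u = potential
  ; Index = List ℕ
  ; indices = λ b → Table.weights (tableOf b)
  ; w = weight
  ; κ = + 37500000
  ; A = + 54857869
  -- A generous bound on all table values; it affects only how large `n` has to be.
  ; C = + 1000000000
  }

open Proposal proposal

entries roundTrips locals : Formula
entries = every₄ λ i j ij ji → every λ k → every₄ λ ik ki jk kj → every λ k′ → every₄ λ ik′ ki′ jk′ kj′ →
  (u (base i j ij ji) (flag k ik ki jk kj) (flag k′ ik′ ki′ jk′ kj′) ≼ C)
  ∧′ (- C ≼ z (base i j ij ji) (flag k ik ki jk kj) (flag k′ ik′ ki′ jk′ kj′))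
roundTrips = every₄ λ m₀ m₁ m₂ m₃ → not (three m₀ m₃ m₁ m₂) ⇒
  every₄ λ s₀ s₁ s₂ s₃ → every₄ λ t₀ t₁ t₂ t₃ → sparse m₀ m₁ m₂ m₃ s₀ s₁ s₂ s₃ t₀ t₁ t₂ t₃ ⇒
  every₄ λ s₀′ s₁′ s₂′ s₃′ → every₄ λ t₀′ t₁′ t₂′ t₃′ → sparse m₀ m₁ m₂ m₃ s₀′ s₁′ s₂′ s₃′ t₀′ t₁′ t₂′ t₃′ ⇒
  roundTrip m₀ m₁ m₂ m₃ s₀ s₁ s₂ s₃ t₀ t₁ t₂ t₃ s₀′ s₁′ s₂′ s₃′ t₀′ t₁′ t₂′ t₃′ ≼ 0ℤ
locals = every₄ λ i j k l →
  -- These guards anticipate conjuncts of `sparse₄`, each as soon as the sides of its square are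
  -- fixed.
  every₂ λ ij ji → not (three i j ij ji) ⇒ every₂ λ ik ki → not (three i k ik ki) ⇒
  every₂ λ il li → not (three i l il li) ⇒ every₂ λ jk kj → not (three j k jk kj) ⇒
  every₂ λ jl lj → not (three j l jl lj) ⇒ every₂ λ kl lk → sparse₄ i j k l ij ji ik ki il li jk kj jl lj kl lk ⇒
  κ * (⟦ i ⟧ + (⟦ j ⟧ + (⟦ k ⟧ + ⟦ l ⟧))) ≼ A + local i j k l ij ji ik ki il li jk kj jl lj kl lk

-- Opaque, so that later uses do not run the enumerations again.
abstract
  entries-hold : decide entries ≡ true
  entries-hold = refl

  roundTrips-hold : decide roundTrips ≡ true
  roundTrips-hold = refl

  locals-hold : decide locals ≡ true
  locals-hold = refl

certificate : Certificate
certificate = record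
  { proposal = proposal
  ; C-nonneg = +≤+ z≤n
  ; κ-nonneg = +≤+ z≤n
  ; A-nonneg = +≤+ z≤n
  ; u-bound = λ { (base i j ij ji) (flag k ik ki jk kj) (flag k′ ik′ ki′ jk′ kj′) →
      proj₁ (sound entries entries-hold i j ij ji k ik ki jk kj k′ ik′ ki′ jk′ kj′) }
  ; z-bound = λ { (base i j ij ji) (flag k ik ki jk kj) (flag k′ ik′ ki′ jk′ kj′) →
      proj₂ (sound entries entries-hold i j ij ji k ik ki jk kj k′ ik′ ki′ jk′ kj′) }
  ; roundTrip≤0 = λ m₀ m₁ m₂ m₃ s₀ s₁ s₂ s₃ t₀ t₁ t₂ t₃ s₀′ s₁′ s₂′ s₃′ t₀′ t₁′ t₂′ t₃′ h h₁ h₂ →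
      sound roundTrips roundTrips-hold m₀ m₁ m₂ m₃ h s₀ s₁ s₂ s₃ t₀ t₁ t₂ t₃ h₁ s₀′ s₁′ s₂′ s₃′ t₀′ t₁′ t₂′ t₃′ h₂
  ; local≥ = λ i j k l ij ji ik ki il li jk kj jl lj kl lk h →
      let h₁ = ∧-conicalʳ (not (three i j ij ji)) _ h
          h₂ = ∧-conicalʳ (not (three i k ik ki)) _ h₁
          h₃ = ∧-conicalʳ (not (three i l il li)) _ h₂
          h₄ = ∧-conicalʳ (not (three j k jk kj)) _ h₃
      in sound locals locals-hold i j k l
           ij ji (∧-conicalˡ (not (three i j ij ji)) _ h) ik ki (∧-conicalˡ (not (three i k ik ki)) _ h₁)
           il li (∧-conicalˡ (not (three i l il li)) _ h₂) jk kj (∧-conicalˡ (not (three j k jk kj)) _ h₃)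
           jl lj (∧-conicalˡ (not (three j l jl lj)) _ h₄) kl lk h
  }

-- The two bounds

-- From dimension 3 on, 8 divides the power of two, so the division in `numC4` is exact.
numC4-Q : ∀ x → let m = suc (suc x) ; n = suc m in numC4 (Q n) ≡ 2 ℕ.^ x ℕ.* (n ℕ.* m)
numC4-Q x = trans (cong (ℕ._/ 8) (ℤ.+-injective (begin
  + labelledC4 (Q n)                ≡⟨ ∑-Q n ⟩
  + (2 ℕ.^ n) * (+ n * + m)         ≡⟨ cong (_*_ (+ (2 ℕ.^ n))) (ℤ.pos-* n m) ⟨
  + (2 ℕ.^ n) * + (n ℕ.* m)         ≡⟨ ℤ.pos-* (2 ℕ.^ n) (n ℕ.* m) ⟨
  + (2 ℕ.^ n ℕ.* (n ℕ.* m))         ≡⟨ cong +_ (eight (2 ℕ.^ x) (n ℕ.* m)) ⟩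
  + (2 ℕ.^ x ℕ.* (n ℕ.* m) ℕ.* 8)   ∎)))
  (ℕ.m*n/n≡m (2 ℕ.^ x ℕ.* (n ℕ.* m)) 8)
  where
  open ≡-Reasoning
  m = suc (suc x)
  n = suc m
  eight : ∀ p y → 2 ℕ.* (2 ℕ.* (2 ℕ.* p)) ℕ.* y ≡ p ℕ.* y ℕ.* 8
  eight = solve 2 (λ p y → con 2 :* (con 2 :* (con 2 :* p)) :* y := p :* y :* con 8) refl
    where open ℕ-Solver

-- The labelled count is at least `2 ^ n * (n - 1) / 4`, and it is divided by 8 once more. From
-- dimension 5 on, 32 divides the power of two and rounding loses nothing.
lower-bound : ∀ x → let n = suc (suc (suc (suc (suc x)))) in
  25 ℕ.* numC4 (Q n) ℕ.≤ 100 ℕ.* n ℕ.* numC4 (lowGraph n)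
lower-bound x = begin
  25 ℕ.* numC4 (Q n) ≡⟨ cong (25 ℕ.*_) (numC4-Q (suc (suc x))) ⟩
  25 ℕ.* (2 ℕ.^ suc (suc x) ℕ.* (n ℕ.* m)) ≡⟨ regroup (2 ℕ.^ x) n m ⟩
  100 ℕ.* n ℕ.* (2 ℕ.^ x ℕ.* m) ≤⟨ ℕ.*-monoʳ-≤ (100 ℕ.* n) many ⟩
  100 ℕ.* n ℕ.* numC4 (lowGraph n) ∎
  where
  open ℕ.≤-Reasoning
  m = suc (suc (suc (suc x)))
  n = suc m
  regroup : ∀ p n y → 25 ℕ.* (2 ℕ.* (2 ℕ.* p) ℕ.* (n ℕ.* y)) ≡ 100 ℕ.* n ℕ.* (p ℕ.* y)
  regroup = solve 3 (λ p n y → con 25 :* (con 2 :* (con 2 :* p) :* (n :* y)) := con 100 :* n :* (p :* y)) refl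
    where open ℕ-Solver
  thirtyTwo : ∀ p y → 2 ℕ.* (2 ℕ.* (2 ℕ.* (2 ℕ.* (2 ℕ.* p)))) ℕ.* y ≡ 4 ℕ.* (p ℕ.* y ℕ.* 8)
  thirtyTwo = solve 2 (λ p y → con 2 :* (con 2 :* (con 2 :* (con 2 :* (con 2 :* p)))) :* y := con 4 :* (p :* y :* con 8)) refl
    where open ℕ-Solver
  labelled : 2 ℕ.^ x ℕ.* m ℕ.* 8 ℕ.≤ labelledC4 (lowGraph n)
  labelled = ℕ.*-cancelˡ-≤ 4 (ℤ.drop‿+≤+ (subst₂ _≤_
    (trans (sym (ℤ.pos-* (2 ℕ.^ n) m)) (cong +_ (thirtyTwo (2 ℕ.^ x) m)))
    (sym (ℤ.pos-* 4 (labelledC4 (lowGraph n)))) (lowGraph-count n)))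
  many : 2 ℕ.^ x ℕ.* m ℕ.≤ numC4 (lowGraph n)
  many = subst (ℕ._≤ numC4 (lowGraph n)) (ℕ.m*n/n≡m (2 ℕ.^ x ℕ.* m) 8) (ℕ./-monoˡ-≤ 8 labelled)

-- `P` stands for `2 ^ (n - 3)`. Cancelling 8 leaves `k * q ≤ P * (A * n + W)`; as the cube has
-- `P * n * (n - 1)` squares, `A * n + W` has to be compared with a multiple of `n - 1`.
upper-arithmetic : ∀ {k α β A m P L q} {W : ℤ} → let n = suc m in .{{ℕ.NonZero k}} →
  q ℕ.* 8 ℕ.≤ L →
  + k * + L ≤ + A * (+ n * + (P ℕ.* 8)) + W * + (P ℕ.* 8) →
  + α * (+ A * + n + W) ≤ + k * + β * + m →
  α ℕ.* n ℕ.* q ℕ.≤ β ℕ.* (P ℕ.* (n ℕ.* m))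
upper-arithmetic {k} {α} {β} {A} {m} {P} {L} {q} {W} q8≤L h h′ =
  ℤ.drop‿+≤+ (subst₂ _≤_ (sym left) (sym right)
    (ℤ.*-cancelˡ-≤-pos (+ α * + n * + q) (+ β * (+ P * (+ n * + m))) (+ k) {{positive (+<+ (ℕ.>-nonZero⁻¹ k))}} (begin
  + k * (+ α * + n * + q)                 ≡⟨ pull (+ k) (+ α) (+ n) (+ q) ⟩
  + α * (+ n * (+ k * + q))               ≤⟨ ℤ.*-monoˡ-≤-nonNeg (+ α) (ℤ.*-monoˡ-≤-nonNeg (+ n) perCycle) ⟩
  + α * (+ n * (+ P * (+ A * + n + W)))   ≡⟨ reorder (+ α) (+ n) (+ P) (+ A * + n + W) ⟩
  + n * (+ P * (+ α * (+ A * + n + W)))   ≤⟨ ℤ.*-monoˡ-≤-nonNeg (+ n) (ℤ.*-monoˡ-≤-nonNeg (+ P) h′) ⟩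
  + n * (+ P * (+ k * + β * + m))         ≡⟨ push (+ n) (+ P) (+ k) (+ β) (+ m) ⟩
  + k * (+ β * (+ P * (+ n * + m)))       ∎)))
  where
  open ℤ.≤-Reasoning
  open +-*-Solver using (solve; _:+_; _:*_; _:=_; con)
  n = suc m
  pull : ∀ k a n q → k * (a * n * q) ≡ a * (n * (k * q))
  pull = solve 4 (λ k a n q → k :* (a :* n :* q) := a :* (n :* (k :* q))) refl
  reorder : ∀ a n p x → a * (n * (p * x)) ≡ n * (p * (a * x))
  reorder = solve 4 (λ a n p x → a :* (n :* (p :* x)) := n :* (p :* (a :* x))) refl
  push : ∀ n p k b m → n * (p * (k * b * m)) ≡ k * (b * (p * (n * m)))
  push = solve 5 (λ n p k b m → n :* (p :* (k :* b :* m)) := k :* (b :* (p :* (n :* m)))) refl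
  eight : ∀ k q → k * (q * + 8) ≡ + 8 * (k * q)
  eight = solve 2 (λ k q → k :* (q :* con (+ 8)) := con (+ 8) :* (k :* q)) refl
  factor : ∀ a n p w → a * (n * (p * + 8)) + w * (p * + 8) ≡ + 8 * (p * (a * n + w))
  factor = solve 4 (λ a n p w → a :* (n :* (p :* con (+ 8))) :+ w :* (p :* con (+ 8)) := con (+ 8) :* (p :* (a :* n :+ w))) refl
  perCycle : + k * + q ≤ + P * (+ A * + n + W)
  perCycle = ℤ.*-cancelˡ-≤-pos (+ k * + q) (+ P * (+ A * + n + W)) (+ 8) (begin
    + 8 * (+ k * + q)       ≡⟨ eight (+ k) (+ q) ⟨
    + k * (+ q * + 8)       ≡⟨ cong (_*_ (+ k)) (ℤ.pos-* q 8) ⟨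
    + k * + (q ℕ.* 8)       ≤⟨ ℤ.*-monoˡ-≤-nonNeg (+ k) (+≤+ q8≤L) ⟩
    + k * + L               ≤⟨ h ⟩
    + A * (+ n * + (P ℕ.* 8)) + W * + (P ℕ.* 8) ≡⟨ cong (λ x → + A * (+ n * x) + W * x) (ℤ.pos-* P 8) ⟩
    + A * (+ n * (+ P * + 8)) + W * (+ P * + 8) ≡⟨ factor (+ A) (+ n) (+ P) W ⟩
    + 8 * (+ P * (+ A * + n + W)) ∎)
  left : + (α ℕ.* n ℕ.* q) ≡ + α * + n * + q
  left = trans (ℤ.pos-* (α ℕ.* n) q) (cong (_* + q) (ℤ.pos-* α n))
  right : + (β ℕ.* (P ℕ.* (n ℕ.* m))) ≡ + β * (+ P * (+ n * + m))
  right = trans (ℤ.pos-* β (P ℕ.* (n ℕ.* m))) (cong (_*_ (+ β)) (trans (ℤ.pos-* P (n ℕ.* m)) (cong (_*_ (+ P)) (ℤ.pos-* n m))))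

-- The slack `d` in the leading constant pays, from `n₀` on, both for `w` and for having `m` where
-- `1 + m` stood.
absorb : ∀ a d w {n₀ m} → 0ℤ ≤ d → w + a ≤ d * n₀ → n₀ ≤ m → a * (1ℤ + m) + w ≤ (a + d) * m
absorb a d w {n₀} {m} 0≤d h n₀≤m = begin
  a * (1ℤ + m) + w ≡⟨ solve 3 (λ a m w → a :* (con 1ℤ :+ m) :+ w := a :* m :+ (w :+ a)) refl a m w ⟩
  a * m + (w + a)  ≤⟨ ℤ.+-monoʳ-≤ (a * m) (ℤ.≤-trans h (ℤ.*-monoˡ-≤-nonNeg d {{nonNegative 0≤d}} n₀≤m)) ⟩
  a * m + d * m    ≡⟨ ℤ.*-distribʳ-+ m a d ⟨
  (a + d) * m      ∎
  where
  open ℤ.≤-Reasoning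
  open +-*-Solver

-- `excess` is about 3.3 * 10^14, that is 2.2 * 10^6 in units of `4 κ`, while 0.36578 exceeds
-- `A / 4κ` by about 6.1 * 10^-5. The quotient is about 3.62 * 10^10.
threshold : ℕ
threshold = 39999999999

upper-bound : ∀ m P → 2 ℕ.^ suc m ≡ P ℕ.* 8 → numC4 (Q (suc m)) ≡ P ℕ.* (suc m ℕ.* m) → threshold ℕ.≤ m →
  (G : Subgraph (suc m)) → C6Free G → 100000 ℕ.* suc m ℕ.* numC4 G ℕ.≤ 36578 ℕ.* numC4 (Q (suc m))
upper-bound m P power count large G free = subst (λ c → 100000 ℕ.* suc m ℕ.* numC4 G ℕ.≤ 36578 ℕ.* c) (sym count)
  (upper-arithmetic {k = 150000000} {α = 100000} {β = 36578} {A = 54857869} {m = m} {P = P} {L = labelledC4 G} {q = numC4 G} {W = W}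
    (ℕ.m/n*n≤m (labelledC4 G) 8)
    (subst (λ p → + 150000000 * + labelledC4 G ≤ + 54857869 * (+ suc m * + p) + W * + p) power
      (labelledC4≤ G free certificate))
    main)
  where
  W : ℤ
  W = excess G free certificate
  open ℤ.≤-Reasoning
  main : + 100000 * (+ 54857869 * + suc m + W) ≤ + 150000000 * + 36578 * + m
  main = begin
    + 100000 * (+ 54857869 * + suc m + W) ≡⟨ ℤ.*-distribˡ-+ (+ 100000) (+ 54857869 * + suc m) W ⟩
    + 100000 * (+ 54857869 * + suc m) + + 100000 * W ≡⟨ cong (_+ + 100000 * W) (ℤ.*-assoc (+ 100000) (+ 54857869) (+ suc m)) ⟨
    + 100000 * + 54857869 * + suc m + + 100000 * W
      -- 913100000 is `150000000 * 36578 - 100000 * 54857869`.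
      ≤⟨ absorb (+ 100000 * + 54857869) (+ 913100000) (+ 100000 * W) (+≤+ z≤n) (ℤ.≤ᵇ⇒≤ tt) (+≤+ large) ⟩
    + 150000000 * + 36578 * + m ∎

theorem2 : ∃[ N ] ∀ (n : ℕ) → N ℕ.≤ n →
    ((∃[ G ] (C6Free {n} G × 25 ℕ.* numC4 (Q n) ℕ.≤ 100 ℕ.* n ℕ.* numC4 G))
    × (∀ (G : Subgraph n) → C6Free G → 100000 ℕ.* n ℕ.* numC4 G ℕ.≤ 36578 ℕ.* numC4 (Q n)))
theorem2 = suc threshold , eventually
  where
  four≤ : 4 ℕ.≤ threshold
  four≤ = ℕ.≤ᵇ⇒≤ 4 threshold tt
  lower : ∀ m → 4 ℕ.≤ m → 25 ℕ.* numC4 (Q (suc m)) ℕ.≤ 100 ℕ.* suc m ℕ.* numC4 (lowGraph (suc m))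
  lower (suc (suc (suc (suc x)))) (s≤s (s≤s (s≤s (s≤s _)))) = lower-bound x
  power : ∀ m → 4 ℕ.≤ m → 2 ℕ.^ suc m ≡ 2 ℕ.^ (m ℕ.∸ 2) ℕ.* 8
  power (suc (suc x)) (s≤s (s≤s _)) =
    solve 1 (λ p → con 2 :* (con 2 :* (con 2 :* p)) := p :* con 8) refl (2 ℕ.^ x)
    where open ℕ-Solver
  count : ∀ m → 4 ℕ.≤ m → numC4 (Q (suc m)) ≡ 2 ℕ.^ (m ℕ.∸ 2) ℕ.* (suc m ℕ.* m)
  count (suc (suc x)) (s≤s (s≤s _)) = numC4-Q x
  eventually : ∀ n → suc threshold ℕ.≤ n →
    ((∃[ G ] (C6Free {n} G × 25 ℕ.* numC4 (Q n) ℕ.≤ 100 ℕ.* n ℕ.* numC4 G))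
    × (∀ (G : Subgraph n) → C6Free G → 100000 ℕ.* n ℕ.* numC4 G ℕ.≤ 36578 ℕ.* numC4 (Q n)))
  eventually (suc m) (s≤s large) =
    (lowGraph (suc m) , lowGraph-C6Free (suc m) , lower m 4≤m)
    , upper-bound m (2 ℕ.^ (m ℕ.∸ 2)) (power m 4≤m) (count m 4≤m) large
    where 4≤m = ℕ.≤-trans four≤ large
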